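{- For every integer $n \geq 2$, there is a bijection between the set of 3-connected planar linear normal $\lambda$-terms with $n$ variables (i.e. $n$ atoms) and the set of rooted bipartite planar maps with $n-2$ edges.
   Context: $\lambda$-terms are built from atoms (variables), applications $t\,u$ and abstractions $\lambda x.t$ (which bind the not-yet-bound atoms $x$ in $t$), considered up to $\alpha$-renaming. A term is linear if it is closed and each abstraction binds exactly one atom; it is (β-)normal if it has no sub-term of the form $(\lambda x.u)\,v$. The skeleton $\operatorname{Sk}(t)$ is the plane unary-binary tree defined by: an atom gives a leaf; an application $u\,v$ gives a binary node with left subtree $\operatorname{Sk}(u)$ and right subtree $\operatorname{Sk}(v)$; an abstraction $\lambda x.u$ gives a unary node with only subtree $\operatorname{Sk}(u)$. The number of variables (size) of $t$ is the number of leaves of $\operatorname{Sk}(t)$. The diagram $\operatorname{Diag}(t)$ is the graph obtained from $\operatorname{Sk}(t)$ by replacing each leaf by an edge from the leaf's parent to the unary node of the abstraction binding that atom; this edge is drawn starting from the parent of the leaf, travelling counter-clockwise, and entering the unary node from the right. The term $t$ is planar if all these edges can be drawn without crossings (for linear terms: reading unary nodes and leaves by first visit in the clockwise contour walk of the skeleton from the root gives a well-parenthesized word, unary nodes as opening and leaves as closing parentheses, each abstraction matched with the atom it binds). A term $t$ is 3-connected if removing any two edges of $\operatorname{Diag}(t)$ does not disconnect $\operatorname{Diag}(t)$, except possibly the pair of two edges adjacent to the root of $\operatorname{Sk}(t)$ when $t$ starts with an abstraction binding one atom. A rooted planar map is a planar map (graph embedded in the plane, up to orientation-preserving deformation) with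 a marked corner on the outer face (root corner), whose vertex is the root vertex; the empty map is a single vertex. A planar map is bipartite if its vertices can be colored black and white so that every edge joins a black and a white vertex. -}

module Defs where

open import Data.Bool using (Bool; not)
open import Data.Empty using (⊥)
open import Data.Fin using (Fin; zero; suc)
open import Data.List using (List; []; _∷_; [_]; _++_; map)
open import Data.Nat using (ℕ; zero; suc; _+_)
open import Data.Product using (∃; ∃₂; ∃-syntax; ∃!; _×_; _,_; proj₁; map₂)
open import Data.Sum as Sum using (_⊎_; inj₁; inj₂; [_,_]′; fromInj₂)
open import Data.Unit using (⊤)
open import Function using (_∘_; id; _↔_; Func; Bijection; Inverse)
open import Function.Construct.Composition using (_↔-∘_)
open import Function.Construct.Identity using (↔-id)
open import Function.Construct.Symmetry using (↔-sym)
open import Level using (0ℓ)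
open import Relation.Binary.Bundles using (Setoid)
open import Relation.Binary.Construct.Closure.Equivalence as EqC using (EqClosure)
import Relation.Binary.Construct.On as On
open import Relation.Binary.PropositionalEquality
  using (_≡_; _≢_; refl; cong; trans; setoid; module ≡-Reasoning)
open import Relation.Nullary using (¬_)

-- Well-scoped de Bruijn terms: α-equivalence is propositional equality, and
-- Term 0 is the type of closed terms.

data Term (k : ℕ) : Set where
  var : Fin k → Term k
  app : Term k → Term k → Term k
  lam : Term (suc k) → Term k

data _⊑_ {j : ℕ} (s : Term j) : {k : ℕ} → Term k → Set where
  here : s ⊑ s
  appˡ : ∀ {k} {u v : Term k} → s ⊑ u → s ⊑ app u v
  appʳ : ∀ {k} {u v : Term k} → s ⊑ v → s ⊑ app u v
  lam  : ∀ {k} {u : Term (suc k)} → s ⊑ u → s ⊑ lam u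

Normal : Term 0 → Set
Normal t = ∀ {j} (u : Term (suc j)) (v : Term j) → ¬ (app (lam u) v ⊑ t)

data Tree : Set where
  leaf   : Tree
  unary  : Tree → Tree
  binary : Tree → Tree → Tree

leaves : Tree → ℕ
leaves leaf         = 1
leaves (unary s)    = leaves s
leaves (binary s r) = leaves s + leaves r

Sk : ∀ {k} → Term k → Tree
Sk (var _)   = leaf
Sk (app u v) = binary (Sk u) (Sk v)
Sk (lam u)   = unary (Sk u)

size : ∀ {k} → Term k → ℕ
size t = leaves (Sk t)

data Leaf : Tree → Set where
  here  : Leaf leaf
  down  : ∀ {s} → Leaf s → Leaf (unary s)
  left  : ∀ {s r} → Leaf s → Leaf (binary s r)
  right : ∀ {s r} → Leaf r → Leaf (binary s r)

data Arity : Set where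
  unary binary : Arity

data Node : Arity → Tree → Set where
  unary  : ∀ {s} → Node unary (unary s)
  binary : ∀ {s r} → Node binary (binary s r)
  down   : ∀ {a s} → Node a s → Node a (unary s)
  left   : ∀ {a s r} → Node a s → Node a (binary s r)
  right  : ∀ {a s r} → Node a r → Node a (binary s r)

Inner : Tree → Set
Inner s = ∃[ a ] Node a s

data TreeEdge : Tree → Set where
  below  : ∀ {s} → TreeEdge (unary s)
  belowˡ : ∀ {s r} → TreeEdge (binary s r)
  belowʳ : ∀ {s r} → TreeEdge (binary s r)
  down   : ∀ {s} → TreeEdge s → TreeEdge (unary s)
  left   : ∀ {s r} → TreeEdge s → TreeEdge (binary s r)
  right  : ∀ {s r} → TreeEdge r → TreeEdge (binary s r)

parent : ∀ {s} → TreeEdge s → Inner s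
parent below     = unary , unary
parent belowˡ    = binary , binary
parent belowʳ    = binary , binary
parent (down e)  = map₂ down (parent e)
parent (left e)  = map₂ left (parent e)
parent (right e) = map₂ right (parent e)

root : ∀ s → Leaf s ⊎ Inner s
root leaf         = inj₁ here
root (unary _)    = inj₂ (unary , unary)
root (binary _ _) = inj₂ (binary , binary)

child : ∀ {s} → TreeEdge s → Leaf s ⊎ Inner s
child (below {s})      = Sum.map down (map₂ down) (root s)
child (belowˡ {s})     = Sum.map left (map₂ left) (root s)
child (belowʳ {r = r}) = Sum.map right (map₂ right) (root r)
child (down e)         = Sum.map down (map₂ down) (child e)
child (left e)         = Sum.map left (map₂ left) (child e)
child (right e)        = Sum.map right (map₂ right) (child e)

-- The left summand is for atoms that are free in the (open) term.
open-binder : ∀ {k} (t : Term k) → Leaf (Sk t) → Fin k ⊎ Node unary (Sk t)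
open-binder (var i)   here      = inj₁ i
open-binder (app u v) (left ℓ)  = Sum.map₂ left (open-binder u ℓ)
open-binder (app u v) (right ℓ) = Sum.map₂ right (open-binder v ℓ)
open-binder (lam u)   (down ℓ)  = [ bound , inj₂ ∘ down ]′ (open-binder u ℓ)
  where
  bound : ∀ {k s} → Fin (suc k) → Fin k ⊎ Node unary (unary s)
  bound zero    = inj₂ unary
  bound (suc i) = inj₁ i

binder : (t : Term 0) → Leaf (Sk t) → Node unary (Sk t)
binder t ℓ = fromInj₂ (λ ()) (open-binder t ℓ)

BindsExactlyOne : (t : Term 0) → Node unary (Sk t) → Set
BindsExactlyOne t a = ∃! _≡_ λ ℓ → binder t ℓ ≡ a

Linear : Term 0 → Set
Linear t = ∀ a → BindsExactlyOne t a

-- Loops and multiple edges are allowed; the direction of an edge is irrelevant.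
record Multigraph : Set₁ where
  field
    Vertex Edge : Set
    end₁ end₂   : Edge → Vertex

  _∈ends_ : Vertex → Edge → Set
  x ∈ends e = end₁ e ≡ x ⊎ end₂ e ≡ x

  ConnectedVia : (Edge → Set) → Set
  ConnectedVia P =
    ∀ x y → EqClosure (λ x y → ∃[ e ] P e × end₁ e ≡ x × end₂ e ≡ y) x y

  ConnectedWithout : Edge → Edge → Set
  ConnectedWithout e f = ConnectedVia (λ g → g ≢ e × g ≢ f)

-- A skeleton edge whose lower end is a leaf becomes an edge from the parent of
-- that leaf to the binder of the corresponding atom.
Diag : Term 0 → Multigraph
Diag t = record
  { Vertex = Inner (Sk t)
  ; Edge   = TreeEdge (Sk t)
  ; end₁   = parent
  ; end₂   = λ e → [ (λ ℓ → unary , binder t ℓ) , id ]′ (child e)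
  }

BothAtRootAbstraction : (t : Term 0) (e f : TreeEdge (Sk t)) → Set
BothAtRootAbstraction (app _ _) _ _ = ⊥
BothAtRootAbstraction t@(lam _) e f =
  BindsExactlyOne t unary × (unary , unary) ∈ends e × (unary , unary) ∈ends f
  where open Multigraph (Diag t)

ThreeConnected : Term 0 → Set
ThreeConnected t =
  ∀ e f → e ≢ f → ¬ BothAtRootAbstraction t e f → ConnectedWithout e f
  where open Multigraph (Diag t)

Letter : Tree → Set
Letter s = Node unary s ⊎ Leaf s

-- Unary nodes and leaves by first visit.  The skeleton has its root at the top
-- (so that an edge running counter-clockwise from a leaf enters a unary node
-- from the right), hence the clockwise walk explores right subtrees first.
contour : ∀ s → List (Letter s)
contour leaf         = [ inj₂ here ]
contour (unary s)    = inj₁ unary ∷ map (Sum.map down down) (contour s)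
contour (binary s r) = map (Sum.map right right) (contour r)
                    ++ map (Sum.map left left) (contour s)

-- Well-parenthesized words in which each opening letter a is closed by a letter
-- ℓ with binder t ℓ ≡ a.
data WellParenthesized (t : Term 0) : List (Letter (Sk t)) → Set where
  []    : WellParenthesized t []
  match : ∀ {a ℓ w w′} → binder t ℓ ≡ a →
          WellParenthesized t w → WellParenthesized t w′ →
          WellParenthesized t (inj₁ a ∷ w ++ inj₂ ℓ ∷ w′)

-- For linear terms only.
Planar : Term 0 → Set
Planar t = WellParenthesized t (contour (Sk t))

record 3ConnectedPlanarLinearNormalTerm (n : ℕ) : Set where
  field
    term           : Term 0
    linear         : Linear term
    normal         : Normal term
    planar         : Planar term
    threeConnected : ThreeConnected term
    size≡n         : size term ≡ n

Terms : ℕ → Setoid 0ℓ 0ℓ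
Terms n = On.setoid (setoid (Term 0)) (3ConnectedPlanarLinearNormalTerm.term {n})

-- Planar maps are encoded as combinatorial maps (rotation systems): a connected
-- graph with m edges, cut into 2m darts, embedded in an oriented surface by a
-- permutation sending each dart to the next one counter-clockwise around its
-- vertex.  The surface is a sphere when Euler's formula holds.

Dart : ℕ → Set
Dart m = Fin m × Bool

opposite : ∀ {m} → Dart m → Dart m
opposite (e , b) = e , not b

Orbits : {A : Set} → (A → A) → Setoid 0ℓ 0ℓ
Orbits f = EqC.setoid (λ x y → f x ≡ y)

HasCardinality : Setoid 0ℓ 0ℓ → ℕ → Set
HasCardinality S k = Bijection S (setoid (Fin k))

record PlanarMap (m : ℕ) : Set where
  field
    rotation : Dart m ↔ Dart m

  next : Dart m → Dart m
  next = Inverse.to rotation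

  Vertices : Setoid 0ℓ 0ℓ
  Vertices = Orbits next

  Faces : Setoid 0ℓ 0ℓ
  Faces = Orbits (next ∘ opposite)

  field
    connected : ∀ d d′ → EqClosure (λ x y → next x ≡ y ⊎ opposite x ≡ y) d d′
    euler     : ∃₂ λ v f → HasCardinality Vertices v × HasCardinality Faces f
                         × v + f ≡ m + 2

-- A dart d stands for the corner between d and next d.  The outer face is the
-- one containing the root corner, so no further datum is needed to pass from
-- the sphere to the plane.  The single vertex has a corner but no dart, whence
-- the separate constructor.
data RootedPlanarMap : ℕ → Set where
  empty  : RootedPlanarMap 0
  rooted : ∀ {m} → PlanarMap m → Dart m → RootedPlanarMap m

-- Orientation-preserving, root-preserving isomorphism.
data _≅_ : ∀ {m} → RootedPlanarMap m → RootedPlanarMap m → Set where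
  empty  : empty ≅ empty
  rooted : ∀ {m} {M N : PlanarMap m} {r s : Dart m} (φ : Dart m ↔ Dart m) →
           let open Inverse φ using (to) in
           (∀ d → to (PlanarMap.next M d) ≡ PlanarMap.next N (to d)) →
           (∀ d → to (opposite d) ≡ opposite (to d)) →
           to r ≡ s →
           rooted M r ≅ rooted N s

≅-refl : ∀ {m} {x : RootedPlanarMap m} → x ≅ x
≅-refl {x = empty}      = empty
≅-refl {x = rooted _ _} = rooted (↔-id _) (λ _ → refl) (λ _ → refl) refl

≅-sym : ∀ {m} {x y : RootedPlanarMap m} → x ≅ y → y ≅ x
≅-sym empty = empty
≅-sym (rooted {M = M} {N} φ n o refl) =
  rooted (↔-sym φ)
    (swap (PlanarMap.next M) (PlanarMap.next N) n)
    (swap opposite opposite o)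
    (strictlyInverseʳ _)
  where
  open Inverse φ
  swap : ∀ f g → (∀ d → to (f d) ≡ g (to d)) → ∀ d → from (g d) ≡ f (from d)
  swap f g h d = begin
    from (g d)             ≡⟨ cong (from ∘ g) (strictlyInverseˡ d) ⟨
    from (g (to (from d))) ≡⟨ cong from (h (from d)) ⟨
    from (to (f (from d))) ≡⟨ strictlyInverseʳ _ ⟩
    f (from d)             ∎
    where open ≡-Reasoning

≅-trans : ∀ {m} {x y z : RootedPlanarMap m} → x ≅ y → y ≅ z → x ≅ z
≅-trans empty empty = empty
≅-trans (rooted φ n o refl) (rooted ψ n′ o′ refl) =
  rooted (ψ ↔-∘ φ)
    (λ d → trans (cong (Inverse.to ψ) (n d)) (n′ _))
    (λ d → trans (cong (Inverse.to ψ) (o d)) (o′ _))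
    refl

RootedPlanarMaps : ℕ → Setoid 0ℓ 0ℓ
RootedPlanarMaps m = record
  { Carrier       = RootedPlanarMap m
  ; _≈_           = _≅_
  ; isEquivalence = record { refl = ≅-refl ; sym = ≅-sym ; trans = ≅-trans }
  }

-- The function being defined on Vertices, it is constant on vertices.
Bipartite : ∀ {m} → RootedPlanarMap m → Set
Bipartite empty        = ⊤
Bipartite (rooted M _) =
  ∃ λ (colour : Func (PlanarMap.Vertices M) (setoid Bool)) →
    ∀ d → Func.to colour d ≢ Func.to colour (opposite d)

BipartiteMaps : ℕ → Setoid 0ℓ 0ℓ
BipartiteMaps m = On.setoid (RootedPlanarMaps m) (proj₁ {B = Bipartite})

module Submission where

-- Both families are encoded by the same trees.  Deleting the root edge of a
-- bipartite map leaves two maps (a bridge), or one map with root face of degree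
-- 2d together with one of the d corners of that face at odd distance from the
-- root (a chord).  On the other side, a 3-connected planar linear normal term is
-- λx.λy₁…yₖ. x v where v is regular: in every maximal subterm
-- λz₁…zⱼ. h v₁ … vₚ with p ≥ 1, the last argument vₚ has more than j free
-- variables.  (If it had m ≤ j of them, the edge above λzⱼ₋ₘ₊₁…zⱼ. h v₁ … vₚ and
-- the edge above h v₁ … vₚ₋₁ would form a cut.)  A regular term is x, or arises from
-- two regular terms by inserting one of them before the last argument of the
-- other (a bridge), or is λz₁…zⱼ. x v where v is regular with more than j ≥ 1 free
-- variables (a chord).  The number of free variables of a regular term is half the
-- degree of the root face plus one.
--
-- Genus enters as follows: every rooted map, of any genus, decomposes into
-- bridges and chords, where a chord adds a face when its ends lie in the same
-- face and merges two faces otherwise, so Euler's formula holds iff all chords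
-- are of the first kind.  That regular terms are 3-connected follows by colouring
-- the components left by the deletion of two edges: unless the colouring is
-- constant, at least three edges join vertices of different colours.

open import Data.Bool as Bool using (Bool; true; false; not)
import Data.Bool.Properties as Boolₚ
open import Data.Empty using (⊥; ⊥-elim)
open import Data.Fin as Fin using (Fin; zero; suc; punchOut; _↑ˡ_; _↑ʳ_; splitAt; join)
open import Data.Fin.Permutation using (↔⇒≡)
import Data.Fin.Properties as Finₚ
open import Data.List using (List; []; _∷_; [_]; _++_; map; length; filter; take; drop; cartesianProduct; allFin)
open import Data.List.Membership.Propositional using (_∈_; find; lose)
open import Data.List.Membership.Propositional.Properties
  using (∈-++⁺ˡ; ∈-++⁺ʳ; ∈-++⁻; ∈-map⁺; ∈-map⁻; ∈-filter⁺; ∈-filter⁻; ∈-cartesianProduct⁺; ∈-allFin)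
import Data.List.Properties as List
open import Data.List.Relation.Unary.All as All using (All; []; _∷_)
import Data.List.Relation.Unary.All.Properties as Allₚ
open import Data.List.Relation.Unary.AllPairs using ([]; _∷_)
open import Data.List.Relation.Unary.Any using (Any; here; there)
open import Data.List.Relation.Unary.Unique.Propositional using (Unique)
import Data.List.Relation.Unary.Unique.Propositional.Properties as Uniqueₚ
open import Data.Maybe as Maybe using (Maybe; just; nothing)
open import Data.Maybe.Properties using (just-injective)
import Data.Maybe.Properties as Maybeₚ
open import Data.Nat using (ℕ; zero; suc; _+_; _*_; _∸_; _≤_; _<_; _≥_; z≤n; s≤s; _<?_; _/_; _%_; NonZero; >-nonZero)
import Data.Nat.DivMod as DivMod
import Data.Nat.Properties as ℕ
open import Data.Nat.Tactic.RingSolver using (solve-∀)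
open import Data.Product as Prod using (Σ; ∃; ∃-syntax; _×_; _,_; proj₁; proj₂; map₂)
open import Data.Product.Function.NonDependent.Propositional using (_×-↔_)
import Data.Product.Properties as Prodₚ
open import Data.Sum as Sum using (_⊎_; inj₁; inj₂; [_,_]′)
import Data.Sum.Properties as Sumₚ
open import Data.Unit using (⊤; tt)
open import Function using (_∘_; id; case_of_; _↔_; Inverse; Func; Bijection; mk↔ₛ′)
open import Function.Construct.Composition using (_↔-∘_)
open import Function.Construct.Identity using (↔-id)
open import Function.Construct.Symmetry using (↔-sym)
open import Level using (0ℓ)
open import Relation.Binary.Bundles using (Setoid)
open import Relation.Binary.Construct.Closure.Equivalence as EqC using (EqClosure)
open import Relation.Binary.Construct.Closure.ReflexiveTransitive using (ε; _◅_)
open import Relation.Binary.Construct.Closure.Symmetric using (fwd; bwd)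
open import Relation.Binary.Definitions using (DecidableEquality; tri<; tri≈; tri>)
open import Relation.Binary.PropositionalEquality hiding ([_])
open import Relation.Nullary using (¬_; yes; no; Dec; contradiction; ¬?)
open import Relation.Nullary.Decidable using (_×-dec_; map′)
open import Relation.Unary using (Decidable)
open import Defs


-- Cycles of permutations

-- Maps are compared up to isomorphism but terms up to equality, so the map side needs canonical
-- representatives. `Gen` provides them: the decomposition of a rooted map is unique (`emb-unique`).
-- Deleting the root edge would lead out of the type of numbered darts and may disconnect the map.
-- Instead, all permutations keep acting on one type, deleted darts become fixed points, and an
-- `Emb` picks out the component of the root. It is rigid because every dart is reached from the
-- root, which turns isomorphisms into equalities of decompositions. The empty map has a corner but
-- no dart, whence the virtual dart that `Maybe (Darts c)` adds at the root corner. `Planar` speaks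
-- of closed terms only; listing the free variables in the order in which the contour closes them
-- gives the compositional form `t ⊢ xs`. In the whole term the argument `v` uses all bound
-- variables but `x`, so regularity fails there. The cut that results is the pair of edges at the
-- root exempted in `ThreeConnected`; this is why `Body` is separate from `Regular`.

Injective : {A B : Set} → (A → B) → Set
Injective f = ∀ {x y} → f x ≡ f y → x ≡ y

to-injective : {A B : Set} (f : A ↔ B) → Injective (Inverse.to f)
to-injective f e = trans (sym (Inverse.strictlyInverseʳ f _)) (trans (cong (Inverse.from f) e) (Inverse.strictlyInverseʳ f _))

iter : {A : Set} → (A → A) → ℕ → A → A
iter f zero    x = x
iter f (suc n) x = iter f n (f x)

module _ {A : Set} (f : A → A) where

  iter-+ : ∀ m n x → iter f (m + n) x ≡ iter f n (iter f m x)
  iter-+ zero    n x = refl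
  iter-+ (suc m) n x = iter-+ m n (f x)

  iter-suc : ∀ n x → iter f (suc n) x ≡ f (iter f n x)
  iter-suc zero    x = refl
  iter-suc (suc n) x = iter-suc n (f x)

  iter-closed : (P : A → Set) → (∀ {x} → P x → P (f x)) → ∀ n {x} → P x → P (iter f n x)
  iter-closed P h zero    p = p
  iter-closed P h (suc n) p = iter-closed P h n (h p)

  iter-cancel : Injective f → ∀ m n x → iter f m x ≡ iter f (m + n) x → x ≡ iter f n x
  iter-cancel inj zero    n x eq = eq
  iter-cancel inj (suc m) n x eq = inj (trans (iter-cancel inj m n (f x) eq) (iter-suc n x))

iter-cong : {A : Set} {f g : A → A} → (∀ x → f x ≡ g x) → ∀ n x → iter f n x ≡ iter g n x
iter-cong h zero    x = refl
iter-cong {g = g} h (suc n) x = trans (iter-cong h n _) (cong (iter g n) (h x))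

iter-map : {A B : Set} {f : A → A} {g : B → B} (h : A → B) → (∀ x → h (f x) ≡ g (h x)) →
           ∀ n x → h (iter f n x) ≡ iter g n (h x)
iter-map h c zero    x = refl
iter-map {g = g} h c (suc n) x = trans (iter-map h c n _) (cong (iter g n) (c x))

Reach : {A : Set} → (A → A) → A → A → Set
Reach π x y = ∃[ n ] iter π n x ≡ y

reach-trans : {A : Set} {π : A → A} {x y z : A} → Reach π x y → Reach π y z → Reach π x z
reach-trans {π = π} {x} (m , refl) (n , eq) = m + n , trans (iter-+ π m n x) eq

reach-closed : {A : Set} {π : A → A} (P : A → Set) → (∀ {x} → P x → P (π x)) →
               ∀ {x y} → Reach π x y → P x → P y
reach-closed {π = π} P h (n , refl) = iter-closed π P h n

-- y is the n-th iterate of x, and not an earlier one (the 0-th excepted).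
First : {A : Set} → (A → A) → A → ℕ → A → Set
First π x n y = iter π n x ≡ y × (∀ j → 0 < j → j < n → iter π j x ≢ y)

-- A numbering of the cycles of a permutation: two elements with the same label
-- are related by forward iteration.
record Count {A : Set} (π : A → A) (k : ℕ) : Set where
  field
    lab      : A → Fin k
    lab-π    : ∀ x → lab (π x) ≡ lab x
    rep      : Fin k → A
    lab-rep  : ∀ i → lab (rep i) ≡ i
    complete : ∀ {x y} → lab x ≡ lab y → Reach π x y

  lab-reach : ∀ {x y} → Reach π x y → lab x ≡ lab y
  lab-reach {x} r = sym (reach-closed (λ z → lab z ≡ lab x) (trans (lab-π _)) r refl)

  reach-sym : ∀ {x y} → Reach π x y → Reach π y x
  reach-sym r = complete (sym (lab-reach r))

  preimage : ∀ y → ∃[ x ] π x ≡ y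
  preimage y with complete (lab-π y)
  ... | n , eq = iter π n y , trans (sym (iter-suc π n y)) eq

open Count

count-cong : ∀ {A : Set} {π ρ : A → A} {k} → (∀ x → π x ≡ ρ x) → Count π k → Count ρ k
count-cong h C = record
  { lab = lab C
  ; lab-π = λ x → trans (cong (lab C) (sym (h x))) (lab-π C x)
  ; rep = rep C
  ; lab-rep = lab-rep C
  ; complete = λ {x} e → case complete C e of λ where
      (n , eq) → n , trans (sym (iter-cong h n x)) eq
  }

count-⊥ : ∀ {π : ⊥ → ⊥} → Count π 0
count-⊥ = record { lab = λ () ; lab-π = λ () ; rep = λ () ; lab-rep = λ () ; complete = λ {x} → ⊥-elim x }

count-⊎ : ∀ {A B : Set} {π : A → A} {ρ : B → B} {k l} →
          Count π k → Count ρ l → Count (Sum.map π ρ) (k + l)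
count-⊎ {π = π} {ρ} {k} {l} C E = record
  { lab      = lab′
  ; lab-π    = λ where
      (inj₁ x) → cong (_↑ˡ l) (lab-π C x)
      (inj₂ y) → cong (k ↑ʳ_) (lab-π E y)
  ; rep      = Sum.map (rep C) (rep E) ∘ splitAt k
  ; lab-rep  = lab-rep′
  ; complete = λ {x} {y} → complete′ x y
  }
  where
  lab′ : _ → Fin (k + l)
  lab′ = join k l ∘ Sum.map (lab C) (lab E)
  lab-rep′ : ∀ i → lab′ (Sum.map (rep C) (rep E) (splitAt k i)) ≡ i
  lab-rep′ i with splitAt k i in eq
  ... | inj₁ j = trans (cong (_↑ˡ l) (lab-rep C j)) (Finₚ.splitAt⁻¹-↑ˡ eq)
  ... | inj₂ j = trans (cong (k ↑ʳ_) (lab-rep E j)) (Finₚ.splitAt⁻¹-↑ʳ {m = k} eq)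
  inj-join : ∀ x y → lab′ x ≡ lab′ y → Sum.map (lab C) (lab E) x ≡ Sum.map (lab C) (lab E) y
  inj-join x y e = trans (sym (Finₚ.splitAt-join k l _)) (trans (cong (splitAt k) e) (Finₚ.splitAt-join k l _))
  complete′ : ∀ x y → lab′ x ≡ lab′ y → Reach (Sum.map π ρ) x y
  complete′ x y e with x | y | inj-join x y e
  ... | inj₁ a | inj₁ b | e′ with complete C (Sumₚ.inj₁-injective e′)
  ... | n , refl = n , sym (iter-map {f = π} inj₁ (λ _ → refl) n a)
  complete′ x y e | inj₂ a | inj₂ b | e′ with complete E (Sumₚ.inj₂-injective e′)
  ... | n , refl = n , sym (iter-map {f = ρ} inj₂ (λ _ → refl) n a)
  complete′ x y e | inj₁ a | inj₂ b | ()
  complete′ x y e | inj₂ a | inj₁ b | ()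

module _ {A : Set} (_≟_ : DecidableEquality A) where

  private
    _≟ₘ_ : DecidableEquality (Maybe A)
    _≟ₘ_ = Maybeₚ.≡-dec _≟_

  -- Inserts a new element after m in its cycle, as a fixed point when m = nothing.
  ins : (A → A) → Maybe A → Maybe A → Maybe A
  ins π m nothing  = Maybe.map π m
  ins π m (just d) with m ≟ₘ just d
  ... | yes _ = nothing
  ... | no  _ = just (π d)

  ins-at : ∀ π x → ins π (just x) (just x) ≡ nothing
  ins-at π x with just x ≟ₘ just x
  ... | yes _ = refl
  ... | no ne = contradiction refl ne

  ins-off : ∀ π m d → m ≢ just d → ins π m (just d) ≡ just (π d)
  ins-off π m d ne with m ≟ₘ just d
  ... | yes e = contradiction e ne
  ... | no  _ = refl

  ins-injective : ∀ {π} m → Injective π → Injective (ins π m)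
  ins-injective {π} m inj {nothing} {nothing} e = refl
  ins-injective {π} m inj {nothing} {just y} e with m ≟ₘ just y
  ins-injective {π} (just x) inj {nothing} {just y} () | yes _
  ins-injective {π} (just x) inj {nothing} {just y} e | no ne =
    contradiction (cong just (inj (just-injective e))) ne
  ins-injective {π} m inj {just x} {nothing} e with m ≟ₘ just x
  ins-injective {π} (just y) inj {just x} {nothing} () | yes _
  ins-injective {π} (just y) inj {just x} {nothing} e | no ne =
    contradiction (cong just (sym (inj (just-injective e)))) ne
  ins-injective {π} m inj {just x} {just y} e with m ≟ₘ just x | m ≟ₘ just y
  ... | yes p | yes q = trans (sym p) q
  ... | no  _ | no  _ = cong just (inj (just-injective e))
  ins-injective {π} m inj {just x} {just y} () | yes _ | no _
  ins-injective {π} m inj {just x} {just y} () | no _ | yes _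

  ins-step : ∀ π x a → Reach (ins π (just x)) (just a) (just (π a))
  ins-step π x a with just x ≟ₘ just a
  ... | no ne    = 1 , ins-off π (just x) a ne
  ... | yes refl = 2 , cong (ins π (just x)) (ins-at π x)

  ins-reach : ∀ π x n a → Reach (ins π (just x)) (just a) (just (iter π n a))
  ins-reach π x zero    a = 0 , refl
  ins-reach π x (suc n) a = reach-trans (ins-step π x a) (ins-reach π x n (π a))

  count-ins : ∀ {π k} x → Count π k → Count (ins π (just x)) k
  count-ins {π} {k} x C = record
    { lab = lab′ ; lab-π = lab-π′ ; rep = just ∘ rep C ; lab-rep = lab-rep C
    ; complete = λ {a} {b} → complete′ a b }
    where
    lab′ : Maybe A → Fin k
    lab′ nothing  = lab C x
    lab′ (just d) = lab C d
    lab-π′ : ∀ m → lab′ (ins π (just x) m) ≡ lab′ m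
    lab-π′ nothing  = lab-π C x
    lab-π′ (just d) with just x ≟ₘ just d
    ... | yes refl = refl
    ... | no  _    = lab-π C d
    from : ∀ a {b} → lab C a ≡ lab C b → Reach (ins π (just x)) (just a) (just b)
    from a e with complete C e
    ... | n , refl = ins-reach π x n a
    complete′ : ∀ a b → lab′ a ≡ lab′ b → Reach (ins π (just x)) a b
    complete′ (just a) (just b) e = from a e
    complete′ (just a) nothing  e = reach-trans (from a e) (1 , ins-at π x)
    complete′ nothing  (just b) e = reach-trans (1 , refl) (from (π x) (trans (lab-π C x) e))
    complete′ nothing  nothing  e = 0 , refl

  -- `Count π 0` forces `A` to be empty, so the inserted fixed point is the only element.
  count-new : ∀ {π} → Count π 0 → Count (ins π nothing) 1
  count-new C = record
    { lab = λ _ → zero ; lab-π = λ _ → refl ; rep = λ _ → nothing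
    ; lab-rep = λ where zero → refl
    ; complete = λ {x} {y} _ → complete′ x y }
    where
    absurd : ∀ {B : Set} → Fin 0 → B
    absurd ()
    complete′ : ∀ x y → Reach (ins _ nothing) x y
    complete′ nothing  nothing  = 0 , refl
    complete′ (just x) _        = absurd (lab C x)
    complete′ nothing  (just y) = absurd (lab C y)

  swap : A → A → A → A
  swap x y z with z ≟ x | z ≟ y
  ... | yes _ | _     = y
  ... | no  _ | yes _ = x
  ... | no  _ | no  _ = z

  swap-l : ∀ x y → swap x y x ≡ y
  swap-l x y with x ≟ x
  ... | yes _ = refl
  ... | no ne = contradiction refl ne

  swap-r : ∀ x y → swap x y y ≡ x
  swap-r x y with y ≟ x | y ≟ y
  ... | yes e | _     = e
  ... | no  _ | yes _ = refl
  ... | no  _ | no ne = contradiction refl ne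

  swap-o : ∀ {x y z} → z ≢ x → z ≢ y → swap x y z ≡ z
  swap-o {x} {y} {z} n₁ n₂ with z ≟ x | z ≟ y
  ... | yes e | _     = contradiction e n₁
  ... | no  _ | yes e = contradiction e n₂
  ... | no  _ | no  _ = refl

  module Merge {π : A → A} {k} (C : Count π (suc k)) (x y : A) (x≁y : lab C x ≢ lab C y) where

    private
      T : A → A
      T = swap x y ∘ π

      -- Along the cycle of `a`, `T` agrees with `π` up to the step that would enter `a`; there the
      -- transposition diverts it to `b`.
      toOther : ∀ {a b} → (∀ {z} → π z ≡ a → T z ≡ b) → (∀ {z} → lab C z ≡ lab C a → π z ≢ a → T z ≡ π z) →
                ∀ n z → lab C z ≡ lab C a → iter π n (π z) ≡ a → Reach T z b
      toOther {a} h₁ h₂ n z l e with π z ≟ a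
      ... | yes q = 1 , h₁ q
      toOther {a} h₁ h₂ zero z l e | no q = contradiction e q
      toOther {a} h₁ h₂ (suc n) z l e | no q =
        reach-trans (1 , h₂ l q) (toOther h₁ h₂ n (π z) (trans (lab-π C z) l) e)

      T-x : ∀ {z} → π z ≡ x → T z ≡ y
      T-x refl = swap-l _ y
      T-y : ∀ {z} → π z ≡ y → T z ≡ x
      T-y refl = swap-r x _

      x→y : Reach T x y
      x→y = let n , e = complete C (lab-π C x) in
        toOther T-x (λ l q → swap-o q λ q′ → x≁y (trans (sym l) (trans (sym (lab-π C _)) (cong (lab C) q′)))) n x refl e

      y→x : Reach T y x
      y→x = let n , e = complete C (lab-π C y) in
        toOther T-y (λ l q → swap-o (λ q′ → x≁y (trans (trans (sym (cong (lab C) q′)) (lab-π C _)) l)) q) n y refl e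

      -- Where `π` enters `x` or `y`, `T` enters the other one and makes up for it by a full turn
      -- around that cycle.
      simulate : ∀ n z → Reach T z (iter π n z)
      simulate zero    z = 0 , refl
      simulate (suc n) z with π z ≟ x | π z ≟ y
      ... | yes q | _     = reach-trans (1 , T-x q) (reach-trans y→x (subst (λ w → Reach T x (iter π n w)) (sym q) (simulate n x)))
      ... | no  _ | yes q = reach-trans (1 , T-y q) (reach-trans x→y (subst (λ w → Reach T y (iter π n w)) (sym q) (simulate n y)))
      ... | no q  | no q′ = reach-trans (1 , swap-o q q′) (simulate n (π z))

      y≁x : lab C y ≢ lab C x
      y≁x = x≁y ∘ sym

      lab′ : A → Fin k
      lab′ z with lab C y Fin.≟ lab C z
      ... | yes _ = punchOut y≁x
      ... | no ne = punchOut ne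

      lab′-y : ∀ z → lab C z ≡ lab C y → lab′ z ≡ punchOut y≁x
      lab′-y z e with lab C y Fin.≟ lab C z
      ... | yes _ = refl
      ... | no ne = contradiction (sym e) ne

      lab′-o : ∀ z (ne : lab C y ≢ lab C z) → lab′ z ≡ punchOut ne
      lab′-o z ne with lab C y Fin.≟ lab C z
      ... | yes e = contradiction e ne
      ... | no _  = Finₚ.punchOut-cong (lab C y) refl

      lab′-cong : ∀ {z w} → lab C z ≡ lab C w → lab′ z ≡ lab′ w
      lab′-cong {z} {w} e with lab C y Fin.≟ lab C w
      ... | yes q = lab′-y z (trans e (sym q))
      ... | no ne = trans (lab′-o z (λ q → ne (trans q e))) (Finₚ.punchOut-cong (lab C y) e)

      lab′-T : ∀ z → lab′ (T z) ≡ lab′ z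
      lab′-T z with π z ≟ x | π z ≟ y
      ... | yes q | _     = trans (lab′-y y refl) (trans (sym (lab′-o x y≁x)) (lab′-cong (trans (cong (lab C) (sym q)) (lab-π C z))))
      ... | no  _ | yes q = trans (lab′-o x y≁x) (trans (sym (lab′-y y refl)) (lab′-cong (trans (cong (lab C) (sym q)) (lab-π C z))))
      ... | no  _ | no  _ = lab′-cong (lab-π C z)

      from : ∀ {z w} → lab C z ≡ lab C w → Reach T z w
      from {z} e with complete C e
      ... | n , refl = simulate n z

      complete′ : ∀ {z w} → lab′ z ≡ lab′ w → Reach T z w
      complete′ {z} {w} e with lab C y Fin.≟ lab C z | lab C y Fin.≟ lab C w
      ... | yes p | yes q = from (trans (sym p) q)
      ... | yes p | no  q = reach-trans (from (sym p)) (reach-trans y→x (from (Finₚ.punchOut-injective y≁x q e)))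
      ... | no  p | yes q = reach-trans (from (Finₚ.punchOut-injective p y≁x e)) (reach-trans x→y (from q))
      ... | no  p | no  q = from (Finₚ.punchOut-injective p q e)

    count-merge : Count (swap x y ∘ π) k
    count-merge = record
      { lab = lab′ ; lab-π = lab′-T
      ; rep = λ i → rep C (Fin.punchIn (lab C y) i)
      ; lab-rep = λ i →
          let e = lab-rep C (Fin.punchIn (lab C y) i)
              ne : lab C y ≢ lab C (rep C (Fin.punchIn (lab C y) i))
              ne q = Finₚ.punchInᵢ≢i (lab C y) i (sym (trans q e))
          in trans (lab′-o _ ne) (trans (Finₚ.punchOut-cong (lab C y) {i≢k = λ q → Finₚ.punchInᵢ≢i (lab C y) i (sym q)} e) (Finₚ.punchOut-punchIn (lab C y)))
      ; complete = complete′ }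

    -- `T` goes once around the cycle of `x`, is diverted to `y` at its end, and comes back to `x`
    -- after a turn around the cycle of `y`. For a bridge this adds up the lengths of the two root
    -- faces.
    period-merge : ∀ {p q} → 0 < p → First π x p x → 0 < q → First π y q y → First T x (p + q) x
    period-merge {p} {q} 0<p (ex , fx) 0<q (ey , fy) = thru , avoid
      where
      reach-lab : ∀ a j → lab C (iter π j a) ≡ lab C a
      reach-lab a j = sym (lab-reach C (j , refl))
      stay : ∀ j a → (∀ i → 0 < i → i ≤ j → iter π i a ≢ x × iter π i a ≢ y) → iter T j a ≡ iter π j a
      stay zero a h = refl
      stay (suc j) a h = trans (cong (iter T j) (swap-o (proj₁ (h 1 (s≤s z≤n) (s≤s z≤n))) (proj₂ (h 1 (s≤s z≤n) (s≤s z≤n)))))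
                               (stay j (π a) λ i p q → h (suc i) (s≤s z≤n) (s≤s q))
      stay-x : ∀ j → j < p → iter T j x ≡ iter π j x
      stay-x j j<p = stay j x λ i 0<i i≤j → fx i 0<i (ℕ.≤-<-trans i≤j j<p) , λ e → x≁y (trans (sym (reach-lab x i)) (cong (lab C) e))
      stay-y : ∀ j → j < q → iter T j y ≡ iter π j y
      stay-y j j<q = stay j y λ i 0<i i≤j → (λ e → x≁y (trans (sym (cong (lab C) e)) (reach-lab y i))) , fy i 0<i (ℕ.≤-<-trans i≤j j<q)
      last : ∀ {a b c} n → 0 < n → (∀ j → j < n → iter T j a ≡ iter π j a) → iter π n a ≡ b → swap x y b ≡ c → iter T n a ≡ c
      last {a} (suc n) _ h e s = trans (iter-suc T n a)
        (trans (cong T (h n ℕ.≤-refl)) (trans (cong (swap x y) (trans (sym (iter-suc π n a)) e)) s))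
      x⇒y : iter T p x ≡ y
      x⇒y = last p 0<p stay-x ex (swap-l x y)
      thru : iter T (p + q) x ≡ x
      thru = trans (iter-+ T p q x) (trans (cong (iter T q) x⇒y) (last q 0<q stay-y ey (swap-r x y)))
      avoid : ∀ j → 0 < j → j < p + q → iter T j x ≢ x
      avoid j 0<j j<pq e with ℕ.<-cmp j p
      ... | tri< j<p _ _ = fx j 0<j j<p (trans (sym (stay-x j j<p)) e)
      ... | tri≈ _ refl _ = x≁y (cong (lab C) (trans (sym e) x⇒y))
      ... | tri> _ _ p<j with ℕ.m≤n⇒∃[o]m+o≡n (ℕ.<⇒≤ p<j)
      ... | i , refl =
        let i<q = ℕ.+-cancelˡ-< p i q j<pq
            e′ = trans (sym (stay-y i i<q)) (trans (cong (iter T i) (sym x⇒y)) (trans (sym (iter-+ T p i x)) e))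
        in x≁y (trans (sym (cong (lab C) e′)) (reach-lab y i))

  module Split {π : A → A} (inj : Injective π) (x y : A) (x≢y : x ≢ y) where

    T : A → A
    T = swap x y ∘ π

    module Arc {n} (0<n : 0 < n) (first : First π x n y) where

      not-x : ∀ j → 0 < j → j < n → iter π j x ≢ x
      not-x j 0<j j<n e with ℕ.m≤n⇒∃[o]m+o≡n (ℕ.<⇒≤ j<n)
      ... | i , refl = proj₂ first i (0<i i j<n) i<n (trans (trans (cong (iter π i) (sym e)) (sym (iter-+ π j i x))) (proj₁ first))
        where
        0<i : ∀ i → j < j + i → 0 < i
        0<i zero    q = contradiction (sym (ℕ.+-identityʳ j)) (ℕ.<⇒≢ q)
        0<i (suc i) _ = s≤s z≤n
        i<n : i < j + i
        i<n = ℕ.+-monoˡ-≤ i 0<j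

      stay : ∀ j → j < n → iter T j x ≡ iter π j x
      stay zero    _   = refl
      stay (suc j) j<n = trans (iter-suc T j x) (trans (cong T (stay j (ℕ.<⇒≤ j<n)))
        (trans (swap-o (λ e → not-x (suc j) (s≤s z≤n) j<n (trans (iter-suc π j x) e))
                       (λ e → proj₂ first (suc j) (s≤s z≤n) j<n (trans (iter-suc π j x) e)))
               (sym (iter-suc π j x))))

      back : ∀ m → m < n → suc m ≡ n → T (iter π m x) ≡ x
      back m m<n refl = trans (cong (swap x y) (trans (sym (iter-suc π m x)) (proj₁ first))) (swap-r x y)

      close : iter T n x ≡ x
      close = go n refl 0<n
        where
        go : ∀ m → m ≡ n → 0 < m → iter T m x ≡ x
        go (suc m) e _ = trans (iter-suc T m x) (trans (cong T (stay m (ℕ.≤-reflexive e))) (back m (ℕ.≤-reflexive e) e))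

      period-split : First T x n x
      period-split = close , λ j 0<j j<n e → not-x j 0<j j<n (trans (sym (stay j j<n)) e)

      -- The points from `x` up to, but excluding, `y`. Under `T` they close up into a cycle of
      -- their own. The bounded exponent makes membership decidable.
      OnArc : A → Set
      OnArc z = ∃[ j ] iter π (Fin.toℕ {n} j) x ≡ z

      onArc? : Decidable OnArc
      onArc? z = Finₚ.any? (λ j → iter π (Fin.toℕ j) x ≟ z)

      arc : ∀ j → j < n → OnArc (iter π j x)
      arc j j<n = Fin.fromℕ< j<n , cong (λ i → iter π i x) (Finₚ.toℕ-fromℕ< j<n)

      x-on : OnArc x
      x-on = arc 0 0<n

      y-off : ¬ OnArc y
      y-off (j , e) with Fin.toℕ j | Finₚ.toℕ<n j
      ... | zero  | _ = x≢y e
      ... | suc i | q = proj₂ first (suc i) (s≤s z≤n) q e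

      arc-T : ∀ {z} → OnArc z → OnArc (T z)
      arc-T (j , refl) with suc (Fin.toℕ j) <? n
      ... | yes q = subst OnArc (trans (sym (stay _ q)) (trans (iter-suc T (Fin.toℕ j) x) (cong T (stay _ (Finₚ.toℕ<n j))))) (arc _ q)
      ... | no ¬q = subst OnArc (sym (back _ (Finₚ.toℕ<n j) (ℕ.≤-antisym (Finₚ.toℕ<n j) (ℕ.≮⇒≥ ¬q)))) x-on

      arc-pred : ∀ {z} → OnArc (π z) → π z ≢ x → OnArc z
      arc-pred {z} (j , e) ne with Fin.toℕ j | Finₚ.toℕ<n j
      ... | zero  | _ = contradiction (sym e) ne
      ... | suc i | q = subst OnArc (inj (trans (sym (iter-suc π i x)) e)) (arc i (ℕ.<⇒≤ q))

      arc-y : ∀ {z} → π z ≡ y → OnArc z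
      arc-y {z} e = go n refl 0<n
        where
        go : ∀ m → m ≡ n → 0 < m → OnArc z
        go (suc m) refl _ = subst OnArc (inj (trans (sym (iter-suc π m x)) (trans (proj₁ first) (sym e)))) (arc m ℕ.≤-refl)

      -- The predecessor of `y` is on the arc, so off the arc `T` departs from `π` only at the
      -- predecessor of `x`, which it sends past the arc to `y`.
      off-T : ∀ {z} → ¬ OnArc z → ¬ OnArc (T z) × (T z ≡ π z ⊎ π z ≡ x × T z ≡ y)
      off-T {z} off with π z ≟ x | π z ≟ y
      ... | yes q | _     = y-off , inj₂ (q , refl)
      ... | no  _ | yes q = contradiction (arc-y q) off
      ... | no  q | no  _ = (λ a → off (arc-pred a q)) , inj₁ refl

      on-reach : ∀ {z w} → OnArc z → OnArc w → Reach T z w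
      on-reach (i , refl) (j , refl) = reach-trans to-x
        (Fin.toℕ j , stay (Fin.toℕ j) (Finₚ.toℕ<n j))
        where
        to-x : Reach T (iter π (Fin.toℕ i) x) x
        to-x with ℕ.m≤n⇒∃[o]m+o≡n (ℕ.<⇒≤ (Finₚ.toℕ<n i))
        ... | o , e = o , trans (cong (iter T o) (sym (stay _ (Finₚ.toℕ<n i))))
                         (trans (sym (iter-+ T (Fin.toℕ i) o x)) (trans (cong (λ m → iter T m x) e) close))

      -- The bound b on the number of steps left decreases by n whenever the arc is skipped.
      simulate : ∀ b m z → m ≤ b → ¬ OnArc z → ¬ OnArc (iter π m z) → Reach T z (iter π m z)
      simulate b zero z _ _ _ = 0 , refl
      simulate (suc b) (suc m) z (s≤s m≤b) off off′ with off-T {z} off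
      ... | offT , inj₁ e = reach-trans (1 , e) (simulate b m (π z) m≤b (subst (¬_ ∘ OnArc) e offT) off′)
      ... | _ , inj₂ (q , e) with ℕ.≤-total n m
      ... | inj₂ m≤n with ℕ.m≤n⇒m<n∨m≡n m≤n
      ...   | inj₁ m<n = contradiction (subst OnArc (cong (iter π m) (sym q)) (arc m m<n)) off′
      ...   | inj₂ refl = 1 , trans e (sym (trans (cong (iter π m) q) (proj₁ first)))
      simulate (suc b) (suc m) z (s≤s m≤b) off off′ | _ , inj₂ (q , e) | inj₁ n≤m with ℕ.m≤n⇒∃[o]m+o≡n n≤m
      ... | o , refl = reach-trans (1 , e) (subst (Reach T y) (sym eq)
                         (simulate b o y (ℕ.≤-trans (ℕ.m≤n+m o n) m≤b) y-off (subst (¬_ ∘ OnArc) eq off′)))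
        where
        eq : iter π (n + o) (π z) ≡ iter π o y
        eq = trans (iter-+ π n o (π z)) (cong (iter π o) (trans (cong (iter π n) q) (proj₁ first)))

      module _ {k} (C : Count π k) where

        private
          lab-T : ∀ z → lab C (T z) ≡ lab C z
          lab-T z with π z ≟ x | π z ≟ y
          ... | yes q | _     = trans (sym (lab-reach C (n , proj₁ first))) (trans (cong (lab C) (sym q)) (lab-π C z))
          ... | no  _ | yes q = trans (lab-reach C (n , proj₁ first)) (trans (cong (lab C) (sym q)) (lab-π C z))
          ... | no  _ | no  _ = lab-π C z

          lab′ : A → Fin (suc k)
          lab′ z with onArc? z
          ... | yes _ = zero
          ... | no  _ = suc (lab C z)

          lab′-on : ∀ {z} → OnArc z → lab′ z ≡ zero
          lab′-on {z} a with onArc? z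
          ... | yes _ = refl
          ... | no ¬a = contradiction a ¬a

          lab′-off : ∀ {z} → ¬ OnArc z → lab′ z ≡ suc (lab C z)
          lab′-off {z} ¬a with onArc? z
          ... | yes a = contradiction a ¬a
          ... | no _  = refl

          -- The old representative may lie on the arc; then `y` replaces it, being in the same old
          -- cycle but off the arc.
          rep′ : ∀ i → ∃[ z ] lab′ z ≡ suc i
          rep′ i with onArc? (rep C i)
          ... | no off       = rep C i , trans (lab′-off off) (cong suc (lab-rep C i))
          ... | yes (j , e) = y , trans (lab′-off y-off) (cong suc
            (trans (sym (lab-reach C (n , proj₁ first))) (trans (lab-reach C (Fin.toℕ j , e)) (lab-rep C i))))

          lab′-T : ∀ z → lab′ (T z) ≡ lab′ z
          lab′-T z with onArc? z
          ... | yes a = lab′-on (arc-T a)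
          ... | no ¬a = trans (lab′-off (proj₁ (off-T ¬a))) (cong suc (lab-T z))

          complete′ : ∀ {z w} → lab′ z ≡ lab′ w → Reach T z w
          complete′ {z} {w} e with onArc? z | onArc? w
          ... | yes a | yes b = on-reach a b
          ... | no ¬a | no ¬b with complete C (Finₚ.suc-injective e)
          ...   | m , refl = simulate m m z ℕ.≤-refl ¬a ¬b
          complete′ {z} {w} () | yes _ | no _
          complete′ {z} {w} () | no _ | yes _

        count-split : Count T (suc k)
        count-split = record
          { lab = lab′ ; lab-π = lab′-T
          ; rep = λ where
              zero    → x
              (suc i) → proj₁ (rep′ i)
          ; lab-rep = λ where
              zero    → lab′-on x-on
              (suc i) → proj₂ (rep′ i)
          ; complete = complete′ }

  first-reach : ∀ (π : A → A) x y n → 0 < n → iter π n x ≡ y → ∃[ m ] 0 < m × First π x m y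
  first-reach π x y n 0<n e = go n n ℕ.≤-refl 0<n e
    where
    go : ∀ b n → n ≤ b → 0 < n → iter π n x ≡ y → ∃[ m ] 0 < m × First π x m y
    go zero zero _ () e
    go (suc b) n n≤b 0<n e with Finₚ.any? {n = n} (λ j → (iter π (Fin.toℕ j) x ≟ y) ×-dec (0 <? Fin.toℕ j))
    ... | yes (j , e′ , 0<j) = go b (Fin.toℕ j) (ℕ.≤-pred (ℕ.<-≤-trans (Finₚ.toℕ<n j) n≤b)) 0<j e′
    ... | no none = n , 0<n , e , λ j 0<j j<n e′ → none (Fin.fromℕ< j<n ,
            trans (cong (λ i → iter π i x) (Finₚ.toℕ-fromℕ< j<n)) e′ , subst (0 <_) (sym (Finₚ.toℕ-fromℕ< j<n)) 0<j)

  count-split′ : ∀ {π k} → Injective π → ∀ x y → x ≢ y → (C : Count π k) → lab C x ≡ lab C y →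
                 Count (swap x y ∘ π) (suc k)
  count-split′ {π} inj x y x≢y C e with complete C e
  ... | zero , q = contradiction q x≢y
  ... | suc n , q with first-reach π x y (suc n) (s≤s z≤n) q
  ... | m , 0<m , f = Split.Arc.count-split inj x y x≢y 0<m f C

  ins-iter : ∀ π x j a → (∀ i → i < j → iter π i a ≢ x) →
             iter (ins π (just x)) j (just a) ≡ just (iter π j a)
  ins-iter π x zero    a h = refl
  ins-iter π x (suc j) a h = trans
    (cong (iter (ins π (just x)) j) (ins-off π (just x) a (λ q → h 0 (s≤s z≤n) (sym (just-injective q)))))
    (ins-iter π x j (π a) (λ i i<j → h (suc i) (s≤s i<j)))

  ins-first : ∀ π r n p → 0 < n → First π r n p → r ≢ p → First (ins π (just p)) (just r) (suc n) nothing
  ins-first π r n p 0<n (e , f) r≢p = thru , avoid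
    where
    walk : ∀ j → j < suc n → iter (ins π (just p)) j (just r) ≡ just (iter π j r)
    walk j (s≤s j≤n) = ins-iter π p j r λ where
      zero    _   → r≢p
      (suc i) i<j → f (suc i) (s≤s z≤n) (ℕ.<-≤-trans i<j j≤n)
    thru : iter (ins π (just p)) (suc n) (just r) ≡ nothing
    thru = trans (iter-suc (ins π (just p)) n (just r))
      (trans (cong (ins π (just p)) (trans (walk n ℕ.≤-refl) (cong just e))) (ins-at π p))
    avoid : ∀ j → 0 < j → j < suc n → iter (ins π (just p)) j (just r) ≢ nothing
    avoid j _ j≤n e′ = contradiction (trans (sym (walk j j≤n)) e′) λ ()

  ins-walk : ∀ π x n → First π x n x → ∀ j → suc j < suc n →
             iter (ins π (just x)) (suc j) nothing ≡ just (iter π (suc j) x)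
  ins-walk π x n (_ , f) j (s≤s j<n) = ins-iter π x j (π x) λ i i<j → f (suc i) (s≤s z≤n) (ℕ.≤-<-trans i<j j<n)

  ins-period : ∀ π x n → 0 < n → First π x n x → First (ins π (just x)) nothing (suc n) nothing
  ins-period π x (suc n) _ per@(e , f) = thru , avoid
    where
    thru : iter (ins π (just x)) (suc (suc n)) nothing ≡ nothing
    thru = trans (iter-suc (ins π (just x)) (suc n) nothing)
      (trans (cong (ins π (just x)) (trans (ins-walk π x (suc n) per n ℕ.≤-refl) (cong just e))) (ins-at π x))
    avoid : ∀ j → 0 < j → j < suc (suc n) → iter (ins π (just x)) j nothing ≢ nothing
    avoid (suc j) _ q e′ = contradiction (trans (sym (ins-walk π x (suc n) per j q)) e′) λ ()

open Count

-- Maps of any genus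

-- deg counts half the degree of the root face.
data Code : Set
deg : Code → ℕ

data Code where
  empty  : Code
  bridge : Code → Code → Code
  chord  : ∀ i (c : Code) → i < deg c → Code

deg empty         = 0
deg (bridge a b)  = suc (deg a + deg b)
deg (chord i _ _) = suc i

edges : Code → ℕ
edges empty         = 0
edges (bridge a b)  = suc (edges a + edges b)
edges (chord _ c _) = suc (edges c)

-- Decompositions of rooted maps of any genus under deletion of the root edge.
-- In both constructors the root dart is inserted first, after the root of the
-- first submap, then its opposite: after the root of the second submap (bridge)
-- or after an arbitrary dart (chord).
data Gen : Set
Darts : Gen → Set

data Gen where
  empty  : Gen
  bridge : Gen → Gen → Gen
  chord  : (c : Gen) → Maybe (Darts c) → Gen

Darts empty        = ⊥
Darts (bridge a b) = Maybe (Darts a) ⊎ Maybe (Darts b)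
Darts (chord c _)  = Maybe (Maybe (Darts c))

edgesᴳ : Gen → ℕ
edgesᴳ empty        = 0
edgesᴳ (bridge a b) = suc (edgesᴳ a + edgesᴳ b)
edgesᴳ (chord c _)  = suc (edgesᴳ c)

_≟ᴰ_ : ∀ {c} → DecidableEquality (Darts c)
_≟ᴰ_ {bridge a b} = Sumₚ.≡-dec (Maybeₚ.≡-dec (_≟ᴰ_ {a})) (Maybeₚ.≡-dec (_≟ᴰ_ {b}))
_≟ᴰ_ {chord c _}  = Maybeₚ.≡-dec (Maybeₚ.≡-dec (_≟ᴰ_ {c}))

_≟ᴹ_ : ∀ {c} → DecidableEquality (Maybe (Darts c))
_≟ᴹ_ {c} = Maybeₚ.≡-dec (_≟ᴰ_ {c})

start : ∀ c → Maybe (Darts c)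
start empty        = nothing
start (bridge _ _) = just (inj₁ nothing)
start (chord _ _)  = just (just nothing)

α : ∀ c → Darts c → Darts c
α (bridge a b) (inj₁ nothing)  = inj₂ nothing
α (bridge a b) (inj₂ nothing)  = inj₁ nothing
α (bridge a b) (inj₁ (just d)) = inj₁ (just (α a d))
α (bridge a b) (inj₂ (just d)) = inj₂ (just (α b d))
α (chord c p)  nothing         = just nothing
α (chord c p)  (just nothing)  = nothing
α (chord c p)  (just (just d)) = just (just (α c d))

insᴰ : ∀ c → (Darts c → Darts c) → Maybe (Darts c) → Maybe (Darts c)
insᴰ c π = ins (_≟ᴰ_ {c}) π (start c)

σ : ∀ c → Darts c → Darts c
σ (bridge a b) = Sum.map (insᴰ a (σ a)) (insᴰ b (σ b))
σ (chord c p)  = ins (_≟ᴹ_ {c}) (insᴰ c (σ c)) (just p)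

-- The corner following a dart d is followed, around its face, by the corner
-- following ψ d.
ψ : ∀ c → Darts c → Darts c
ψ c = α c ∘ σ c

-- The face permutation with a virtual dart `nothing` at the root corner. It makes sense for the
-- empty map too, whose only corner is `nothing`.
ψ⁺ : ∀ c → Maybe (Darts c) → Maybe (Darts c)
ψ⁺ c = insᴰ c (ψ c)

α-involutive : ∀ c d → α c (α c d) ≡ d
α-involutive (bridge a b) (inj₁ nothing)  = refl
α-involutive (bridge a b) (inj₂ nothing)  = refl
α-involutive (bridge a b) (inj₁ (just d)) = cong (inj₁ ∘ just) (α-involutive a d)
α-involutive (bridge a b) (inj₂ (just d)) = cong (inj₂ ∘ just) (α-involutive b d)
α-involutive (chord c p)  nothing         = refl
α-involutive (chord c p)  (just nothing)  = refl
α-involutive (chord c p)  (just (just d)) = cong (just ∘ just) (α-involutive c d)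

α-injective : ∀ c → Injective (α c)
α-injective c e = trans (sym (α-involutive c _)) (trans (cong (α c) e) (α-involutive c _))

σ-injective : ∀ c → Injective (σ c)
σ-injective (bridge a b) {inj₁ x} {inj₁ y} e = cong inj₁ (ins-injective (_≟ᴰ_ {a}) (start a) (σ-injective a) (Sumₚ.inj₁-injective e))
σ-injective (bridge a b) {inj₂ x} {inj₂ y} e = cong inj₂ (ins-injective (_≟ᴰ_ {b}) (start b) (σ-injective b) (Sumₚ.inj₂-injective e))
σ-injective (bridge a b) {inj₁ x} {inj₂ y} ()
σ-injective (bridge a b) {inj₂ x} {inj₁ y} ()
σ-injective (chord c p) = ins-injective (_≟ᴹ_ {c}) (just p) (ins-injective (_≟ᴰ_ {c}) (start c) (σ-injective c))

ψ-injective : ∀ c → Injective (ψ c)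
ψ-injective c = σ-injective c ∘ α-injective c

module _ {A : Set} (_≟_ : DecidableEquality A) where

  ins-cong : ∀ {π ρ} → (∀ x → π x ≡ ρ x) → ∀ m x → ins _≟_ π m x ≡ ins _≟_ ρ m x
  ins-cong h nothing  nothing = refl
  ins-cong h (just y) nothing = cong just (h y)
  ins-cong h m (just x) with Maybeₚ.≡-dec _≟_ m (just x)
  ... | yes _ = refl
  ... | no  _ = cong just (h x)

  ins-∘ : ∀ f π m x → ins _≟_ (f ∘ π) m x ≡ Maybe.map f (ins _≟_ π m x)
  ins-∘ f π nothing  nothing = refl
  ins-∘ f π (just y) nothing = refl
  ins-∘ f π m (just x) with Maybeₚ.≡-dec _≟_ m (just x)
  ... | yes _ = refl
  ... | no  _ = refl

-- The new `α` is the old ones, extended by two fixed points, followed by the transposition of the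
-- new darts. So the face permutation arises by inserting both darts and composing with a
-- transposition, the form treated in `Merge` and `Split`.
ψ-bridge : ∀ a b x → swap (_≟ᴰ_ {bridge a b}) (inj₁ nothing) (inj₂ nothing) (Sum.map (ψ⁺ a) (ψ⁺ b) x) ≡ ψ (bridge a b) x
ψ-bridge a b x = trans (cong (swap _≟ᴰ_ _ _) (relabel x)) (flip (σ (bridge a b) x))
  where
  relabel : ∀ x → Sum.map (ψ⁺ a) (ψ⁺ b) x ≡ Sum.map (Maybe.map (α a)) (Maybe.map (α b)) (σ (bridge a b) x)
  relabel (inj₁ x) = cong inj₁ (ins-∘ (_≟ᴰ_ {a}) (α a) (σ a) (start a) x)
  relabel (inj₂ x) = cong inj₂ (ins-∘ (_≟ᴰ_ {b}) (α b) (σ b) (start b) x)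
  flip : ∀ z → swap (_≟ᴰ_ {bridge a b}) (inj₁ nothing) (inj₂ nothing) (Sum.map (Maybe.map (α a)) (Maybe.map (α b)) z) ≡ α (bridge a b) z
  flip (inj₁ nothing)  = swap-l (_≟ᴰ_ {bridge a b}) (inj₁ nothing) (inj₂ nothing)
  flip (inj₂ nothing)  = swap-r (_≟ᴰ_ {bridge a b}) (inj₁ nothing) (inj₂ nothing)
  flip (inj₁ (just d)) = swap-o (_≟ᴰ_ {bridge a b}) {inj₁ nothing} {inj₂ nothing} (λ ()) (λ ())
  flip (inj₂ (just d)) = swap-o (_≟ᴰ_ {bridge a b}) {inj₁ nothing} {inj₂ nothing} (λ ()) (λ ())

ψ-chord : ∀ c p x → swap (_≟ᴰ_ {chord c p}) (just nothing) nothing (ins (_≟ᴹ_ {c}) (ψ⁺ c) (just p) x) ≡ ψ (chord c p) x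
ψ-chord c p x = trans (cong (swap (_≟ᴰ_ {chord c p}) (just nothing) nothing) relabel) (flip (σ (chord c p) x))
  where
  relabel : ins (_≟ᴹ_ {c}) (ψ⁺ c) (just p) x ≡ Maybe.map (Maybe.map (α c)) (σ (chord c p) x)
  relabel = trans (ins-cong (_≟ᴹ_ {c}) (ins-∘ (_≟ᴰ_ {c}) (α c) (σ c) (start c)) (just p) x)
                  (ins-∘ (_≟ᴹ_ {c}) (Maybe.map (α c)) (insᴰ c (σ c)) (just p) x)
  flip : ∀ z → swap (_≟ᴰ_ {chord c p}) (just nothing) nothing (Maybe.map (Maybe.map (α c)) z) ≡ α (chord c p) z
  flip nothing         = swap-r (_≟ᴰ_ {chord c p}) (just nothing) nothing
  flip (just nothing)  = swap-l (_≟ᴰ_ {chord c p}) (just nothing) nothing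
  flip (just (just d)) = swap-o (_≟ᴰ_ {chord c p}) {just nothing} {nothing} (λ ()) (λ ())

-- The empty map has one vertex and one face, which only become cycles of a
-- permutation once a dart is inserted there.

vertices : Gen → ℕ
vertices empty        = 1
vertices (bridge a b) = vertices a + vertices b
vertices (chord c _)  = vertices c


countσ⁺ : ∀ c → Count (insᴰ c (σ c)) (vertices c)
countσ  : ∀ c {x} → start c ≡ just x → Count (σ c) (vertices c)

countσ⁺ empty          = count-new (_≟ᴰ_ {empty}) count-⊥
countσ⁺ c@(bridge _ _) = count-ins (_≟ᴰ_ {c}) _ (countσ c refl)
countσ⁺ c@(chord _ _)  = count-ins (_≟ᴰ_ {c}) _ (countσ c refl)

countσ (bridge a b) _ = count-⊎ (countσ⁺ a) (countσ⁺ b)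
countσ (chord c p)  _ = count-ins (_≟ᴹ_ {c}) p (countσ⁺ c)

Planarᴳ : Gen → Set
Planarᴳ empty        = ⊤
Planarᴳ (bridge a b) = Planarᴳ a × Planarᴳ b
Planarᴳ (chord c p)  = Planarᴳ c × Reach (ψ⁺ c) nothing p

-- `handles` is the genus: it counts the chords whose ends lie in different faces of the smaller
-- map.
record Faces (c : Gen) : Set where
  field
    faces handles : ℕ
    countψ⁺  : Count (ψ⁺ c) faces
    countψ   : ∀ {x} → start c ≡ just x → Count (ψ c) faces
    eulerᴳ    : vertices c + faces + 2 * handles ≡ edgesᴳ c + 2
    sphere   : handles ≡ 0 → Planarᴳ c
    genus0   : Planarᴳ c → handles ≡ 0

open Faces

inj₁≁inj₂ : ∀ {A B : Set} {f : A → A} {g : B → B} {x y} → ¬ Reach (Sum.map f g) (inj₁ x) (inj₂ y)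
inj₁≁inj₂ {A} {B} r = reach-closed IsInj₁ (λ {z} → step z) r tt
  where
  IsInj₁ : A ⊎ B → Set
  IsInj₁ (inj₁ _) = ⊤
  IsInj₁ (inj₂ _) = ⊥
  step : ∀ z → IsInj₁ z → IsInj₁ _
  step (inj₁ _) _ = tt

faces-of : ∀ c → Faces c
faces-of empty = record
  { faces = 1 ; handles = 0
  ; countψ⁺ = count-new (_≟ᴰ_ {empty}) count-⊥ ; countψ = λ ()
  ; eulerᴳ = refl ; sphere = λ _ → tt ; genus0 = λ _ → refl }
faces-of (bridge a b) with faces-of a | faces-of b
... | A@record { faces = zero } | B = case lab (countψ⁺ A) nothing of λ ()
... | A@record { faces = suc f } | B = record
  { faces = f + faces B ; handles = handles A + handles B
  ; countψ⁺ = count-ins (_≟ᴰ_ {bridge a b}) _ C ; countψ = λ _ → C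
  ; eulerᴳ = ℕ.suc-injective (trans (arith₁ (vertices a) (vertices b) f (faces B) (handles A) (handles B))
      (trans (cong₂ _+_ (eulerᴳ A) (eulerᴳ B)) (arith₂ (edgesᴳ a) (edgesᴳ b))))
  ; sphere = λ h → sphere A (ℕ.m+n≡0⇒m≡0 (handles A) h) , sphere B (ℕ.m+n≡0⇒n≡0 (handles A) h)
  ; genus0 = λ (p , q) → cong₂ _+_ (genus0 A p) (genus0 B q) }
  where
  C : Count (ψ (bridge a b)) (f + faces B)
  C = count-cong (ψ-bridge a b)
    (Merge.count-merge (_≟ᴰ_ {bridge a b}) AB (inj₁ nothing) (inj₂ nothing) λ e → inj₁≁inj₂ (complete AB e))
    where
    AB : Count (Sum.map (ψ⁺ a) (ψ⁺ b)) (suc f + faces B)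
    AB = count-⊎ (countψ⁺ A) (countψ⁺ B)
  arith₁ : ∀ v w f g h k → suc (v + w + (f + g) + 2 * (h + k)) ≡ (v + suc f + 2 * h) + (w + g + 2 * k)
  arith₁ = solve-∀
  arith₂ : ∀ e e′ → (e + 2) + (e′ + 2) ≡ suc (suc (e + e′) + 2)
  arith₂ = solve-∀
faces-of (chord c p) with faces-of c
... | F@record { faces = f } with lab (countψ⁺ F) nothing Fin.≟ lab (countψ⁺ F) p
... | yes same = record
  { faces = suc f ; handles = handles F
  ; countψ⁺ = count-ins (_≟ᴰ_ {chord c p}) _ C ; countψ = λ _ → C
  ; eulerᴳ = trans (cong (_+ 2 * handles F) (ℕ.+-suc (vertices c) f)) (cong suc (eulerᴳ F))
  ; sphere = λ h → sphere F h , complete (countψ⁺ F) same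
  ; genus0 = λ (q , _) → genus0 F q }
  where
  C : Count (ψ (chord c p)) (suc f)
  C = count-cong (ψ-chord c p) (count-split′ (_≟ᴰ_ {chord c p})
    (ins-injective (_≟ᴹ_ {c}) (just p) (ins-injective (_≟ᴰ_ {c}) (start c) (ψ-injective c)))
    (just nothing) nothing (λ ()) (count-ins (_≟ᴹ_ {c}) p (countψ⁺ F)) same)
faces-of (chord c p) | F@record { faces = zero } | no _ = case lab (countψ⁺ F) nothing of λ ()
faces-of (chord c p) | F@record { faces = suc f } | no diff = record
  { faces = f ; handles = suc (handles F)
  ; countψ⁺ = count-ins (_≟ᴰ_ {chord c p}) _ C ; countψ = λ _ → C
  ; eulerᴳ = trans (arith (vertices c) f (handles F)) (cong suc (eulerᴳ F))
  ; sphere = λ ()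
  ; genus0 = λ (_ , r) → contradiction (lab-reach (countψ⁺ F) r) diff }
  where
  C : Count (ψ (chord c p)) f
  C = count-cong (ψ-chord c p) (Merge.count-merge (_≟ᴰ_ {chord c p})
    (count-ins (_≟ᴹ_ {c}) p (countψ⁺ F)) (just nothing) nothing diff)
  arith : ∀ v f h → v + f + 2 * suc h ≡ suc (v + suc f + 2 * h)
  arith = solve-∀

-- If the new element was inserted right after `x`, then `π x` comes one step later, after
-- `nothing`.
closed-ins : ∀ {A : Set} (_≟_ : DecidableEquality A) (π : A → A) m (P : Maybe A → Set) → P nothing →
             (∀ {x} → P x → P (ins _≟_ π m x)) → ∀ {x} → P (just x) → P (just (π x))
closed-ins _≟_ π m P p₀ h {x} p with Maybeₚ.≡-dec _≟_ m (just x) | h p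
... | no  _    | q = q
... | yes refl | _ = h p₀

-- Connectedness of a decomposed map, as an induction principle: every dart is reached from the root
-- by `σ` and `α`.
all-darts : ∀ c (P : Darts c → Set) → (∀ {d} → P d → P (σ c d)) → (∀ {d} → P d → P (α c d)) →
            (∀ {x} → start c ≡ just x → P x) → ∀ d → P d
all-insᴰ : ∀ c (P : Maybe (Darts c) → Set) → (∀ {d} → P d → P (insᴰ c (σ c) d)) →
           (∀ {d} → P (just d) → P (just (α c d))) → P nothing → ∀ d → P d

all-insᴰ c P hσ hα p nothing  = p
all-insᴰ c P hσ hα p (just d) = all-darts c (P ∘ just) (closed-ins (_≟ᴰ_ {c}) (σ c) (start c) P p hσ) hα first d
  where
  first : ∀ {x} → start c ≡ just x → P (just x)
  -- `P` is preserved by forward steps only. The cycle being finite, these also lead from `nothing`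
  -- to its predecessor, which is the root of `c`.
  first {x} e = reach-closed P hσ (reach-sym (countσ⁺ c) (1 , step)) p
    where
    step : insᴰ c (σ c) (just x) ≡ nothing
    step rewrite e = ins-at (_≟ᴰ_ {c}) (σ c) x

all-darts (bridge a b) P hσ hα h = λ where
    (inj₁ d) → all-insᴰ a (P ∘ inj₁) hσ hα (h refl) d
    (inj₂ d) → all-insᴰ b (P ∘ inj₂) hσ hα (hα (h refl)) d
all-darts (chord c p) P hσ hα h nothing  = hα (h refl)
all-darts (chord c p) P hσ hα h (just d) = all-insᴰ c (P ∘ just)
  (closed-ins (_≟ᴹ_ {c}) (insᴰ c (σ c)) (just p) P (hα (h refl)) hσ) hα (h refl) d

open Count

-- Deleting and restoring the root edge

any-Maybe? : ∀ {A : Set} → (∀ (P : A → Set) → Decidable P → Dec (∃ P)) →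
             ∀ (P : Maybe A → Set) → Decidable P → Dec (∃ P)
any-Maybe? any? P P? with P? nothing | any? (P ∘ just) (P? ∘ just)
... | yes p | _           = yes (nothing , p)
... | no  _ | yes (x , p) = yes (just x , p)
... | no  n | no  m       = no λ where
  (nothing , p) → n p
  (just x  , p) → m (x , p)

any-dart? : ∀ c (P : Darts c → Set) → Decidable P → Dec (∃ P)
any-dart? empty P P? = no λ ()
any-dart? (bridge a b) P P? with any-Maybe? (any-dart? a) (P ∘ inj₁) (P? ∘ inj₁) | any-Maybe? (any-dart? b) (P ∘ inj₂) (P? ∘ inj₂)
... | yes (x , p) | _           = yes (inj₁ x , p)
... | no  _       | yes (x , p) = yes (inj₂ x , p)
... | no  n       | no  m       = no λ where
  (inj₁ x , p) → n (x , p)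
  (inj₂ x , p) → m (x , p)
any-dart? (chord c _) = any-Maybe? (any-Maybe? (any-dart? c))

σ-surjective : ∀ c d → ∃[ d′ ] σ c d′ ≡ d
σ-surjective empty          = λ ()
σ-surjective c@(bridge _ _) = preimage (countσ c refl)
σ-surjective c@(chord _ _)  = preimage (countσ c refl)

attach : ∀ {A B : Set} → B → (A → B) → Maybe A → B
attach x f nothing  = x
attach x f (just d) = f d

attach-inj : ∀ {A B : Set} {x : B} {f : A → B} → Injective f → (∀ d → f d ≢ x) → Injective (attach x f)
attach-inj fi ne {nothing} {nothing} e = refl
attach-inj fi ne {nothing} {just y} e = contradiction (sym e) (ne y)
attach-inj fi ne {just x} {nothing} e = contradiction e (ne x)
attach-inj fi ne {just x} {just y} e = cong just (fi e)

module _ {X : Set} (_≟_ : DecidableEquality X) where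

  -- The deleted element stays as a fixed point, so that all deletions act on the same type.
  del : (X → X) → X → X → X
  del π x z with z ≟ x | π z ≟ x
  ... | yes _ | _     = x
  ... | no  _ | yes _ = π x
  ... | no  _ | no  _ = π z

  del-self : ∀ π x → del π x x ≡ x
  del-self π x with x ≟ x
  ... | yes _ = refl
  ... | no ne = contradiction refl ne

  del-pred : ∀ π x z → z ≢ x → π z ≡ x → del π x z ≡ π x
  del-pred π x z ne e with z ≟ x | π z ≟ x
  ... | yes q | _     = contradiction q ne
  ... | no  _ | yes _ = refl
  ... | no  _ | no ¬e = contradiction e ¬e

  del-off : ∀ π x z → z ≢ x → π z ≢ x → del π x z ≡ π z
  del-off π x z ne ne′ with z ≟ x | π z ≟ x
  ... | yes q | _     = contradiction q ne
  ... | no  _ | yes q = contradiction q ne′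
  ... | no  _ | no  _ = refl

  del-fixed : ∀ π x z → π z ≡ z → del π x z ≡ z
  del-fixed π x z e with z ≟ x
  ... | yes q = sym q
  ... | no ne with π z ≟ x
  ...   | yes q = contradiction (trans (sym e) q) ne
  ...   | no  _ = e

  del-inverse : ∀ {f g : X → X} → (∀ z → f (g z) ≡ z) → (∀ z → g (f z) ≡ z) → ∀ x z → del f x (del g x z) ≡ z
  del-inverse {f} {g} fg gf x z with z ≟ x | g z ≟ x
  ... | yes q | _     = trans (del-self f x) (sym q)
  ... | no ne | yes q = trans (del-pred f x (g x) (λ e → ne (trans (sym (fg z)) (trans (cong f (trans q (sym e))) (fg x)))) (fg x))
                              (trans (cong f (sym q)) (fg z))
  ... | no ne | no ne′ = trans (del-off f x (g z) ne′ (λ e → ne (trans (sym (fg z)) e))) (fg z)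

  del↔ : X ↔ X → X → X ↔ X
  del↔ π x = mk↔ₛ′ (del to x) (del from x)
    (del-inverse strictlyInverseˡ strictlyInverseʳ x) (del-inverse strictlyInverseʳ strictlyInverseˡ x)
    where open Inverse π

  open Inverse using (to; from; strictlyInverseˡ; strictlyInverseʳ)

  -- The position at which `x` would have to be inserted again, with `nothing` for a fixed point as
  -- in `ins`.
  pred : X ↔ X → X → Maybe X
  pred π x with from π x ≟ x
  ... | yes _ = nothing
  ... | no  _ = just (from π x)

  pred-fixed : ∀ π {x} → to π x ≡ x → pred π x ≡ nothing
  pred-fixed π {x} e with from π x ≟ x
  ... | yes _ = refl
  ... | no ne = contradiction (trans (cong (from π) (sym e)) (strictlyInverseʳ π x)) ne

  pred-moved : ∀ π {x y} → to π y ≡ x → y ≢ x → pred π x ≡ just y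
  pred-moved π {x} {y} e ne with from π x ≟ x
  ... | yes q = contradiction (trans (sym (strictlyInverseʳ π y)) (trans (cong (from π) e) q)) ne
  ... | no  _ = cong just (trans (cong (from π) (sym e)) (strictlyInverseʳ π y))

  pred-nothing : ∀ π {x} → pred π x ≡ nothing → to π x ≡ x
  pred-nothing π {x} e with from π x ≟ x
  ... | yes q = trans (cong (to π) (sym q)) (strictlyInverseˡ π x)
  pred-nothing π {x} () | no _

  pred-just : ∀ π {x y} → pred π x ≡ just y → to π y ≡ x × y ≢ x
  pred-just π {x} e with from π x ≟ x
  pred-just π {x} () | yes _
  pred-just π {x} refl | no ne = strictlyInverseˡ π x , ne

  module Insertion {A : Set} (_≟ₐ_ : DecidableEquality A) (s : A → A) (m : Maybe A)
                   (f : Maybe A → X) (f-inj : Injective f) (π : X ↔ X) where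

    private
      x : X
      x = f nothing

    -- With its converse `delete`: `f` carries an insertion to `π` exactly when it carries `s` to
    -- `π` without `x`, and `m` to the position of `x`.
    undelete : (∀ d → f (just (s d)) ≡ del (to π) x (f (just d))) → pred π x ≡ Maybe.map (f ∘ just) m →
               ∀ z → f (ins _≟ₐ_ s m z) ≡ to π (f z)
    undelete h p nothing = at-new m h p
      where
      at-new : ∀ m → (∀ d → f (just (s d)) ≡ del (to π) x (f (just d))) → pred π x ≡ Maybe.map (f ∘ just) m →
               f (Maybe.map s m) ≡ to π x
      at-new nothing  h p = sym (pred-nothing π p)
      at-new (just y) h p = let e , ne = pred-just π p in trans (h y) (del-pred (to π) x (f (just y)) ne e)
    undelete h p (just d) with Maybeₚ.≡-dec _≟ₐ_ m (just d)
    ... | yes refl = sym (proj₁ (pred-just π p))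
    ... | no ne = trans (h d) (del-off (to π) x (f (just d)) (λ e → contradiction (f-inj e) λ ())
      λ e → ne (Maybeₚ.map-injective (just-injective ∘ f-inj) (trans (sym p) (pred-moved π e (λ q → contradiction (f-inj q) λ ())))))

    delete : (∀ z → f (ins _≟ₐ_ s m z) ≡ to π (f z)) →
             (∀ d → f (just (s d)) ≡ del (to π) x (f (just d))) × pred π x ≡ Maybe.map (f ∘ just) m
    delete h = step , before m h
      where
      step : ∀ d → f (just (s d)) ≡ del (to π) x (f (just d))
      step d with Maybeₚ.≡-dec _≟ₐ_ m (just d) | h (just d)
      ... | yes refl | e = trans (h nothing) (sym (del-pred (to π) x (f (just d)) (λ q → contradiction (f-inj q) λ ()) (sym e)))
      ... | no ne    | e = trans e (sym (del-off (to π) x (f (just d)) (λ q → contradiction (f-inj q) λ ())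
        (λ q → contradiction (f-inj (trans e q)) λ ())))
      before : ∀ m → (∀ z → f (ins _≟ₐ_ s m z) ≡ to π (f z)) → pred π x ≡ Maybe.map (f ∘ just) m
      before nothing  h = pred-fixed π (sym (h nothing))
      before (just y) h = pred-moved π (sym (trans (cong f (sym (ins-at _≟ₐ_ s y))) (h (just y)))) (λ q → contradiction (f-inj q) λ ())

  module Embedding (ω : X → X) (ω-inv : ∀ x → ω (ω x) ≡ x) where

    -- Identifies `c` with the component of the dart `m` under `π` and `ω`, or with the empty map if
    -- `m` is `nothing`. `X` may contain further elements, such as deleted darts and other
    -- components.
    record Emb (c : Gen) (π : X ↔ X) (m : Maybe X) : Set where
      field
        ι       : Darts c → X
        ι-inj   : Injective ι
        ι-σ     : ∀ d → ι (σ c d) ≡ to π (ι d)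
        ι-α     : ∀ d → ι (α c d) ≡ ω (ι d)
        ι-start : Maybe.map ι (start c) ≡ m

    open Emb

    emb-empty : ∀ {π} → Emb empty π nothing
    emb-empty = record { ι = λ () ; ι-inj = λ {x} → ⊥-elim x ; ι-σ = λ () ; ι-α = λ () ; ι-start = refl }

    ι-unique : ∀ {c π m} (E E′ : Emb c π m) → ∀ d → ι E d ≡ ι E′ d
    ι-unique {c} {π} E E′ = all-darts c (λ d → ι E d ≡ ι E′ d)
      (λ {d} e → trans (ι-σ E d) (trans (cong (to π) e) (sym (ι-σ E′ d))))
      (λ {d} e → trans (ι-α E d) (trans (cong ω e) (sym (ι-α E′ d))))
      (λ e → just-injective (trans (cong (Maybe.map (ι E)) (sym e))
        (trans (ι-start E) (trans (sym (ι-start E′)) (cong (Maybe.map (ι E′)) e)))))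

    module _ (π : X ↔ X) (r : X) where

      private
        ρ : X
        ρ = ω r

      -- `ρ` goes before `r`, the reverse of the order in which `Gen` inserts them. In between, the
      -- position of `r` is read off from `without-ρ`.
      without-ρ without-edge : X ↔ X
      without-ρ    = del↔ π ρ
      without-edge = del↔ without-ρ r

      Avoids : ∀ {c m} → Emb c without-edge m → Set
      Avoids {c} E = ∀ d → ι E d ≢ r × ι E d ≢ ρ

      Disjoint : ∀ {a b m m′} → Emb a without-edge m → Emb b without-edge m′ → Set
      Disjoint E F = ∀ x y → ι E x ≢ ι F y

      emb-chord : ∀ {c} (E : Emb c without-edge (pred without-ρ r)) → Avoids E → r ≢ ρ →
                  ∀ p → pred π ρ ≡ just (attach r (ι E) p) → Emb (chord c p) π (just r)
      emb-chord {c} E av r≢ρ p e = record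
        { ι = g ; ι-inj = g-inj
        ; ι-σ = Insertion.undelete (_≟ᴹ_ {c}) (insᴰ c (σ c)) (just p) g g-inj π
            (Insertion.undelete (_≟ᴰ_ {c}) (σ c) (start c) f f-inj without-ρ (ι-σ E) (sym (ι-start E))) e
        ; ι-α = λ where
            nothing         → sym (ω-inv r)
            (just nothing)  → refl
            (just (just d)) → ι-α E d
        ; ι-start = refl }
        where
        f : Maybe (Darts c) → X
        f = attach r (ι E)
        f-inj : Injective f
        f-inj = attach-inj (ι-inj E) (proj₁ ∘ av)
        g : Maybe (Maybe (Darts c)) → X
        g = attach ρ f
        g-inj : Injective g
        g-inj = attach-inj f-inj λ where
          nothing  → r≢ρ
          (just d) → proj₂ (av d)

      emb-bridge : ∀ {a b} (E : Emb a without-edge (pred without-ρ r)) (F : Emb b without-edge (pred π ρ)) →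
                   Avoids E → Avoids F → Disjoint E F → r ≢ ρ → pred π ρ ≢ just r → Emb (bridge a b) π (just r)
      emb-bridge {a} {b} E F avE avF dis r≢ρ p≢r = record
        { ι = g ; ι-inj = g-inj
        ; ι-σ = λ where
            (inj₁ z) → trans (Insertion.undelete (_≟ᴰ_ {a}) (σ a) (start a) f₁ f₁-inj without-ρ (ι-σ E) (sym (ι-start E)) z)
                             (del-off (to π) ρ (f₁ z) (f₁≢ρ z) (f₁-next z))
            (inj₂ z) → Insertion.undelete (_≟ᴰ_ {b}) (σ b) (start b) f₂ f₂-inj π
                         (λ d → trans (ι-σ F d) (del-off (to without-ρ) r (ι F d) (proj₁ (avF d)) (ιF-next d)))
                         (sym (ι-start F)) z
        ; ι-α = λ where
            (inj₁ nothing)  → refl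
            (inj₂ nothing)  → sym (ω-inv r)
            (inj₁ (just d)) → ι-α E d
            (inj₂ (just d)) → ι-α F d
        ; ι-start = refl }
        where
        f₁ : Maybe (Darts a) → X
        f₁ = attach r (ι E)
        f₁-inj : Injective f₁
        f₁-inj = attach-inj (ι-inj E) (proj₁ ∘ avE)
        f₂ : Maybe (Darts b) → X
        f₂ = attach ρ (ι F)
        f₂-inj : Injective f₂
        f₂-inj = attach-inj (ι-inj F) (proj₂ ∘ avF)
        f₁≢ρ : ∀ z → f₁ z ≢ ρ
        f₁≢ρ nothing  = r≢ρ
        f₁≢ρ (just d) = proj₂ (avE d)
        f₁≢f₂ : ∀ z w → f₁ z ≢ f₂ w
        f₁≢f₂ z        nothing  = f₁≢ρ z
        f₁≢f₂ nothing  (just y) = ≢-sym (proj₁ (avF y))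
        f₁≢f₂ (just x) (just y) = dis x y
        g : Darts (bridge a b) → X
        g = Sum.[ f₁ , f₂ ]
        g-inj : Injective g
        g-inj {inj₁ x} {inj₁ y} e = cong inj₁ (f₁-inj e)
        g-inj {inj₁ x} {inj₂ y} e = contradiction e (f₁≢f₂ x y)
        g-inj {inj₂ x} {inj₁ y} e = contradiction (sym e) (f₁≢f₂ y x)
        g-inj {inj₂ x} {inj₂ y} e = cong inj₂ (f₂-inj e)
        f₁-next : ∀ z → to π (f₁ z) ≢ ρ
        f₁-next z e with start b | trans (ι-start F) (pred-moved π e (f₁≢ρ z))
        f₁-next nothing  e | just y | q = p≢r (pred-moved π e r≢ρ)
        f₁-next (just x) e | just y | q = dis x y (sym (just-injective q))
        f₁-next z e | nothing | ()
        ιF-next : ∀ d → to without-ρ (ι F d) ≢ r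
        ιF-next d e with start a | trans (ι-start E) (pred-moved without-ρ e (proj₁ (avF d)))
        ... | just x  | q  = dis x d (just-injective q)
        ... | nothing | ()

      module Root {c} (E : Emb c π (just r)) where

        at-r : ∀ {x} → start c ≡ just x → ι E x ≡ r
        at-r e = just-injective (trans (cong (Maybe.map (ι E)) (sym e)) (ι-start E))

        at-ρ : ∀ {x} → start c ≡ just x → ι E (α c x) ≡ ρ
        at-ρ e = trans (ι-α E _) (cong ω (at-r e))

      chord-sub : ∀ {c p} → Emb (chord c p) π (just r) → Emb c without-edge (pred without-ρ r)
      chord-pred : ∀ {c p} (E : Emb (chord c p) π (just r)) → pred π ρ ≡ just (ι E (just p))

      chord-sub {c} {p} E = record
        { ι = ι E ∘ just ∘ just
        ; ι-inj = just-injective ∘ just-injective ∘ ι-inj E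
        ; ι-σ = subst (λ x → ∀ d → ι E (just (just (σ c d))) ≡ del (to without-ρ) x (ι E (just (just d)))) (at-r refl) (proj₁ lower)
        ; ι-α = λ d → ι-α E (just (just d))
        ; ι-start = sym (trans (cong (pred without-ρ) (sym (at-r refl))) (proj₂ lower)) }
        where
        open Root E
        upper : ∀ d → ι E (just (insᴰ c (σ c) d)) ≡ del (to π) ρ (ι E (just d))
        upper = subst (λ x → ∀ d → ι E (just (insᴰ c (σ c) d)) ≡ del (to π) x (ι E (just d))) (at-ρ refl)
          (proj₁ (Insertion.delete (_≟ᴹ_ {c}) (insᴰ c (σ c)) (just p) (ι E) (ι-inj E) π (ι-σ E)))
        lower : (∀ d → ι E (just (just (σ c d))) ≡ del (to without-ρ) (ι E (just nothing)) (ι E (just (just d)))) ×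
                pred without-ρ (ι E (just nothing)) ≡ Maybe.map (ι E ∘ just ∘ just) (start c)
        lower = Insertion.delete (_≟ᴰ_ {c}) (σ c) (start c) (ι E ∘ just) (just-injective ∘ ι-inj E) without-ρ upper

      chord-pred {c} {p} E = trans (cong (pred π) (sym (at-ρ refl)))
        (proj₂ (Insertion.delete (_≟ᴹ_ {c}) (insᴰ c (σ c)) (just p) (ι E) (ι-inj E) π (ι-σ E)))
        where open Root E

      module BridgeSub {a b} (E : Emb (bridge a b) π (just r)) where

        open Root E
        private
          right-part : (∀ d → ι E (inj₂ (just (σ b d))) ≡ del (to π) (ι E (inj₂ nothing)) (ι E (inj₂ (just d)))) ×
                       pred π (ι E (inj₂ nothing)) ≡ Maybe.map (ι E ∘ inj₂ ∘ just) (start b)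
          right-part = Insertion.delete (_≟ᴰ_ {b}) (σ b) (start b) (ι E ∘ inj₂) (Sumₚ.inj₂-injective ∘ ι-inj E) π (ι-σ E ∘ inj₂)

          apart : ∀ z w → ι E (inj₁ z) ≢ ι E (inj₂ w)
          apart z w e = contradiction (ι-inj E e) λ ()

          apart-ρ : ∀ z → ι E (inj₁ z) ≢ ρ
          apart-ρ z e = apart z nothing (trans e (sym (at-ρ refl)))

          apart-r : ∀ w → ι E (inj₂ w) ≢ r
          apart-r w e = apart nothing w (trans (at-r refl) (sym e))

          keep : ∀ z → ι E (inj₁ (insᴰ a (σ a) z)) ≡ del (to π) ρ (ι E (inj₁ z))
          keep z = trans (ι-σ E (inj₁ z)) (sym (del-off (to π) ρ _ (apart-ρ z) λ e → apart-ρ _ (trans (ι-σ E (inj₁ z)) e)))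

          left-part : (∀ d → ι E (inj₁ (just (σ a d))) ≡ del (to without-ρ) (ι E (inj₁ nothing)) (ι E (inj₁ (just d)))) ×
                      pred without-ρ (ι E (inj₁ nothing)) ≡ Maybe.map (ι E ∘ inj₁ ∘ just) (start a)
          left-part = Insertion.delete (_≟ᴰ_ {a}) (σ a) (start a) (ι E ∘ inj₁) (Sumₚ.inj₁-injective ∘ ι-inj E) without-ρ keep

          right-ρ : ∀ d → ι E (inj₂ (just (σ b d))) ≡ del (to π) ρ (ι E (inj₂ (just d)))
          right-ρ = subst (λ x → ∀ d → ι E (inj₂ (just (σ b d))) ≡ del (to π) x (ι E (inj₂ (just d)))) (at-ρ refl) (proj₁ right-part)

        left-sub : Emb a without-edge (pred without-ρ r)
        left-sub = record
          { ι = ι E ∘ inj₁ ∘ just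
          ; ι-inj = just-injective ∘ Sumₚ.inj₁-injective ∘ ι-inj E
          ; ι-σ = subst (λ x → ∀ d → ι E (inj₁ (just (σ a d))) ≡ del (to without-ρ) x (ι E (inj₁ (just d)))) (at-r refl) (proj₁ left-part)
          ; ι-α = λ d → ι-α E (inj₁ (just d))
          ; ι-start = sym (trans (cong (pred without-ρ) (sym (at-r refl))) (proj₂ left-part)) }

        right-sub : Emb b without-edge (pred π ρ)
        right-sub = record
          { ι = ι E ∘ inj₂ ∘ just
          ; ι-inj = just-injective ∘ Sumₚ.inj₂-injective ∘ ι-inj E
          ; ι-σ = λ d → trans (right-ρ d) (sym (del-off (to without-ρ) r _ (apart-r _) λ e → apart-r _ (trans (right-ρ d) e)))
          ; ι-α = λ d → ι-α E (inj₂ (just d))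
          ; ι-start = sym (trans (cong (pred π) (sym (at-ρ refl))) (proj₂ right-part)) }

        disjoint : Disjoint left-sub right-sub
        disjoint x y = apart (just x) (just y)

        off-r : ∀ y → ι right-sub y ≢ r
        off-r y = apart-r (just y)

      -- In a chord, `ρ` follows `r` or a dart of `c`; in a bridge it follows a dart of `b` or is a
      -- fixed point. Comparing the two requires `ι-unique` for the first parts, hence the
      -- conclusion `a ≢ c`.
      chord≢bridge : ∀ {a b c p} → Emb (chord c p) π (just r) → Emb (bridge a b) π (just r) → a ≢ c
      chord≢bridge {a} {b} {c} {p} C B refl with start b | ι-start (BridgeSub.right-sub B) | chord-pred C
      ... | nothing | e | e′ = contradiction (trans e e′) λ ()
      chord≢bridge {p = nothing} C B refl | just y | e | e′ =
        BridgeSub.off-r B y (trans (just-injective (trans e e′)) (Root.at-r C refl))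
      chord≢bridge {p = just d} C B refl | just y | e | e′ =
        BridgeSub.disjoint B d y (trans (ι-unique (BridgeSub.left-sub B) (chord-sub C) d) (sym (just-injective (trans e e′))))

    -- The permutation without the root edge and the positions of its two darts depend on `π` and
    -- `r` alone, so each stage of the decomposition can be read off from them.
    emb-unique : ∀ c c′ {π m} → Emb c π m → Emb c′ π m → c ≡ c′
    emb-unique empty empty E E′ = refl
    emb-unique empty (bridge _ _) {m = nothing} E E′ = contradiction (ι-start E′) λ ()
    emb-unique empty (chord _ _)  {m = nothing} E E′ = contradiction (ι-start E′) λ ()
    emb-unique empty c′ {m = just _} E E′ = contradiction (ι-start E) λ ()
    emb-unique (bridge _ _) c′ {m = nothing} E E′ = contradiction (ι-start E) λ ()
    emb-unique (chord _ _)  c′ {m = nothing} E E′ = contradiction (ι-start E) λ ()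
    emb-unique (bridge _ _) empty {m = just _} E E′ = contradiction (ι-start E′) λ ()
    emb-unique (chord _ _)  empty {m = just _} E E′ = contradiction (ι-start E′) λ ()
    emb-unique (bridge a b) (bridge a′ b′) {π} {just r} E E′ = cong₂ bridge
      (emb-unique a a′ (BridgeSub.left-sub π r E) (BridgeSub.left-sub π r E′))
      (emb-unique b b′ (BridgeSub.right-sub π r E) (BridgeSub.right-sub π r E′))
    emb-unique (bridge a b) (chord c p) {π} {just r} E E′ =
      contradiction (emb-unique a c (BridgeSub.left-sub π r E) (chord-sub π r E′)) (chord≢bridge π r E′ E)
    emb-unique (chord c p) (bridge a b) {π} {just r} E E′ =
      contradiction (emb-unique a c (BridgeSub.left-sub π r E′) (chord-sub π r E)) (chord≢bridge π r E E′)
    emb-unique (chord c p) (chord c′ p′) {π} {just r} E E′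
      with emb-unique c c′ (chord-sub π r E) (chord-sub π r E′)
    ... | refl = cong (chord c) (just-injective (ι-inj E (trans
                   (just-injective (trans (sym (chord-pred π r E)) (chord-pred π r E′))) (sym (agree p′)))))
      where
      agree : ∀ z → ι E (just z) ≡ ι E′ (just z)
      agree nothing  = trans (Root.at-r π r E refl) (sym (Root.at-r π r E′ refl))
      agree (just d) = ι-unique (chord-sub π r E) (chord-sub π r E′) d

    module Existence (ω-free : ∀ x → ω x ≢ x) where

      -- `r` and `ω r` are fixed by `without-edge` and exchanged by `ω`, so no walk that starts
      -- elsewhere meets them.
      avoid : ∀ {π r c m} (E : Emb c (without-edge π r) m) → (∀ {x} → m ≡ just x → x ≢ r × x ≢ ω r) → Avoids π r E
      avoid {π} {r} {c} E h = all-darts c (λ d → ι E d ≢ r × ι E d ≢ ω r)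
        (λ {d} (n , n′) → stays r (del-self (to (without-ρ π r)) r) n
                        , stays (ω r) (del-fixed (to (without-ρ π r)) r (ω r) (del-self (to π) (ω r))) n′)
        (λ {d} (n , n′) → (λ e → n′ (trans (sym (ω-inv _)) (cong ω (trans (sym (ι-α E d)) e))))
                        , (λ e → n (trans (sym (ω-inv _)) (trans (cong ω (trans (sym (ι-α E d)) e)) (ω-inv r)))))
        (λ {d} e → h (trans (sym (ι-start E)) (cong (Maybe.map (ι E)) e)))
        where
        stays : ∀ x → to (without-edge π r) x ≡ x → ∀ {d} → ι E d ≢ x → ι E (σ c d) ≢ x
        stays x fix {d} n e = n (to-injective (without-edge π r) (trans (sym (ι-σ E d)) (trans e (sym fix))))

      -- The image of `E` is closed under `ω` and, `σ` being onto, under predecessors. Hence its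
      -- complement is closed under the steps that lead from `p` to all of the image of `F`.
      apart : ∀ {π r a b m p} (E : Emb a (without-edge π r) m) (F : Emb b (without-edge π r) (just p)) →
              ¬ (∃[ x ] ι E x ≡ p) → Disjoint π r E F
      apart {π} {r} {a} {b} E F off = λ x y e → none y (x , e)
        where
        none : ∀ y → ¬ (∃[ x ] ι E x ≡ ι F y)
        none = all-darts b (λ y → ¬ (∃[ x ] ι E x ≡ ι F y))
          (λ {y} n (x , e) → let x′ , q = σ-surjective a x in
            n (x′ , to-injective (without-edge π r) (trans (sym (ι-σ E x′)) (trans (cong (ι E) q) (trans e (ι-σ F y))))))
          (λ {y} n (x , e) → n (α a x , trans (ι-α E x) (trans (cong ω (trans e (ι-α F y))) (ω-inv _))))
          (λ {y} s (x , e) → off (x , trans e (just-injective (trans (sym (cong (Maybe.map (ι F)) s)) (ι-start F)))))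

      -- The position of `ω r` decides: a chord if it follows `r` or the component already embedded,
      -- a bridge if it is alone or follows something else, whose component is then the second part.
      assemble : ∀ π r → (∀ m → ∃[ c ] Emb c (without-edge π r) m) → ∃[ c ] Emb c π (just r)
      assemble π r rec with rec (pred (without-ρ π r) r)
      ... | c , E = second (pred π (ω r)) refl
        where
        avE : Avoids π r E
        avE = avoid {π} {r} E λ e → let q , ne = pred-just (without-ρ π r) e in
          ne , λ e′ → ω-free r (trans (sym (del-self (to π) (ω r))) (trans (cong (del (to π) (ω r)) (sym e′)) q))
        second : ∀ m → pred π (ω r) ≡ m → ∃[ c ] Emb c π (just r)
        second nothing e = bridge c empty , emb-bridge π r E (subst (Emb empty _) (sym e) emb-empty)
          avE (λ ()) (λ _ ()) (≢-sym (ω-free r)) (λ q → contradiction (trans (sym e) q) λ ())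
        second (just p) e with p ≟ r | any-dart? c (λ d → ι E d ≡ p) (λ d → ι E d ≟ p)
        ... | yes q | _           = chord c nothing , emb-chord π r E avE (≢-sym (ω-free r)) nothing (trans e (cong just q))
        ... | no  _ | yes (d , q) = chord c (just d) , emb-chord π r E avE (≢-sym (ω-free r)) (just d) (trans e (cong just (sym q)))
        ... | no ne | no off with rec (just p)
        ...   | c′ , F = bridge c c′ , emb-bridge π r E (subst (Emb c′ _) (sym e) F) avE
          (avoids-subst (sym e) F avF) (disjoint-subst (sym e) F (apart {π} {r} E F off)) (≢-sym (ω-free r))
          (λ q → ne (just-injective (trans (sym e) q)))
          where
          avF : Avoids π r F
          avF = avoid {π} {r} F λ where refl → ne , proj₂ (pred-just π e)
          avoids-subst : ∀ {m m′} (e : m ≡ m′) (F : Emb c′ (without-edge π r) m) → Avoids π r F → Avoids π r (subst (Emb c′ _) e F)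
          avoids-subst refl F h = h
          disjoint-subst : ∀ {m m′} (e : m ≡ m′) (F : Emb c′ (without-edge π r) m) → Disjoint π r E F → Disjoint π r E (subst (Emb c′ _) e F)
          disjoint-subst refl F h = h

      Live : X → X → Set
      Live r z = z ≢ r × z ≢ ω r

      live? : ∀ r → Decidable (Live r)
      live? r z = ¬? (z ≟ r) ×-dec ¬? (z ≟ ω r)

      -- Since deletions do not shrink `X`, the induction is on the length of a list `L` that
      -- contains all points moved by `π`. Deleting the root edge removes an entry unless both its
      -- darts are fixed points, and then the component is a single edge.
      decompose  : ∀ n L (π : X ↔ X) → length L ≤ n → (∀ z → to π z ≢ z → z ∈ L) → ∀ r → ∃[ c ] Emb c π (just r)
      decompose-edge : ∀ n L (π : X ↔ X) → length L ≤ n → (∀ z → to π z ≢ z → z ∈ L) → ∀ r →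
                       Any (λ z → ¬ Live r z) L → ∃[ c ] Emb c π (just r)
      decompose? : ∀ n L (π : X ↔ X) → length L ≤ n → (∀ z → to π z ≢ z → z ∈ L) → ∀ m → ∃[ c ] Emb c π m

      decompose? n L π l h nothing  = empty , emb-empty
      decompose? n L π l h (just r) = decompose n L π l h r

      decompose n L π l h r with to π r ≟ r | to π (ω r) ≟ ω r
      ... | yes e | yes e′ = bridge empty empty , emb-bridge π r
        (subst (Emb empty _) (sym (pred-fixed (without-ρ π r) (del-fixed (to π) (ω r) r e))) emb-empty)
        (subst (Emb empty _) (sym (pred-fixed π e′)) emb-empty)
        (λ ()) (λ ()) (λ ()) (≢-sym (ω-free r))
        λ q → contradiction (trans (sym q) (pred-fixed π e′)) λ ()
      ... | no e | _ = decompose-edge n L π l h r (lose (h r e) λ (n , _) → n refl)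
      ... | yes _ | no e = decompose-edge n L π l h r (lose (h (ω r) e) λ (_ , n) → n refl)

      decompose-edge zero    L π l h r i = contradiction (ℕ.<-≤-trans (List.filter-notAll (live? r) L i) l) λ ()
      decompose-edge (suc n) L π l h r i = assemble π r (decompose? n L′ (without-edge π r) l′ h′)
        where
        L′ : List X
        L′ = filter (live? r) L
        l′ : length L′ ≤ n
        l′ = ℕ.≤-pred (ℕ.<-≤-trans (List.filter-notAll (live? r) L i) l)
        h′ : ∀ z → to (without-edge π r) z ≢ z → z ∈ L′
        h′ z ne = ∈-filter⁺ (live? r)
          (h z λ e → ne (del-fixed (to (without-ρ π r)) r z (del-fixed (to π) (ω r) z e)))
          ((λ e → ne (trans (cong (to (without-edge π r)) e) (trans (del-self (to (without-ρ π r)) r) (sym e))))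
          , (λ e → ne (trans (cong (to (without-edge π r)) e)
              (trans (del-fixed (to (without-ρ π r)) r (ω r) (del-self (to π) (ω r))) (sym e)))))

open Count
open Faces

-- Planar bipartite maps

iter-distinct : ∀ {A : Set} {π : A → A} {x p} → Injective π → First π x p x →
                ∀ i j → i < j → j < p → iter π i x ≢ iter π j x
iter-distinct {π = π} {x} inj (_ , f) i j i<j j<p e with ℕ.m≤n⇒∃[o]m+o≡n (ℕ.<⇒≤ i<j)
... | zero  , refl = contradiction (sym (ℕ.+-identityʳ i)) (ℕ.<⇒≢ i<j)
... | suc o , refl = f (suc o) (s≤s z≤n) (ℕ.≤-<-trans (ℕ.m≤n+m (suc o) i) j<p) (sym (iter-cancel π inj i (suc o) x e))

iter-injective : ∀ {A : Set} {π : A → A} {x p} → Injective π → First π x p x →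
                 ∀ i j → i < p → j < p → iter π i x ≡ iter π j x → i ≡ j
iter-injective inj f i j i<p j<p e with ℕ.<-cmp i j
... | tri< i<j _ _ = contradiction e (iter-distinct inj f i j i<j j<p)
... | tri≈ _ q _   = q
... | tri> _ _ j<i = contradiction (sym e) (iter-distinct inj f j i j<i i<p)

iter-mod : ∀ {A : Set} (π : A → A) {x} p .{{_ : NonZero p}} → iter π p x ≡ x → ∀ n → iter π (n % p) x ≡ iter π n x
iter-mod π {x} p e n = sym (trans (cong (λ m → iter π m x) (trans (DivMod.m≡m%n+[m/n]*n n p) (ℕ.+-comm (n % p) _)))
  (trans (iter-+ π (n / p * p) (n % p) x) (cong (iter π (n % p)) (turns (n / p)))))
  where
  turns : ∀ q → iter π (q * p) x ≡ x
  turns zero    = refl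
  turns (suc q) = trans (iter-+ π p (q * p) x) (trans (cong (iter π (q * p)) e) (turns q))

first-cong : ∀ {A : Set} {π ρ : A → A} {x n y} → (∀ z → π z ≡ ρ z) → First π x n y → First ρ x n y
first-cong {x = x} {n} h (e , f) = trans (sym (iter-cong h n x)) e , λ j p q e′ → f j p q (trans (iter-cong h j x) e′)

parity : ∀ n → (∃[ i ] n ≡ 2 * i) ⊎ (∃[ i ] n ≡ suc (2 * i))
parity zero = inj₁ (0 , refl)
parity (suc n) with parity n
... | inj₁ (i , refl) = inj₂ (i , refl)
... | inj₂ (i , refl) = inj₁ (suc i , cong suc (sym (ℕ.+-suc i (i + 0))))

double : ∀ d → 2 * suc d ≡ suc (suc (2 * d))
double d = cong suc (ℕ.+-suc d (d + 0))

gen : Code → Gen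
gen empty         = empty
gen (bridge a b)  = bridge (gen a) (gen b)
-- The root face has `2 * deg k` corners; a bipartite map only admits chords to those at an odd
-- distance `2 * i + 1` from the root corner, one for each `i < deg k`.
gen (chord i k _) = chord (gen k) (Maybe.map (iter (ψ (gen k)) (suc (2 * i))) (start (gen k)))

gen-edges : ∀ k → edgesᴳ (gen k) ≡ edges k
gen-edges empty         = refl
gen-edges (bridge a b)  = cong suc (cong₂ _+_ (gen-edges a) (gen-edges b))
gen-edges (chord _ k _) = cong suc (gen-edges k)

gen-start : ∀ k → 0 < deg k → ∃[ x ] start (gen k) ≡ just x
gen-start (bridge _ _)  _ = _ , refl
gen-start (chord _ _ _) _ = _ , refl

ψ⁺-start : ∀ c {x} → start c ≡ just x → ∀ z → ψ⁺ c z ≡ ins (_≟ᴰ_ {c}) (ψ c) (just x) z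
ψ⁺-start c e z = cong (λ m → ins (_≟ᴰ_ {c}) (ψ c) m z) e

-- These periods justify reading `deg` as half the degree of the root face; the virtual dart adds
-- one to the length.
period⁺ : ∀ k → First (ψ⁺ (gen k)) nothing (suc (2 * deg k)) nothing
period  : ∀ k {x} → start (gen k) ≡ just x → First (ψ (gen k)) x (2 * deg k) x

-- The virtual dart sits right after `x`, so until the cycle closes its iterates are those of `x`.
chord-path : ∀ i k → i < deg k → ∀ {x} → start (gen k) ≡ just x →
             First (ψ⁺ (gen k)) nothing (suc (2 * i)) (just (iter (ψ (gen k)) (suc (2 * i)) x))
chord-path i k i<d {x} e = walk (2 * i) ℕ.≤-refl , avoid
  where
  c = gen k
  bound : suc (2 * i) < 2 * deg k
  bound = ℕ.<-≤-trans (ℕ.≤-reflexive (sym (double i))) (ℕ.*-monoʳ-≤ 2 i<d)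
  walk : ∀ j → j ≤ 2 * i → iter (ψ⁺ c) (suc j) nothing ≡ just (iter (ψ c) (suc j) x)
  walk j q = trans (iter-cong (ψ⁺-start c e) (suc j) nothing)
    (ins-walk (_≟ᴰ_ {c}) (ψ c) x (2 * deg k) (period k e) j (s≤s (ℕ.≤-<-trans q (ℕ.<⇒≤ bound))))
  avoid : ∀ j → 0 < j → j < suc (2 * i) → iter (ψ⁺ c) j nothing ≢ just (iter (ψ c) (suc (2 * i)) x)
  avoid (suc j) _ (s≤s q) e′ = iter-distinct (ψ-injective c) (period k e) (suc j) (suc (2 * i)) (s≤s q) bound
    (just-injective (trans (sym (walk j (ℕ.<⇒≤ q))) e′))

period⁺ empty = refl , λ where (suc j) _ (s≤s ())
period⁺ k@(bridge a b)  = ins-period (_≟ᴰ_ {gen k}) (ψ (gen k)) _ (2 * deg k) (s≤s z≤n) (period k refl)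
period⁺ k@(chord _ _ _) = ins-period (_≟ᴰ_ {gen k}) (ψ (gen k)) _ (2 * deg k) (s≤s z≤n) (period k refl)

period (bridge a b) refl with faces-of (gen a) | faces-of (gen b)
... | A@record { faces = zero } | B = case lab (countψ⁺ A) nothing of λ ()
... | A@record { faces = suc f } | B =
  first-cong (ψ-bridge (gen a) (gen b)) (subst (λ n → First T (inj₁ nothing) n (inj₁ nothing)) (arith (deg a) (deg b))
    (Merge.period-merge (_≟ᴰ_ {bridge (gen a) (gen b)}) AB (inj₁ nothing) (inj₂ nothing) (λ e → inj₁≁inj₂ (complete AB e))
      (s≤s z≤n) (lift inj₁ (λ _ → refl) Sumₚ.inj₁-injective (period⁺ a))
      (s≤s z≤n) (lift inj₂ (λ _ → refl) Sumₚ.inj₂-injective (period⁺ b))))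
  where
  AB : Count (Sum.map (ψ⁺ (gen a)) (ψ⁺ (gen b))) (suc f + faces B)
  AB = count-⊎ (countψ⁺ A) (countψ⁺ B)
  T : Darts (gen (bridge a b)) → Darts (gen (bridge a b))
  T = swap (_≟ᴰ_ {bridge (gen a) (gen b)}) (inj₁ nothing) (inj₂ nothing) ∘ Sum.map (ψ⁺ (gen a)) (ψ⁺ (gen b))
  lift : ∀ {A B : Set} {π : A → A} {ρ : B → B} {x n} (h : A → B) → (∀ z → h (π z) ≡ ρ (h z)) → Injective h →
         First π x n x → First ρ (h x) n (h x)
  lift {x = x} {n} h c inj (e , f) = trans (sym (iter-map h c n x)) (cong h e) , λ j p q e′ → f j p q (inj (trans (iter-map h c j x) e′))
  arith : ∀ d e → suc (2 * d) + suc (2 * e) ≡ 2 * suc (d + e)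
  arith = solve-∀
period (chord i k i<d) refl with gen-start k (ℕ.<-≤-trans (s≤s z≤n) i<d)
... | x , e = first-cong (λ z → ψ-chord c p z)
  (subst (λ n → First T (just nothing) n (just nothing)) (sym (double i))
    -- The arc from the root dart to its opposite has `2 * i + 2` points; cut off by the chord, it
    -- becomes the new root face.
    (Split.Arc.period-split (_≟ᴰ_ {chord c p})
      (ins-injective (_≟ᴹ_ {c}) (just p) (ins-injective (_≟ᴰ_ {c}) (start c) (ψ-injective c)))
      (just nothing) nothing (λ ()) (s≤s z≤n)
      (subst (λ q → First (ins (_≟ᴹ_ {c}) (ψ⁺ c) (just q)) (just nothing) (suc (suc (2 * i))) nothing)
        (sym (cong (Maybe.map (iter (ψ c) (suc (2 * i)))) e))
        (ins-first (_≟ᴹ_ {c}) (ψ⁺ c) nothing (suc (2 * i)) (just (iter (ψ c) (suc (2 * i)) x)) (s≤s z≤n) (chord-path i k i<d e) λ ()))))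
  where
  c = gen k
  p = Maybe.map (iter (ψ c) (suc (2 * i))) (start c)
  T : Maybe (Maybe (Darts c)) → Maybe (Maybe (Darts c))
  T = swap (_≟ᴰ_ {chord c p}) (just nothing) nothing ∘ ins (_≟ᴹ_ {c}) (ψ⁺ c) (just p)

gen-planar : ∀ k → Planarᴳ (gen k)
gen-planar empty           = tt
gen-planar (bridge a b)    = gen-planar a , gen-planar b
gen-planar (chord i k i<d) with gen-start k (ℕ.<-≤-trans (s≤s z≤n) i<d)
... | x , e = gen-planar k , suc (2 * i) ,
  trans (proj₁ (chord-path i k i<d e)) (sym (cong (Maybe.map (iter (ψ (gen k)) (suc (2 * i)))) e))

chordᴳ-injectiveˡ : ∀ {c c′ p p′} → Gen.chord c p ≡ chord c′ p′ → c ≡ c′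
chordᴳ-injectiveˡ refl = refl

chordᴳ-injectiveʳ : ∀ {c p p′} → Gen.chord c p ≡ chord c p′ → p ≡ p′
chordᴳ-injectiveʳ refl = refl

bridgeᴳ-injective : ∀ {a b a′ b′} → Gen.bridge a b ≡ bridge a′ b′ → a ≡ a′ × b ≡ b′
bridgeᴳ-injective refl = refl , refl

-- The end of a chord determines its index because the iterates of the root are distinct below the
-- period.
gen-injective : Injective gen
gen-injective {empty} {empty} e = refl
gen-injective {bridge a b} {bridge a′ b′} e = cong₂ bridge
  (gen-injective (proj₁ (bridgeᴳ-injective e))) (gen-injective (proj₂ (bridgeᴳ-injective e)))
gen-injective {chord i k i<d} {chord i′ k′ i′<d} e with gen-injective {k} {k′} (chordᴳ-injectiveˡ e)
... | refl with gen-start k (ℕ.<-≤-trans (s≤s z≤n) i<d)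
...   | x , s with trans (cong (Maybe.map _) (sym s)) (trans (chordᴳ-injectiveʳ e) (cong (Maybe.map _) s))
...     | q with ℕ.*-cancelˡ-≡ i i′ 2 (ℕ.suc-injective (iter-injective (ψ-injective (gen k)) (period k s) _ _ (bound i i<d) (bound i′ i′<d) (just-injective q)))
  where
  bound : ∀ i → i < deg k → suc (2 * i) < 2 * deg k
  bound i h = ℕ.<-≤-trans (ℕ.≤-reflexive (sym (double i))) (ℕ.*-monoʳ-≤ 2 h)
...       | refl = cong (chord i k) (ℕ.≤-irrelevant i<d i′<d)
gen-injective {empty} {bridge _ _} ()
gen-injective {empty} {chord _ _ _} ()
gen-injective {bridge _ _} {empty} ()
gen-injective {bridge _ _} {chord _ _ _} ()
gen-injective {chord _ _ _} {empty} ()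
gen-injective {chord _ _ _} {bridge _ _} ()

record Colouring (c : Gen) : Set where
  field
    χ   : Darts c → Bool
    χ-σ : ∀ d → χ (σ c d) ≡ χ d
    χ-α : ∀ d → χ (α c d) ≡ not (χ d)

  χ-ψ : ∀ d → χ (ψ c d) ≡ not (χ d)
  χ-ψ d = trans (χ-α (σ c d)) (cong not (χ-σ d))

  χ-even : ∀ i d → χ (iter (ψ c) (2 * i) d) ≡ χ d
  χ-even zero    d = refl
  χ-even (suc i) d = trans (cong (λ n → χ (iter (ψ c) n d)) (double i))
    (trans (χ-even i (ψ c (ψ c d))) (trans (χ-ψ (ψ c d)) (trans (cong not (χ-ψ d)) (Boolₚ.not-involutive (χ d)))))

  χ-odd : ∀ i d → χ (iter (ψ c) (suc (2 * i)) d) ≡ not (χ d)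
  χ-odd i d = trans (χ-even i (ψ c d)) (χ-ψ d)

open Colouring

module _ {A B : Set} (_≟_ : DecidableEquality A) (π : A → A) (m : Maybe A) (f : Maybe A → B) where

  ins-constant : (∀ d → f (just (π d)) ≡ f (just d)) → (∀ {x} → m ≡ just x → f (just x) ≡ f nothing) →
                 ∀ z → f (ins _≟_ π m z) ≡ f z
  ins-constant h h₀ nothing = at-new m h₀
    where
    at-new : ∀ m → (∀ {x} → m ≡ just x → f (just x) ≡ f nothing) → f (Maybe.map π m) ≡ f nothing
    at-new nothing  _  = refl
    at-new (just x) h₀ = trans (h x) (h₀ refl)
  ins-constant h h₀ (just d) with Maybeₚ.≡-dec _≟_ m (just d)
  ... | yes e = sym (h₀ e)
  ... | no  _ = h d

  constant-ins : (∀ z → f (ins _≟_ π m z) ≡ f z) →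
                 (∀ d → f (just (π d)) ≡ f (just d)) × (∀ {x} → m ≡ just x → f nothing ≡ f (just x))
  constant-ins h = lowered , at-old
    where
    lowered : ∀ d → f (just (π d)) ≡ f (just d)
    lowered d with Maybeₚ.≡-dec _≟_ m (just d) | h (just d)
    ... | no  _    | e = e
    ... | yes refl | e = trans (h nothing) e
    at-old : ∀ {x} → m ≡ just x → f nothing ≡ f (just x)
    at-old {x} refl = trans (cong f (sym (ins-at _≟_ π x))) (h (just x))

-- Prescribing the colour of the root allows the two sides of a bridge to be matched. The ends of a
-- chord get different colours because their distance along the face is odd.
gen-colouring : ∀ k b → Σ (Colouring (gen k)) λ C → ∀ {x} → start (gen k) ≡ just x → χ C x ≡ b
gen-colouring empty b = record { χ = λ () ; χ-σ = λ () ; χ-α = λ () } , λ ()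
gen-colouring (bridge k l) b with gen-colouring k b | gen-colouring l (not b)
... | C , c | D , d = record
  { χ = Sum.[ attach b (χ C) , attach (not b) (χ D) ]
  ; χ-σ = λ where
      (inj₁ z) → ins-constant (_≟ᴰ_ {gen k}) (σ (gen k)) (start (gen k)) (attach b (χ C)) (χ-σ C) c z
      (inj₂ z) → ins-constant (_≟ᴰ_ {gen l}) (σ (gen l)) (start (gen l)) (attach (not b) (χ D)) (χ-σ D) d z
  ; χ-α = λ where
      (inj₁ nothing)  → refl
      (inj₂ nothing)  → sym (Boolₚ.not-involutive b)
      (inj₁ (just z)) → χ-α C z
      (inj₂ (just z)) → χ-α D z
  } , λ where refl → refl
gen-colouring (chord i k i<d) b with gen-colouring k b | gen-start k (ℕ.<-≤-trans (s≤s z≤n) i<d)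
... | C , c | x , e = record
  { χ = attach (not b) (attach b (χ C))
  ; χ-σ = ins-constant (_≟ᴹ_ {gen k}) (insᴰ (gen k) (σ (gen k))) _ (attach (not b) (attach b (χ C)))
      (ins-constant (_≟ᴰ_ {gen k}) (σ (gen k)) (start (gen k)) (attach b (χ C)) (χ-σ C) c)
      λ where refl → trans (cong (attach b (χ C) ∘ Maybe.map (iter (ψ (gen k)) (suc (2 * i)))) e)
                       (trans (χ-odd C i x) (cong not (c e)))
  ; χ-α = λ where
      nothing         → sym (Boolₚ.not-involutive b)
      (just nothing)  → refl
      (just (just z)) → χ-α C z
  } , λ where refl → refl

reach-start : ∀ c {d} → Reach (ψ⁺ c) nothing (just d) → ∃[ x ] start c ≡ just x × Reach (ψ c) x d
reach-start c@(bridge _ _) r = let C = countψ (faces-of c) refl in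
  _ , refl , complete C (lab-reach (count-ins (_≟ᴰ_ {c}) _ C) r)
reach-start c@(chord _ _) r = let C = countψ (faces-of c) refl in
  _ , refl , complete C (lab-reach (count-ins (_≟ᴰ_ {c}) _ C) r)

deg-positive : ∀ k {x} → start (gen k) ≡ just x → 0 < deg k
deg-positive (bridge _ _)  _ = s≤s z≤n
deg-positive (chord _ _ _) _ = s≤s z≤n

code-of : ∀ c → Planarᴳ c → Colouring c → ∃[ k ] gen k ≡ c
code-of empty _ _ = empty , refl
code-of (bridge a b) (p , q) C with code-of a p A | code-of b q B
  where
  A : Colouring a
  A = record { χ = χ C ∘ inj₁ ∘ just
             ; χ-σ = proj₁ (constant-ins (_≟ᴰ_ {a}) (σ a) (start a) (χ C ∘ inj₁) (χ-σ C ∘ inj₁))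
             ; χ-α = λ d → χ-α C (inj₁ (just d)) }
  B : Colouring b
  B = record { χ = χ C ∘ inj₂ ∘ just
             ; χ-σ = proj₁ (constant-ins (_≟ᴰ_ {b}) (σ b) (start b) (χ C ∘ inj₂) (χ-σ C ∘ inj₂))
             ; χ-α = λ d → χ-α C (inj₂ (just d)) }
... | k , refl | l , refl = bridge k l , refl
code-of (chord c p) (pl , r) C = chord-code (code-of c pl C′) p (proj₂ outer refl) r
  where
  outer = constant-ins (_≟ᴹ_ {c}) (insᴰ c (σ c)) (just p) (χ C) (χ-σ C)
  inner = constant-ins (_≟ᴰ_ {c}) (σ c) (start c) (χ C ∘ just) (proj₁ outer)
  C′ : Colouring c
  C′ = record { χ = χ C ∘ just ∘ just ; χ-σ = proj₁ inner ; χ-α = λ d → χ-α C (just (just d)) }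
  ρ≢r : χ C nothing ≢ χ C (just nothing)
  ρ≢r e = Boolₚ.not-¬ e (χ-α C (just nothing))
  chord-code : (∃[ k ] gen k ≡ c) → ∀ p → χ C nothing ≡ χ C (just p) → Reach (ψ⁺ c) nothing p → ∃[ k ] gen k ≡ chord c p
  chord-code _ nothing e _ = contradiction e ρ≢r
  chord-code (k , refl) (just d) e r with reach-start c r
  -- The position matters only modulo the degree of the root face. An even one would give both ends
  -- of the chord the same colour.
  ... | x , s , n , q = finish (parity (n % (2 * deg k)))
    where
    pos : 0 < deg k
    pos = deg-positive k s
    instance
      nz : NonZero (2 * deg k)
      nz = >-nonZero (ℕ.<-≤-trans pos (ℕ.m≤m+n (deg k) _))
    short : iter (ψ c) (n % (2 * deg k)) x ≡ d
    short = trans (iter-mod (ψ c) (2 * deg k) (proj₁ (period k s)) n) q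
    finish : _ → ∃[ k ] gen k ≡ chord c (just d)
    finish (inj₁ (i , h)) = contradiction
      (trans e (trans (cong (χ C ∘ just ∘ just) (trans (sym short) (cong (λ j → iter (ψ c) j x) h)))
        (trans (χ-even C′ i x) (sym (proj₂ inner s))))) ρ≢r
    finish (inj₂ (i , h)) = chord i k i<d , cong (chord c)
      (trans (cong (Maybe.map (iter (ψ c) (suc (2 * i)))) s) (cong just (trans (cong (λ j → iter (ψ c) j x) (sym h)) short)))
      where
      i<d : i < deg k
      i<d = ℕ.*-cancelˡ-< 2 i (deg k) (ℕ.<-trans (ℕ.n<1+n (2 * i)) (subst (_< 2 * deg k) h (DivMod.m%n<n n (2 * deg k))))

open Count
open Faces
open Colouring using (χ; χ-σ; χ-α)
open Inverse using (to; from; strictlyInverseˡ; strictlyInverseʳ)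

-- Rotation systems on numbered darts

reach-orbit : ∀ {A : Set} {π : A → A} {x y} → Reach π x y → EqClosure (λ x y → π x ≡ y) x y
reach-orbit (zero  , refl) = ε
reach-orbit {π = π} (suc n , e) = fwd refl ◅ reach-orbit (n , e)

orbit-lab : ∀ {A : Set} {π : A → A} {k} (C : Count π k) {x y} → EqClosure (λ x y → π x ≡ y) x y → lab C x ≡ lab C y
orbit-lab C = EqC.gfold isEquivalence (lab C) λ where refl → sym (lab-π C _)

count-cardinality : ∀ {A : Set} {π : A → A} {k} → Count π k → HasCardinality (Orbits π) k
count-cardinality C = record
  { to = lab C ; cong = orbit-lab C
  ; bijective = (λ e → reach-orbit (complete C e))
              , λ i → rep C i , λ e → trans (orbit-lab C e) (lab-rep C i) }

cardinality-unique : ∀ {S : Setoid 0ℓ 0ℓ} {k l} → HasCardinality S k → HasCardinality S l → k ≡ l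
cardinality-unique {S} B B′ = ℕ.≤-antisym (bound B B′) (bound B′ B)
  where
  bound : ∀ {k l} → HasCardinality S k → HasCardinality S l → k ≤ l
  bound B B′ = Finₚ.injective⇒≤ {f = λ i → Bijection.to B′ (Bijection.to⁻ B i)} λ {i} {j} e →
    trans (sym (proj₂ (Bijection.strictlySurjective B i)))
      (trans (Bijection.cong B (Bijection.injective B′ e)) (proj₂ (Bijection.strictlySurjective B j)))

count-transport : ∀ {A B : Set} {π : A → A} {ρ : B → B} {k} (f : A ↔ B) →
                  (∀ x → to f (π x) ≡ ρ (to f x)) → Count π k → Count ρ k
count-transport {π = π} {ρ} f h C = record
  { lab = lab C ∘ from f
  ; lab-π = λ y → trans (cong (lab C) (from-ρ y)) (lab-π C (from f y))
  ; rep = to f ∘ rep C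
  ; lab-rep = λ i → trans (cong (lab C) (strictlyInverseʳ f _)) (lab-rep C i)
  ; complete = λ {x} {y} e → case complete C e of λ where
      (n , q) → n , trans (cong (iter ρ n) (sym (strictlyInverseˡ f x)))
        (trans (sym (iter-map (to f) h n (from f x))) (trans (cong (to f) q) (strictlyInverseˡ f y)))
  }
  where
  from-ρ : ∀ y → from f (ρ y) ≡ π (from f y)
  from-ρ y = trans (cong (from f ∘ ρ) (sym (strictlyInverseˡ f y)))
    (trans (cong (from f) (sym (h (from f y)))) (strictlyInverseʳ f _))

-- Conjugation by `α` passes from `ψ` to the convention `next ∘ opposite` of `PlanarMap`.
count-φ : ∀ c {k} → Count (ψ c) k → Count (σ c ∘ α c) k
count-φ c = count-transport (mk↔ₛ′ (α c) (α c) (α-involutive c) (α-involutive c))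
  λ d → trans (α-involutive c (σ c d)) (cong (σ c) (sym (α-involutive c d)))

_≟ᵈ_ : ∀ {m} → DecidableEquality (Dart m)
_≟ᵈ_ = Prodₚ.≡-dec Fin._≟_ Bool._≟_

opposite-involutive : ∀ {m} (d : Dart m) → opposite (opposite d) ≡ d
opposite-involutive (e , b) = cong (e ,_) (Boolₚ.not-involutive b)

opposite-free : ∀ {m} (d : Dart m) → opposite d ≢ d
opposite-free (e , b) q = Boolₚ.not-¬ refl (sym (cong proj₂ q))

edges-unique : ∀ {m n} → Dart m ↔ Dart n → m ≡ n
edges-unique {m} {n} f = ℕ.*-cancelʳ-≡ m n 2 (↔⇒≡ (↔-sym (code n) ↔-∘ (f ↔-∘ code m)))
  where
  code : ∀ n → Fin (n * 2) ↔ Dart n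
  code n = (↔-id _ ×-↔ Finₚ.2↔Bool) ↔-∘ Finₚ.*↔×

number : ∀ c → Darts c ↔ Dart (edgesᴳ c)
number empty = mk↔ₛ′ (λ ()) (λ ()) (λ ()) (λ ())
number (bridge a b) = mk↔ₛ′ enc dec enc-dec dec-enc
  where
  m = edgesᴳ a
  n = edgesᴳ b
  enc : Darts (bridge a b) → Dart (suc (m + n))
  enc (inj₁ nothing)  = zero , false
  enc (inj₂ nothing)  = zero , true
  enc (inj₁ (just d)) = Prod.map₁ (suc ∘ (_↑ˡ n)) (to (number a) d)
  enc (inj₂ (just d)) = Prod.map₁ (suc ∘ (m ↑ʳ_)) (to (number b) d)
  dec′ : Fin m ⊎ Fin n → Bool → Darts (bridge a b)
  dec′ (inj₁ e) s = inj₁ (just (from (number a) (e , s)))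
  dec′ (inj₂ e) s = inj₂ (just (from (number b) (e , s)))
  dec : Dart (suc (m + n)) → Darts (bridge a b)
  dec (zero , false) = inj₁ nothing
  dec (zero , true)  = inj₂ nothing
  dec (suc e , s)    = dec′ (splitAt m e) s
  enc-dec : ∀ d → enc (dec d) ≡ d
  enc-dec (zero , false) = refl
  enc-dec (zero , true)  = refl
  enc-dec (suc e , s) with splitAt m e in eq
  ... | inj₁ e′ = trans (cong (Prod.map₁ (suc ∘ (_↑ˡ n))) (strictlyInverseˡ (number a) (e′ , s))) (cong (λ i → suc i , s) (Finₚ.splitAt⁻¹-↑ˡ eq))
  ... | inj₂ e′ = trans (cong (Prod.map₁ (suc ∘ (m ↑ʳ_))) (strictlyInverseˡ (number b) (e′ , s))) (cong (λ i → suc i , s) (Finₚ.splitAt⁻¹-↑ʳ {m = m} eq))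
  dec-enc : ∀ d → dec (enc d) ≡ d
  dec-enc (inj₁ nothing)  = refl
  dec-enc (inj₂ nothing)  = refl
  dec-enc (inj₁ (just d)) = trans (cong (λ x → dec′ x _) (Finₚ.splitAt-↑ˡ m _ n)) (cong (inj₁ ∘ just) (strictlyInverseʳ (number a) d))
  dec-enc (inj₂ (just d)) = trans (cong (λ x → dec′ x _) (Finₚ.splitAt-↑ʳ m n _)) (cong (inj₂ ∘ just) (strictlyInverseʳ (number b) d))
number (chord c p) = mk↔ₛ′ enc dec enc-dec dec-enc
  where
  enc : Darts (chord c p) → Dart (suc (edgesᴳ c))
  enc nothing         = zero , true
  enc (just nothing)  = zero , false
  enc (just (just d)) = Prod.map₁ suc (to (number c) d)
  dec : Dart (suc (edgesᴳ c)) → Darts (chord c p)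
  dec (zero , false) = just nothing
  dec (zero , true)  = nothing
  dec (suc e , s)    = just (just (from (number c) (e , s)))
  enc-dec : ∀ d → enc (dec d) ≡ d
  enc-dec (zero , false) = refl
  enc-dec (zero , true)  = refl
  enc-dec (suc e , s)    = cong (Prod.map₁ suc) (strictlyInverseˡ (number c) (e , s))
  dec-enc : ∀ d → dec (enc d) ≡ d
  dec-enc nothing         = refl
  dec-enc (just nothing)  = refl
  dec-enc (just (just d)) = cong (just ∘ just) (strictlyInverseʳ (number c) d)

number-α : ∀ c d → to (number c) (α c d) ≡ opposite (to (number c) d)
number-α (bridge a b) (inj₁ nothing)  = refl
number-α (bridge a b) (inj₂ nothing)  = refl
number-α (bridge a b) (inj₁ (just d)) = cong (Prod.map₁ (suc ∘ (_↑ˡ edgesᴳ b))) (number-α a d)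
number-α (bridge a b) (inj₂ (just d)) = cong (Prod.map₁ (suc ∘ (edgesᴳ a ↑ʳ_))) (number-α b d)
number-α (chord c p)  nothing         = refl
number-α (chord c p)  (just nothing)  = refl
number-α (chord c p)  (just (just d)) = cong (Prod.map₁ suc) (number-α c d)

module DartEmbedding {m : ℕ} = Embedding (_≟ᵈ_ {m}) opposite opposite-involutive
open DartEmbedding using (Emb; emb-unique; ι-unique; module Existence)
open Emb

data Represents : ∀ {m} → RootedPlanarMap m → Gen → Set where
  empty  : Represents empty empty
  rooted : ∀ {m c r} {M : PlanarMap m} → Emb c (PlanarMap.rotation M) (just r) → Represents (rooted M r) c

represents-unique : ∀ {m} {x : RootedPlanarMap m} {c c′} → Represents x c → Represents x c′ → c ≡ c′
represents-unique empty empty = refl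
represents-unique (rooted E) (rooted E′) = emb-unique _ _ E E′

represents-≅ : ∀ {m} {x y : RootedPlanarMap m} {c} → Represents x c → x ≅ y → Represents y c
represents-≅ empty empty = empty
represents-≅ (rooted E) (rooted φ n o refl) = rooted (record
  { ι = to φ ∘ ι E
  ; ι-inj = ι-inj E ∘ to-injective φ
  ; ι-σ = λ d → trans (cong (to φ) (ι-σ E d)) (n (ι E d))
  ; ι-α = λ d → trans (cong (to φ) (ι-α E d)) (o (ι E d))
  ; ι-start = trans (Maybeₚ.map-∘ {g = to φ} {f = ι E} (start _)) (cong (Maybe.map (to φ)) (ι-start E)) })

darts : ∀ m → List (Dart m)
darts m = cartesianProduct (allFin m) (false ∷ true ∷ [])

∈-darts : ∀ {m} (d : Dart m) → d ∈ darts m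
∈-darts (e , false) = ∈-cartesianProduct⁺ (∈-allFin e) (here refl)
∈-darts (e , true)  = ∈-cartesianProduct⁺ (∈-allFin e) (there (here refl))

represented : ∀ {m} (x : RootedPlanarMap m) → ∃[ c ] Represents x c
represented empty = empty , empty
represented {m} (rooted M r) with Existence.decompose opposite-free (length (darts m)) (darts m)
  (PlanarMap.rotation M) ℕ.≤-refl (λ z _ → ∈-darts z) r
... | c , E = c , rooted E

module _ {m c r} {M : PlanarMap m} (E : Emb c (PlanarMap.rotation M) (just r)) where

  open PlanarMap M using (rotation; next; connected)

  emb-start : ∃[ x ] start c ≡ just x × ι E x ≡ r
  emb-start with start c | ι-start E
  ... | just x | e = x , refl , just-injective e

  -- The image is closed under steps in both directions, hence everything by connectedness of the
  -- map.
  emb-surjective : ∀ d → ∃[ x ] ι E x ≡ d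
  emb-surjective d = walk (connected r d) (let x , _ , e = emb-start in x , e)
    where
    walk : ∀ {d d′} → EqClosure (λ x y → next x ≡ y ⊎ opposite x ≡ y) d d′ → ∃[ x ] ι E x ≡ d → ∃[ x ] ι E x ≡ d′
    walk ε p = p
    walk (fwd (inj₁ refl) ◅ w) (x , refl) = walk w (σ c x , ι-σ E x)
    walk (fwd (inj₂ refl) ◅ w) (x , refl) = walk w (α c x , ι-α E x)
    walk (bwd (inj₁ e) ◅ w) (x , refl) = let y , q = σ-surjective c x in
      walk w (y , to-injective rotation (trans (sym (ι-σ E y)) (trans (cong (ι E) q) (sym e))))
    walk (bwd (inj₂ e) ◅ w) (x , refl) =
      walk w (α c x , trans (ι-α E x) (trans (cong opposite (sym e)) (opposite-involutive _)))

  emb↔ : Darts c ↔ Dart m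
  emb↔ = mk↔ₛ′ (ι E) (proj₁ ∘ emb-surjective) (proj₂ ∘ emb-surjective) (λ x → ι-inj E (proj₂ (emb-surjective (ι E x))))

  emb-edges : edgesᴳ c ≡ m
  emb-edges = edges-unique (emb↔ ↔-∘ ↔-sym (number c))

  -- Euler's formula for the map and the formula with handles for its decomposition count the same
  -- cycles, so twice the number of handles is zero.
  emb-planar : Planarᴳ c
  emb-planar with faces-of c | emb-start | PlanarMap.euler M
  ... | F | x , s , _ | v , f , V , W , e = sphere F (ℕ.m+n≡0⇒m≡0 (handles F)
    (ℕ.+-cancelˡ-≡ (edgesᴳ c + 2) _ 0 (trans (cong (_+ 2 * handles F) (sym sum)) (trans (eulerᴳ F) (sym (ℕ.+-identityʳ _))))))
    where
    sum : vertices c + faces F ≡ edgesᴳ c + 2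
    sum = trans (cong₂ _+_
        (cardinality-unique (count-cardinality (count-transport emb↔ (ι-σ E) (countσ c s))) V)
        (cardinality-unique (count-cardinality (count-transport emb↔
          (λ d → trans (ι-σ E (α c d)) (cong next (ι-α E d))) (count-φ c (countψ F s)))) W))
      (trans e (cong (_+ 2) (sym emb-edges)))

represents-edges : ∀ {m} {x : RootedPlanarMap m} {c} → Represents x c → edgesᴳ c ≡ m
represents-edges empty      = refl
represents-edges (rooted {M = M} E) = emb-edges {M = M} E

represents-planar : ∀ {m} {x : RootedPlanarMap m} {c} → Represents x c → Planarᴳ c
represents-planar empty      = tt
represents-planar (rooted {M = M} E) = emb-planar {M = M} E

represents-colouring : ∀ {m} {x : RootedPlanarMap m} {c} → Represents x c → Bipartite x → Colouring c
represents-colouring empty _ = record { χ = λ () ; χ-σ = λ () ; χ-α = λ () }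
represents-colouring {c = c} (rooted E) (col , proper) = record
  { χ = Func.to col ∘ ι E
  ; χ-σ = λ d → trans (cong (Func.to col) (ι-σ E d)) (sym (Func.cong col (fwd refl ◅ ε)))
  ; χ-α = λ d → trans (cong (Func.to col) (ι-α E d)) (Boolₚ.¬-not (≢-sym (proper (ι E d)))) }

represents-same : ∀ {m} {x y : RootedPlanarMap m} {c} → Represents x c → Represents y c → x ≅ y
represents-same empty empty = empty
represents-same (rooted {c = c} {M = M} E) (rooted {M = N} F) = rooted
  (mk↔ₛ′ (ι F ∘ from e) (ι E ∘ from f)
    (λ d → trans (cong (ι F) (strictlyInverseʳ e _)) (strictlyInverseˡ f d))
    (λ d → trans (cong (ι E) (strictlyInverseʳ f _)) (strictlyInverseˡ e d)))
  (λ d → trans (cong (ι F) (ι-inj E (trans (strictlyInverseˡ e _) (trans (cong (PlanarMap.next M) (sym (strictlyInverseˡ e d))) (sym (ι-σ E _))))))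
               (ι-σ F (from e d)))
  (λ d → trans (cong (ι F) (ι-inj E (trans (strictlyInverseˡ e _) (trans (cong opposite (sym (strictlyInverseˡ e d))) (sym (ι-α E _))))))
               (ι-α F (from e d)))
  (let x , s , q = emb-start {M = M} E ; y , t , q′ = emb-start {M = N} F in
    trans (cong (ι F) (trans (ι-inj E (trans (strictlyInverseˡ e _) (sym q))) (just-injective (trans (sym s) t)))) q′)
  where
  e = emb↔ {M = M} E
  f = emb↔ {M = N} F

-- Realising decompositions and codes as rooted maps

module Realise (c : Gen) (pl : Planarᴳ c) (C : Colouring c) {x} (s : start c ≡ just x) where

  private
    n = number c
    d₀ = to n x

    σ⁻¹ : Darts c → Darts c
    σ⁻¹ d = proj₁ (σ-surjective c d)

  next′ : Dart (edgesᴳ c) → Dart (edgesᴳ c)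
  next′ = to n ∘ σ c ∘ from n

  next-to : ∀ d → to n (σ c d) ≡ next′ (to n d)
  next-to d = cong (to n ∘ σ c) (sym (strictlyInverseʳ n d))

  realised : PlanarMap (edgesᴳ c)
  realised = record
    { rotation = mk↔ₛ′ next′ (to n ∘ σ⁻¹ ∘ from n)
        (λ d → trans (cong (to n ∘ σ c) (strictlyInverseʳ n _)) (trans (cong (to n) (proj₂ (σ-surjective c (from n d)))) (strictlyInverseˡ n d)))
        (λ d → trans (cong (to n ∘ σ⁻¹) (strictlyInverseʳ n _))
          (trans (cong (to n) (σ-injective c (proj₂ (σ-surjective c (σ c (from n d)))))) (strictlyInverseˡ n d)))
    ; connected = λ d d′ → EqC.transitive _ (EqC.symmetric _ (from-root d)) (from-root d′)
    ; euler = vertices c , faces F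
        , count-cardinality (count-transport n next-to (countσ c s))
        , count-cardinality (count-transport n (λ d → trans (next-to (α c d)) (cong next′ (number-α c d))) (count-φ c (countψ F s)))
        , trans (sym (ℕ.+-identityʳ _)) (trans (cong (λ h → vertices c + faces F + 2 * h) (sym (genus0 F pl))) (eulerᴳ F))
    }
    where
    F = faces-of c
    Step : Dart (edgesᴳ c) → Dart (edgesᴳ c) → Set
    Step x y = next′ x ≡ y ⊎ opposite x ≡ y
    from-root : ∀ d → EqClosure Step d₀ d
    from-root d = subst (EqClosure Step d₀) (strictlyInverseˡ n d)
      (all-darts c (λ d → EqClosure Step d₀ (to n d))
        (λ {d} p → EqC.transitive _ p (fwd (inj₁ (sym (next-to d))) ◅ ε))
        (λ {d} p → EqC.transitive _ p (fwd (inj₂ (sym (number-α c d))) ◅ ε))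
        (λ q → subst (λ y → EqClosure Step d₀ (to n y)) (just-injective (trans (sym s) q)) ε)
        (from n d))

  realised-emb : Emb c (PlanarMap.rotation realised) (just d₀)
  realised-emb = record
    { ι = to n ; ι-inj = to-injective n
    ; ι-σ = next-to ; ι-α = number-α c ; ι-start = cong (Maybe.map (to n)) s }

  realised-bipartite : Bipartite (rooted realised d₀)
  realised-bipartite = record { to = χ C ∘ from n ; cong = EqC.gfold isEquivalence (χ C ∘ from n) step }
    , λ d e → Boolₚ.not-¬ e (trans (sym (Boolₚ.not-involutive _)) (cong not (sym (trans (cong (χ C) (opp d)) (χ-α C (from n d))))))
    where
    step : ∀ {x y} → next′ x ≡ y → χ C (from n x) ≡ χ C (from n y)
    step refl = sym (trans (cong (χ C) (strictlyInverseʳ n _)) (χ-σ C _))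
    opp : ∀ d → from n (opposite d) ≡ α c (from n d)
    opp d = trans (cong (from n ∘ opposite) (sym (strictlyInverseˡ n d)))
      (trans (cong (from n) (sym (number-α c (from n d)))) (strictlyInverseʳ n _))

realise : ∀ {m} c → edgesᴳ c ≡ m → Planarᴳ c → Colouring c → Σ (RootedPlanarMap m) λ x → Represents x c × Bipartite x
realise empty refl _ _ = empty , empty , tt
realise c@(bridge _ _) refl pl C = _ , rooted {M = Realise.realised c pl C refl} (Realise.realised-emb c pl C refl) , Realise.realised-bipartite c pl C refl
realise c@(chord _ _)  refl pl C = _ , rooted {M = Realise.realised c pl C refl} (Realise.realised-emb c pl C refl) , Realise.realised-bipartite c pl C refl

module CodeMap (k : Code) {m} (e : edges k ≡ m) where

  private
    whole = realise (gen k) (trans (gen-edges k) e) (gen-planar k) (proj₁ (gen-colouring k true))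

  map-of : Setoid.Carrier (BipartiteMaps m)
  map-of = proj₁ whole , proj₂ (proj₂ whole)

  map-represents : Represents (proj₁ map-of) (gen k)
  map-represents = proj₁ (proj₂ whole)

open CodeMap

map-injective : ∀ {m} k k′ (e : edges k ≡ m) (e′ : edges k′ ≡ m) → proj₁ (map-of k e) ≅ proj₁ (map-of k′ e′) → k ≡ k′
map-injective k k′ e e′ h = gen-injective (represents-unique (represents-≅ (map-represents k e) h) (map-represents k′ e′))

map-surjective : ∀ {m} (y : Setoid.Carrier (BipartiteMaps m)) → ∃[ k ] Σ (edges k ≡ m) λ e → proj₁ (map-of k e) ≅ proj₁ y
map-surjective (x , bip) with represented x
... | c , R with code-of c (represents-planar R) (represents-colouring R bip)
... | k , refl = k , e , represents-same (map-represents k e) R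
  where e = trans (sym (gen-edges k)) (represents-edges R)

-- Planar linear terms

-- t ⊢ xs: the leaves of t, read along the contour, close the abstractions of t
-- and the variables xs (most recent first) in a well-parenthesized way.
data _⊢_ : ∀ {k} → Term k → List (Fin k) → Set where
  var : ∀ {k} {i : Fin k} {zs} → zs ≡ [ i ] → var i ⊢ zs
  app : ∀ {k} {u v : Term k} {xs ys zs} → u ⊢ xs → v ⊢ ys → zs ≡ ys ++ xs → app u v ⊢ zs
  lam : ∀ {k} {u : Term (suc k)} {xs} → u ⊢ (zero ∷ map suc xs) → lam u ⊢ xs

unique-++⁻ : ∀ {A : Set} (ys {xs} : List A) → Unique (ys ++ xs) →
             Unique ys × Unique xs × (∀ {x} → x ∈ ys → x ∈ xs → ⊥)
unique-++⁻ [] u = [] , u , λ ()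
unique-++⁻ (y ∷ ys) (p ∷ u) with unique-++⁻ ys u
... | uy , ux , d = Allₚ.++⁻ˡ ys p ∷ uy , ux , λ where
  (here refl) q → All.lookup (Allₚ.++⁻ʳ ys p) q refl
  (there q′)  q → d q′ q

unique-lift : ∀ {k} {xs : List (Fin k)} → Unique xs → Unique (zero ∷ map suc xs)
unique-lift u = Allₚ.map⁺ (All.universal (λ _ ()) _) ∷ Uniqueₚ.map⁺ Finₚ.suc-injective u

-- The graph of `bound`, the function local to `open-binder`.
data IsBound {k s} : Fin (suc k) ⊎ Node unary s → Fin k ⊎ Node unary (unary s) → Set where
  zero  : IsBound (inj₁ zero) (inj₂ unary)
  suc   : ∀ {i} → IsBound (inj₁ (suc i)) (inj₁ i)
  inner : ∀ {a} → IsBound (inj₂ a) (inj₂ (down a))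

binder-lam : ∀ {k} (u : Term (suc k)) ℓ → IsBound (open-binder u ℓ) (open-binder (lam u) (down ℓ))
binder-lam u ℓ with open-binder u ℓ
... | inj₁ zero    = zero
... | inj₁ (suc i) = suc
... | inj₂ a       = inner

lam-bound : ∀ {k} (u : Term (suc k)) {ℓ x y} → open-binder u ℓ ≡ x → IsBound x y → open-binder (lam u) (down ℓ) ≡ y
lam-bound u {ℓ} refl b = det (binder-lam u ℓ) b
  where
  det : ∀ {k s x y z} → IsBound {k} {s} x y → IsBound x z → y ≡ z
  det zero zero = refl
  det suc suc = refl
  det inner inner = refl

lam-free⁻ : ∀ {k} (u : Term (suc k)) {ℓ i} → open-binder (lam u) (down ℓ) ≡ inj₁ i → open-binder u ℓ ≡ inj₁ (suc i)
lam-free⁻ u {ℓ} e = go (binder-lam u ℓ) e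
  where
  go : ∀ {k s x y i} → IsBound {k} {s} x y → y ≡ inj₁ i → x ≡ inj₁ (suc i)
  go suc refl = refl
  go zero ()
  go inner ()

lam-unary⁻ : ∀ {k} (u : Term (suc k)) {ℓ} → open-binder (lam u) (down ℓ) ≡ inj₂ unary → open-binder u ℓ ≡ inj₁ zero
lam-unary⁻ u {ℓ} e = go (binder-lam u ℓ) e
  where
  go : ∀ {k s x y} → IsBound {k} {s} x y → y ≡ inj₂ unary → x ≡ inj₁ zero
  go zero refl = refl
  go suc ()
  go inner ()

lam-down⁻ : ∀ {k} (u : Term (suc k)) {ℓ a} → open-binder (lam u) (down ℓ) ≡ inj₂ (down a) → open-binder u ℓ ≡ inj₂ a
lam-down⁻ u {ℓ} e = go (binder-lam u ℓ) e
  where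
  go : ∀ {k s x y a} → IsBound {k} {s} x y → y ≡ inj₂ (down a) → x ≡ inj₂ a
  go inner refl = refl
  go zero ()
  go suc ()

map₂-inj₁⁻ : ∀ {A B C : Set} {f : B → C} (x : A ⊎ B) {a} → Sum.map₂ f x ≡ inj₁ a → x ≡ inj₁ a
map₂-inj₁⁻ (inj₁ _) refl = refl

map₂-inj₂⁻ : ∀ {A B C : Set} (f : B → C) (x : A ⊎ B) {c} → Sum.map₂ f x ≡ inj₂ c → ∃[ b ] x ≡ inj₂ b × f b ≡ c
map₂-inj₂⁻ _ (inj₂ b) refl = b , refl , refl

free-occurs : ∀ {k} {t : Term k} {xs} → t ⊢ xs → ∀ ℓ {i} → open-binder t ℓ ≡ inj₁ i → i ∈ xs
free-occurs (var refl) here refl = here refl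
free-occurs (app {u = u₁} {v₁} {ys = ys} D E refl) (left ℓ)  e = ∈-++⁺ʳ ys (free-occurs D ℓ (map₂-inj₁⁻ (open-binder u₁ ℓ) e))
free-occurs (app {u = u₁} {v₁} {ys = ys} D E refl) (right ℓ) e = ∈-++⁺ˡ (free-occurs E ℓ (map₂-inj₁⁻ (open-binder v₁ ℓ) e))
free-occurs (lam {u = u} D) (down ℓ) e with free-occurs D ℓ (lam-free⁻ u e)
... | there q with ∈-map⁻ suc q
...   | _ , q′ , refl = q′

free-leaf : ∀ {k} {t : Term k} {xs} → t ⊢ xs → ∀ {i} → i ∈ xs → ∃[ ℓ ] open-binder t ℓ ≡ inj₁ i
free-leaf (var refl) (here refl) = here , refl
free-leaf (app {ys = ys} D E refl) q with ∈-++⁻ ys q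
... | inj₁ q′ = let ℓ , e = free-leaf E q′ in right ℓ , cong (Sum.map₂ right) e
... | inj₂ q′ = let ℓ , e = free-leaf D q′ in left ℓ , cong (Sum.map₂ left) e
free-leaf (lam {u = u} D) q = let ℓ , e = free-leaf D (there (∈-map⁺ suc q)) in down ℓ , lam-bound u e suc

free-unique : ∀ {k} {t : Term k} {xs} → t ⊢ xs → Unique xs → ∀ {ℓ ℓ′ i} →
              open-binder t ℓ ≡ inj₁ i → open-binder t ℓ′ ≡ inj₁ i → ℓ ≡ ℓ′
free-unique (var refl) u {here} {here} e e′ = refl
free-unique (app {u = u₁} {v₁} {ys = ys} D E refl) u {left ℓ} {left ℓ′} e e′ =
  cong left (free-unique D (proj₁ (proj₂ (unique-++⁻ ys u))) (map₂-inj₁⁻ (open-binder u₁ ℓ) e) (map₂-inj₁⁻ (open-binder u₁ ℓ′) e′))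
free-unique (app {u = u₁} {v₁} {ys = ys} D E refl) u {right ℓ} {right ℓ′} e e′ =
  cong right (free-unique E (proj₁ (unique-++⁻ ys u)) (map₂-inj₁⁻ (open-binder v₁ ℓ) e) (map₂-inj₁⁻ (open-binder v₁ ℓ′) e′))
free-unique (app {u = u₁} {v₁} {ys = ys} D E refl) u {left ℓ} {right ℓ′} e e′ =
  ⊥-elim (proj₂ (proj₂ (unique-++⁻ ys u)) (free-occurs E ℓ′ (map₂-inj₁⁻ (open-binder v₁ ℓ′) e′)) (free-occurs D ℓ (map₂-inj₁⁻ (open-binder u₁ ℓ) e)))
free-unique (app {u = u₁} {v₁} {ys = ys} D E refl) u {right ℓ} {left ℓ′} e e′ =
  ⊥-elim (proj₂ (proj₂ (unique-++⁻ ys u)) (free-occurs E ℓ (map₂-inj₁⁻ (open-binder v₁ ℓ) e)) (free-occurs D ℓ′ (map₂-inj₁⁻ (open-binder u₁ ℓ′) e′)))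
free-unique (lam {u = t} D) u {down ℓ} {down ℓ′} e e′ =
  cong down (free-unique D (unique-lift u) (lam-free⁻ t e) (lam-free⁻ t e′))

bound-leaf : ∀ {k} {t : Term k} {xs} → t ⊢ xs → ∀ a → ∃[ ℓ ] open-binder t ℓ ≡ inj₂ a
bound-leaf (app D E _) (left a)  = let ℓ , e = bound-leaf D a in left ℓ , cong (Sum.map₂ left) e
bound-leaf (app D E _) (right a) = let ℓ , e = bound-leaf E a in right ℓ , cong (Sum.map₂ right) e
bound-leaf (lam {u = u} D) unary    = let ℓ , e = free-leaf D (here refl) in down ℓ , lam-bound u e zero
bound-leaf (lam {u = u} D) (down a) = let ℓ , e = bound-leaf D a in down ℓ , lam-bound u e inner

bound-unique : ∀ {k} {t : Term k} {xs} → t ⊢ xs → Unique xs → ∀ {ℓ ℓ′ a} →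
               open-binder t ℓ ≡ inj₂ a → open-binder t ℓ′ ≡ inj₂ a → ℓ ≡ ℓ′
bound-unique (app {u = u₁} {v₁} {ys = ys} D E refl) u {left ℓ} {left ℓ′} e e′ with map₂-inj₂⁻ left (open-binder u₁ ℓ) e | map₂-inj₂⁻ left (open-binder u₁ ℓ′) e′
... | b , q , refl | _ , q′ , refl = cong left (bound-unique D (proj₁ (proj₂ (unique-++⁻ ys u))) q q′)
bound-unique (app {u = u₁} {v₁} {ys = ys} D E refl) u {right ℓ} {right ℓ′} e e′ with map₂-inj₂⁻ right (open-binder v₁ ℓ) e | map₂-inj₂⁻ right (open-binder v₁ ℓ′) e′
... | b , q , refl | _ , q′ , refl = cong right (bound-unique E (proj₁ (unique-++⁻ ys u)) q q′)
bound-unique (app {u = u₁} {v₁} D E refl) u {left ℓ} {right ℓ′} e e′ with map₂-inj₂⁻ left (open-binder u₁ ℓ) e | map₂-inj₂⁻ right (open-binder v₁ ℓ′) e′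
... | b , q , refl | _ , q′ , ()
bound-unique (app {u = u₁} {v₁} D E refl) u {right ℓ} {left ℓ′} e e′ with map₂-inj₂⁻ right (open-binder v₁ ℓ) e | map₂-inj₂⁻ left (open-binder u₁ ℓ′) e′
... | b , q , refl | _ , q′ , ()
bound-unique (lam {u = t} D) u {down ℓ} {down ℓ′} {unary} e e′ =
  cong down (free-unique D (unique-lift u) (lam-unary⁻ t e) (lam-unary⁻ t e′))
bound-unique (lam {u = t} D) u {down ℓ} {down ℓ′} {down a} e e′ =
  cong down (bound-unique D (unique-lift u) (lam-down⁻ t e) (lam-down⁻ t e′))

binder-closed : ∀ (t : Term 0) ℓ → open-binder t ℓ ≡ inj₂ (binder t ℓ)
binder-closed t ℓ with open-binder t ℓ
... | inj₂ a = refl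

⊢⇒linear : ∀ {t : Term 0} → t ⊢ [] → Linear t
⊢⇒linear {t} D a with bound-leaf D a
... | ℓ , e = ℓ , Sumₚ.inj₂-injective (trans (sym (binder-closed t ℓ)) e)
  , λ {ℓ′} q → bound-unique D [] e (trans (binder-closed t ℓ′) (cong inj₂ q))

extend : ∀ {A : Set} {k} → A → (Fin k → A) → Fin (suc k) → A
extend a f zero    = a
extend a f (suc i) = f i

-- Reads a word with a stack of open abstractions, `S` before and `S′` after. Unlike
-- well-parenthesized words, runs can be cut anywhere, in particular between the words of two
-- subterms.
data Run (t : Term 0) : List (Letter (Sk t)) → (S S′ : List (Node unary (Sk t))) → Set where
  []    : ∀ {S} → Run t [] S S
  open′ : ∀ {a w S S′} → Run t w (a ∷ S) S′ → Run t (inj₁ a ∷ w) S S′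
  close : ∀ {ℓ a w S S′} → binder t ℓ ≡ a → Run t w S S′ → Run t (inj₂ ℓ ∷ w) (a ∷ S) S′

module _ {t : Term 0} where

  run-++ : ∀ {w w′ S S′ S″} → Run t w S S′ → Run t w′ S′ S″ → Run t (w ++ w′) S S″
  run-++ []          r′ = r′
  run-++ (open′ r)   r′ = open′ (run-++ r r′)
  run-++ (close e r) r′ = close e (run-++ r r′)

  run-split : ∀ w {w′ S S″} → Run t (w ++ w′) S S″ → ∃[ S′ ] Run t w S S′ × Run t w′ S′ S″
  run-split []      r           = _ , [] , r
  run-split (_ ∷ w) (open′ r)   = let S , p , q = run-split w r in S , open′ p , q
  run-split (_ ∷ w) (close e r) = let S , p , q = run-split w r in S , close e p , q

  wp⇒run : ∀ {w} → WellParenthesized t w → ∀ S → Run t w S S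
  wp⇒run []            S = []
  wp⇒run (match e p q) S = open′ (run-++ (wp⇒run p _) (close e (wp⇒run q S)))

  -- The word of a run that empties its stack, cut at the letters that close the initial entries.
  data Closes : List (Letter (Sk t)) → List (Node unary (Sk t)) → Set where
    done : ∀ {w} → WellParenthesized t w → Closes w []
    next : ∀ {w ℓ w′ a S} → WellParenthesized t w → binder t ℓ ≡ a → Closes w′ S → Closes (w ++ inj₂ ℓ ∷ w′) (a ∷ S)

  run⇒closes : ∀ {w S} → Run t w S [] → Closes w S
  run⇒closes [] = done []
  run⇒closes (close e r) = next [] e (run⇒closes r)
  run⇒closes {inj₁ a ∷ _} (open′ r) with run⇒closes r
  ... | next {w} {ℓ} {w′} p e c = resume c
    where
    resume : ∀ {w′ S} → Closes w′ S → Closes (inj₁ a ∷ w ++ inj₂ ℓ ∷ w′) S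
    resume (done q) = done (match e p q)
    resume (next {w₁} {ℓ₁} {w₂} q e′ c) = subst (λ v → Closes (inj₁ a ∷ v) _)
      (List.++-assoc w (inj₂ ℓ ∷ w₁) (inj₂ ℓ₁ ∷ w₂)) (next (match e p q) e′ c)

  run⇒wp : ∀ {w} → Run t w [] [] → WellParenthesized t w
  run⇒wp r with run⇒closes r
  ... | done p = p

  run-All : ∀ (P : Node unary (Sk t) → Set) {w S S′} → Run t w S S′ → All P S →
            All (λ x → ∀ {a} → x ≡ inj₁ a → P a) w → All P S′
  run-All P []          ps       qs       = ps
  run-All P (open′ r)   ps       (q ∷ qs) = run-All P r (q refl ∷ ps) qs
  run-All P (close e r) (_ ∷ ps) (_ ∷ qs) = run-All P r ps qs

  -- An occurrence of `u` in `t`, where `freeAt` sends the free variables of `u` to their binders.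
  record Inside {k} (u : Term k) : Set where
    field
      nodeAt  : Node unary (Sk u) → Node unary (Sk t)
      leafAt  : Leaf (Sk u) → Leaf (Sk t)
      freeAt  : Fin k → Node unary (Sk t)
      bind  : ∀ ℓ → binder t (leafAt ℓ) ≡ [ freeAt , nodeAt ]′ (open-binder u ℓ)

    word : List (Letter (Sk t))
    word = map (Sum.map nodeAt leafAt) (contour (Sk u))

  open Inside

  inside-left : ∀ {k} {u v : Term k} → Inside (app u v) → Inside u
  inside-left {u = u} I = record { nodeAt = nodeAt I ∘ left ; leafAt = leafAt I ∘ left ; freeAt = freeAt I
    ; bind = λ ℓ → trans (bind I (left ℓ)) (Sumₚ.[,]-map (open-binder u ℓ)) }

  inside-right : ∀ {k} {u v : Term k} → Inside (app u v) → Inside v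
  inside-right {v = v} I = record { nodeAt = nodeAt I ∘ right ; leafAt = leafAt I ∘ right ; freeAt = freeAt I
    ; bind = λ ℓ → trans (bind I (right ℓ)) (Sumₚ.[,]-map (open-binder v ℓ)) }

  inside-body : ∀ {k} {u : Term (suc k)} → Inside (lam u) → Inside u
  inside-body {u = u} I = record { nodeAt = nodeAt I ∘ down ; leafAt = leafAt I ∘ down ; freeAt = extend (nodeAt I unary) (freeAt I)
    ; bind = λ ℓ → trans (bind I (down ℓ)) (go (binder-lam u ℓ)) }
    where
    go : ∀ {x y} → IsBound x y → [ freeAt I , nodeAt I ]′ y ≡ [ extend (nodeAt I unary) (freeAt I) , nodeAt I ∘ down ]′ x
    go zero  = refl
    go suc   = refl
    go inner = refl

  map-fuse : ∀ {A B A′ B′ A″ B″ : Set} (f : A′ → A″) (g : B′ → B″) (h : A → A′) (i : B → B′) w →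
             map (Sum.map f g) (map (Sum.map h i) w) ≡ map (Sum.map (f ∘ h) (g ∘ i)) w
  map-fuse f g h i w = trans (sym (List.map-∘ w)) (List.map-cong Sumₚ.map-map w)

  word-app : ∀ {k} {u v : Term k} (I : Inside (app u v)) → word I ≡ word (inside-right I) ++ word (inside-left I)
  word-app {u = u} {v} I = trans (List.map-++ _ (map (Sum.map right right) (contour (Sk v))) _)
    (cong₂ _++_ (map-fuse (nodeAt I) (leafAt I) right right (contour (Sk v))) (map-fuse (nodeAt I) (leafAt I) left left (contour (Sk u))))

  word-lam : ∀ {k} {u : Term (suc k)} (I : Inside (lam u)) → word I ≡ inj₁ (nodeAt I unary) ∷ word (inside-body I)
  word-lam {u = u} I = cong (inj₁ (nodeAt I unary) ∷_) (map-fuse (nodeAt I) (leafAt I) down down (contour (Sk u)))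

  map-extend : ∀ {A : Set} {k} {a : A} {f : Fin k → A} xs → map (extend a f) (map suc xs) ≡ map f xs
  map-extend xs = sym (List.map-∘ xs)

  ⊢⇒run : ∀ {k} {u : Term k} {xs} → u ⊢ xs → (I : Inside u) → ∀ S → Run t (word I) (map (freeAt I) xs ++ S) S
  ⊢⇒run (var refl) I S = close (bind I here) []
  ⊢⇒run (app {xs = xs} {ys} D E refl) I S = subst₂ (λ w S′ → Run t w S′ S) (sym (word-app I))
    (trans (sym (List.++-assoc (map (freeAt I) ys) _ S)) (cong (_++ S) (sym (List.map-++ (freeAt I) ys xs))))
    (run-++ (⊢⇒run E (inside-right I) _) (⊢⇒run D (inside-left I) S))
  ⊢⇒run (lam {xs = xs} D) I S = subst (λ w → Run t w (map (freeAt I) xs ++ S) S) (sym (word-lam I))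
    (open′ (subst (λ S′ → Run t _ (nodeAt I unary ∷ S′ ++ S) S) (map-extend xs) (⊢⇒run D (inside-body I) S)))

  unsuc : ∀ {k} (xs : List (Fin (suc k))) → ¬ (zero ∈ xs) → ∃[ ys ] xs ≡ map suc ys
  unsuc []           n = [] , refl
  unsuc (zero ∷ xs)  n = contradiction (here refl) n
  unsuc (suc i ∷ xs) n with unsuc xs (n ∘ there)
  ... | ys , refl = i ∷ ys , refl

  record Fresh {k} {u : Term k} (I : Inside u) : Set where
    field
      node-inj  : Injective (nodeAt I)
      free≢node : ∀ i a → freeAt I i ≢ nodeAt I a

  open Fresh

  Avoid : ∀ {k} {u : Term k} → Inside u → List (Node unary (Sk t)) → Set
  Avoid I = All (λ b → ∀ a → b ≢ nodeAt I a)

  -- Since neither stack contains nodes of `u`, whatever `u` opens it also closes; what else it pops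
  -- from `S` are the binders of its free variables, in the order of `xs`.
  run⇒⊢ : ∀ {k} (u : Term k) (I : Inside u) → Fresh I → ∀ {S S′} → Avoid I S → Avoid I S′ →
          Run t (word I) S S′ → ∃[ xs ] u ⊢ xs × S ≡ map (freeAt I) xs ++ S′
  run⇒⊢ (var i) I F _ _ (close e []) = [ i ] , var refl , cong (_∷ _) (trans (sym e) (bind I here))
  run⇒⊢ (app u v) I F {S} {S′} av av′ r
    with run-split (word (inside-right I)) (subst (λ w → Run t w S S′) (word-app I) r)
  -- The middle stack consists of entries of `S` and nodes of `v`, so it avoids the nodes of `u`.
  -- Only the result for `u` shows that it avoids those of `v` as well.
  ... | S″ , p , q
    with run⇒⊢ u (inside-left I) (record { node-inj = left-inj ∘ node-inj F ; free≢node = λ i a → free≢node F i (left a) })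
           (run-All _ p (All.map (λ h a → h (left a)) av) (Allₚ.map⁺ (All.universal fresh (contour (Sk v)))))
           (All.map (λ h a → h (left a)) av′) q
    where
    left-inj : Injective {Node unary (Sk u)} {Node unary (Sk (app u v))} left
    left-inj refl = refl
    fresh : ∀ x {a} → Sum.map (nodeAt I ∘ right) (leafAt I ∘ right) x ≡ inj₁ a → ∀ b → a ≢ nodeAt I (left b)
    fresh (inj₁ c) refl b e = contradiction (node-inj F e) λ ()
  ... | xs , D , refl
    with run⇒⊢ v (inside-right I) (record { node-inj = right-inj ∘ node-inj F ; free≢node = λ i a → free≢node F i (right a) })
           (All.map (λ h a → h (right a)) av)
           (Allₚ.++⁺ (Allₚ.map⁺ (All.universal (λ i a → free≢node F i (right a)) xs)) (All.map (λ h a → h (right a)) av′)) p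
    where
    right-inj : Injective {Node unary (Sk v)} {Node unary (Sk (app u v))} right
    right-inj refl = refl
  ... | ys , E , refl = ys ++ xs , app D E refl ,
    trans (sym (List.++-assoc (map (freeAt I) ys) _ S′)) (cong (_++ S′) (sym (List.map-++ (freeAt I) ys xs)))
  run⇒⊢ (lam u) I F {S} {S′} av av′ r with subst (λ w → Run t w S S′) (word-lam I) r
  ... | open′ p
    with run⇒⊢ u (inside-body I) (record { node-inj = down-inj ∘ node-inj F ; free≢node = apart })
           ((λ a e → contradiction (node-inj F e) λ ()) ∷ All.map (λ h a → h (down a)) av) (All.map (λ h a → h (down a)) av′) p
    where
    down-inj : Injective {Node unary (Sk u)} {Node unary (Sk (lam u))} down
    down-inj refl = refl
    apart : ∀ i a → extend (nodeAt I unary) (freeAt I) i ≢ nodeAt I (down a)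
    apart zero    a e = contradiction (node-inj F e) λ ()
    apart (suc i) a = free≢node F i (down a)
  -- The abstraction lies on top of the stack when its body is read. It is popped there, as
  -- otherwise it would remain in `S′`; it is popped as variable `zero`; and only once, since `S`
  -- does not contain it.
  ... | [] , D , refl = contradiction refl (All.head av′ unary)
  ... | suc i ∷ xs , D , e = contradiction (sym (List.∷-injectiveˡ e)) (free≢node F i unary)
  ... | zero ∷ xs , D , refl with unsuc xs (λ z → All.lookup av (∈-++⁺ˡ (∈-map⁺ _ z)) unary refl)
  ...   | ys , refl = ys , lam D , cong (_++ S′) (map-extend ys)

whole : (t : Term 0) → Inside {t} t
whole t = record { nodeAt = id ; leafAt = id ; freeAt = λ () ; bind = λ ℓ → go (open-binder t ℓ) }
  where
  go : ∀ (x : Fin 0 ⊎ Node unary (Sk t)) → Sum.fromInj₂ (λ ()) x ≡ [ (λ ()) , id ]′ x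
  go (inj₂ _) = refl

word-whole : ∀ t → Inside.word (whole t) ≡ contour (Sk t)
word-whole t = trans (List.map-cong same (contour (Sk t))) (List.map-id _)
  where
  same : ∀ x → Sum.map id id x ≡ x
  same (inj₁ _) = refl
  same (inj₂ _) = refl

⊢⇒planar : ∀ {t} → t ⊢ [] → Planar t
⊢⇒planar {t} D = run⇒wp (subst (λ w → Run t w [] []) (word-whole t) (⊢⇒run D (whole t) []))

planar⇒⊢ : ∀ {t} → Planar t → t ⊢ []
planar⇒⊢ {t} p with run⇒⊢ t (whole t) (record { node-inj = id ; free≢node = λ () }) [] []
                      (subst (λ w → Run t w [] []) (sym (word-whole t)) (wp⇒run p []))
... | [] , D , _ = D

-- Regular terms

-- Regular j describes a term below j abstractions.
data Neutral : ∀ {k} → Term k → List (Fin k) → Set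
data Regular : ∀ {k} → ℕ → Term k → List (Fin k) → Set

data Neutral where
  var : ∀ {k} {i : Fin k} {zs} → zs ≡ [ i ] → Neutral (var i) zs
  app : ∀ {k} {u v : Term k} {xs ys zs} → Neutral u xs → Regular 0 v ys → zs ≡ ys ++ xs → Neutral (app u v) zs

data Regular where
  var : ∀ {k} {i : Fin k} {zs} → zs ≡ [ i ] → Regular 0 (var i) zs
  app : ∀ {k j} {u v : Term k} {xs ys zs} → Neutral u xs → Regular 0 v ys → j < length ys → zs ≡ ys ++ xs → Regular j (app u v) zs
  lam : ∀ {k j} {u : Term (suc k)} {xs} → Regular (suc j) u (zero ∷ map suc xs) → Regular j (lam u) xs

-- The head comes last in the list, so it is the oldest variable: in a closed term, the one bound by
-- the outermost abstraction.
data Body : ∀ {k} → Term k → List (Fin k) → Set where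
  app : ∀ {k} {i : Fin k} {v ys zs} → Regular 0 v ys → zs ≡ ys ++ [ i ] → Body (app (var i) v) zs
  lam : ∀ {k} {u : Term (suc k)} {xs} → Body u (zero ∷ map suc xs) → Body (lam u) xs

neutral⇒⊢ : ∀ {k} {t : Term k} {xs} → Neutral t xs → t ⊢ xs
regular⇒⊢ : ∀ {k j} {t : Term k} {xs} → Regular j t xs → t ⊢ xs
neutral⇒⊢ (var e)     = var e
neutral⇒⊢ (app N R e) = app (neutral⇒⊢ N) (regular⇒⊢ R) e
regular⇒⊢ (var e)       = var e
regular⇒⊢ (app N R _ e) = app (neutral⇒⊢ N) (regular⇒⊢ R) e
regular⇒⊢ (lam R)       = lam (regular⇒⊢ R)

body⇒⊢ : ∀ {k} {t : Term k} {xs} → Body t xs → t ⊢ xs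
body⇒⊢ (app R e) = app (var refl) (regular⇒⊢ R) e
body⇒⊢ (lam B)   = lam (body⇒⊢ B)

-- In a code, the abstractions and the last argument come from the innermost
-- left branch, and the other arguments are grafted by bridges.
base : ∀ j (c : Code) → j ≤ deg c → Code
base zero    c _   = bridge empty c
base (suc j) c j≤d = chord (deg c ∸ suc j) c (ℕ.∸-monoʳ-< (s≤s z≤n) j≤d)

spine : ∀ {k} {t : Term k} {xs} → Code → Neutral t xs → Code
code  : ∀ {k j} {t : Term k} {xs} → Regular j t xs → Code
-- The `j` variables bound just above are free in `t` itself, whereas the code is that of the term
-- including those abstractions.
length-code : ∀ {k j} {t : Term k} {xs} (R : Regular j t xs) → length xs ≡ j + suc (deg (code R))

spine b (var _)     = b
spine b (app N R _) = bridge (spine b N) (code R)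

bounded : ∀ {k j} {t : Term k} {xs} (R : Regular 0 t xs) → j < length xs → j ≤ deg (code R)
bounded R j<n = ℕ.≤-pred (subst (_ <_) (length-code R) j<n)

code (var _)               = empty
code (app {j = j} N R l _) = spine (base j (code R) (bounded R l)) N
code (lam R)               = code R

deg-base : ∀ j c l → j + deg (base j c l) ≡ suc (deg c)
deg-base zero    c l = refl
deg-base (suc j) c l = trans (ℕ.+-suc (suc j) _) (cong suc (trans (ℕ.+-comm (suc j) _) (ℕ.m∸n+n≡m l)))

deg-spine : ∀ {k} {t : Term k} {xs} b (N : Neutral t xs) → suc (deg (spine b N)) ≡ deg b + length xs
deg-spine b (var refl) = sym (ℕ.+-comm (deg b) 1)
deg-spine b (app {xs = xs} {ys} N R refl) = trans (cong (2 +_) (ℕ.+-comm (deg (spine b N)) (deg (code R))))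
  (trans (cong suc (sym (ℕ.+-suc (deg (code R)) _)))
    (trans (cong₂ _+_ (sym (length-code R)) (deg-spine b N))
      (trans (swap-+ (length ys) (deg b) (length xs)) (cong (deg b +_) (sym (List.length-++ ys))))))
  where
  swap-+ : ∀ a b c → a + (b + c) ≡ b + (a + c)
  swap-+ = solve-∀

length-code (var refl) = refl
length-code (app {j = j} {xs = xs} {ys} N R l refl) = sym (trans (cong (j +_) (deg-spine (base j (code R) (bounded R l)) N))
  (trans (sym (ℕ.+-assoc j _ (length xs))) (trans (cong (_+ length xs) (trans (deg-base j (code R) _) (sym (length-code R)))) (sym (List.length-++ ys)))))
length-code {j = j} (lam {xs = xs} R) = ℕ.suc-injective (trans (cong suc (sym (List.length-map suc xs))) (length-code R))

base-cong : ∀ j {c c′} l l′ → c ≡ c′ → base j c l ≡ base j c′ l′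
base-cong j l l′ refl = cong (base j _) (ℕ.≤-irrelevant l l′)

code-functional  : ∀ {k j} {t : Term k} {xs xs′} (R : Regular j t xs) (R′ : Regular j t xs′) → code R ≡ code R′
spine-functional : ∀ {k} {t : Term k} {xs xs′ b b′} (N : Neutral t xs) (N′ : Neutral t xs′) → b ≡ b′ → spine b N ≡ spine b′ N′
code-functional (var _) (var _) = refl
code-functional (app {j = j} N R l _) (app N′ R′ l′ _) = spine-functional N N′ (base-cong j _ _ (code-functional R R′))
code-functional (lam R) (lam R′) = code-functional R R′
spine-functional (var _) (var _) e = e
spine-functional (app N R _) (app N′ R′ _) e = cong₂ bridge (spine-functional N N′ e) (code-functional R R′)

bridge-injective : ∀ {a b a′ b′} → Code.bridge a b ≡ bridge a′ b′ → a ≡ a′ × b ≡ b′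
bridge-injective refl = refl , refl

-- The number of abstractions above the spine encoded by a code.
depth : Code → ℕ
depth empty         = 0
depth (bridge a _)  = depth a
depth (chord i c _) = deg c ∸ i

depth-base : ∀ j c l → depth (base j c l) ≡ j
depth-base zero    c l = refl
depth-base (suc j) c l = ℕ.m∸[m∸n]≡n l

depth-spine : ∀ {k} {t : Term k} {xs} b (N : Neutral t xs) → depth (spine b N) ≡ depth b
depth-spine b (var _)     = refl
depth-spine b (app N R _) = depth-spine b N

depth-app : ∀ {k j} {u v : Term k} {zs} (R : Regular j (app u v) zs) → depth (code R) ≡ j
depth-app (app {j = j} N R l _) = trans (depth-spine _ N) (depth-base j _ _)

-- Besides the `j` abstractions above `t`, those of `t` itself count too. Equality for applications
-- (`depth-app`) tells them from abstractions.
depth-code : ∀ {k j} {t : Term k} {xs} (R : Regular j t xs) → j ≤ depth (code R)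
depth-code (var _)         = z≤n
depth-code R@(app _ _ _ _) = ℕ.≤-reflexive (sym (depth-app R))
depth-code (lam R)         = ℕ.≤-trans (ℕ.n≤1+n _) (depth-code R)

-- A spine is a left branch of bridges ending in its base. Any bridge above the base has a nonempty
-- left part, so the code shows where the base begins.
data IsBase : Code → Set where
  bridge : ∀ {c} → IsBase (bridge empty c)
  chord  : ∀ {i c l} → IsBase (chord i c l)

isBase : ∀ j c l → IsBase (base j c l)
isBase zero    c l = bridge
isBase (suc j) c l = chord

spine≢empty : ∀ {k} {t : Term k} {xs b} → IsBase b → (N : Neutral t xs) → spine b N ≢ empty
spine≢empty bridge (var _) ()
spine≢empty chord  (var _) ()
spine≢empty _ (app _ _ _) ()

base-injective : ∀ j c c′ l l′ → base j c l ≡ base j c′ l′ → c ≡ c′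
base-injective zero    c c′ l l′ e = proj₂ (bridge-injective e)
base-injective (suc j) c c′ l l′ e = chord-injective e
  where
  chord-injective : ∀ {i i′ c c′ l l′} → Code.chord i c l ≡ chord i′ c′ l′ → c ≡ c′
  chord-injective refl = refl

++-injective : ∀ {A : Set} (xs xs′ : List A) {ys ys′} → length xs ≡ length xs′ → xs ++ ys ≡ xs′ ++ ys′ → xs ≡ xs′ × ys ≡ ys′
++-injective [] [] _ e = refl , e
++-injective (x ∷ xs) (x′ ∷ xs′) l e with ++-injective xs xs′ (ℕ.suc-injective l) (List.∷-injectiveʳ e)
... | p , q = cong₂ _∷_ (List.∷-injectiveˡ e) p , q

code-injective  : ∀ {k j} {t t′ : Term k} {xs} (R : Regular j t xs) (R′ : Regular j t′ xs) → code R ≡ code R′ → t ≡ t′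
-- A list of free variables can be cut only when the lengths of its parts are known. The length of
-- the last part `ys`, belonging to the last argument, follows from the first conclusion; hence the
-- implication in the second.
spine-injective : ∀ {k} {t t′ : Term k} {xs xs′ ys ys′ b b′} → IsBase b → IsBase b′ → (N : Neutral t xs) (N′ : Neutral t′ xs′) →
                  spine b N ≡ spine b′ N′ → b ≡ b′ × (length ys ≡ length ys′ → ys ++ xs ≡ ys′ ++ xs′ → t ≡ t′)

spine-injective B B′ (var refl) (var refl) e = e , λ {l refl′ → cong var (List.∷-injectiveˡ (proj₂ (++-injective _ _ l refl′)))}
spine-injective {ys = ys} {ys′} B B′ (app {xs = xs} {zs} N R refl) (app {xs = xs′} {zs′} N′ R′ refl) e with bridge-injective e
... | e₁ , e₂ with spine-injective {ys = zs} {zs′} B B′ N N′ e₁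
... | b≡b′ , h = b≡b′ , λ l q →
  let q′ = proj₂ (++-injective ys ys′ l q)
      l′ = trans (length-code R) (trans (cong suc (cong deg e₂)) (sym (length-code R′)))
  in cong₂ app (h l′ q′) (same (proj₁ (++-injective zs zs′ l′ q′)))
  where
  same : zs ≡ zs′ → _
  same refl = code-injective R R′ e₂
spine-injective bridge B′ (var _) (app N R _) e = contradiction (sym (proj₁ (bridge-injective e))) (spine≢empty B′ N)
spine-injective B bridge (app N R _) (var _) e = contradiction (proj₁ (bridge-injective e)) (spine≢empty B N)

code-injective (var refl) (var refl) e = refl
code-injective (var _) (app {j = j} N R l _) e = contradiction (sym e) (spine≢empty (isBase j (code R) (bounded R l)) N)
code-injective (var _) (lam R) e = contradiction (ℕ.≤-trans (depth-code R) (ℕ.≤-reflexive (cong depth (sym e)))) λ ()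
code-injective (lam R) (var _) e = contradiction (ℕ.≤-trans (depth-code R) (ℕ.≤-reflexive (cong depth e))) λ ()
code-injective (app {j = j} N R l _) (var _) e = contradiction e (spine≢empty (isBase j (code R) (bounded R l)) N)
code-injective R@(app _ _ _ _) (lam R′) e = contradiction (ℕ.≤-trans (depth-code R′) (ℕ.≤-reflexive (trans (cong depth (sym e)) (depth-app R)))) ℕ.1+n≰n
code-injective (lam R) R′@(app _ _ _ _) e = contradiction (ℕ.≤-trans (depth-code R) (ℕ.≤-reflexive (trans (cong depth e) (depth-app R′)))) ℕ.1+n≰n
code-injective (lam R) (lam R′) e = cong lam (code-injective R R′ e)
code-injective (app {j = j} {ys = ys} N R l refl) (app {ys = ys′} N′ R′ l′ q) e
  with spine-injective {ys = ys} {ys′} (isBase j _ _) (isBase j _ _) N N′ e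
... | b , h with base-injective j _ _ _ _ b
... | c = let len = trans (length-code R) (trans (cong suc (cong deg c)) (sym (length-code R′))) in
  cong₂ app (h len q) (same (proj₁ (++-injective ys ys′ len q)))
  where
  same : ys ≡ ys′ → _
  same refl = code-injective R R′ c

-- The outer spine of a nonempty code taken apart: `lams` abstractions, a last argument with code
-- `last`, and a function part with `width` free variables.
record Builder (c : Code) : Set where
  field
    {lams width} : ℕ
    last   : Code
    l      : lams ≤ deg last
    build-last  : ∀ {k} (ys : List (Fin k)) → length ys ≡ suc (deg last) → Σ (Term k) λ v → Σ (Regular 0 v ys) λ R → code R ≡ last
    build-spine : ∀ {k} (xs : List (Fin k)) → length xs ≡ width → Σ (Term k) λ u → Σ (Neutral u xs) λ N → spine (base lams last l) N ≡ c
    total : lams + suc (deg c) ≡ suc (deg last) + width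

split-at : ∀ {A : Set} m n (zs : List A) → length zs ≡ m + n → ∃[ xs ] ∃[ ys ] length xs ≡ m × length ys ≡ n × zs ≡ xs ++ ys
split-at zero    n zs e = [] , zs , refl , e , refl
split-at (suc m) n (z ∷ zs) e with split-at m n zs (ℕ.suc-injective e)
... | xs , ys , p , q , refl = z ∷ xs , ys , cong suc p , q , refl

Build : ℕ → Code → Set
Build j c = ∀ {k} (zs : List (Fin k)) → length zs ≡ j + suc (deg c) → Σ (Term k) λ t → Σ (Regular j t zs) λ R → code R ≡ c

build-lams : ∀ j {c} → Build j c → Build 0 c
build-lams zero    b = b
build-lams (suc j) b = build-lams j λ zs e →
  let t , R , q = b (zero ∷ map suc zs) (cong suc (trans (List.length-map suc zs) e)) in lam t , lam R , q

build-from : ∀ {c} → Builder c → Build 0 c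
build-from B = build-lams lams λ zs e → case split-at (suc (deg last)) width zs (trans e total) of λ where
    (ys , xs , p , q , refl) → let v , R , e₁ = build-last ys p ; u , N , e₂ = build-spine xs q in
      app u v , app N R (ℕ.≤-trans (s≤s l) (ℕ.≤-reflexive (sym p))) refl ,
      trans (spine-functional N N (base-cong lams _ l e₁)) e₂
  where open Builder B

graft : ∀ {a b} → Builder a → Build 0 b → Builder (bridge a b)
graft {a} {b} B h = record
  { last = last ; l = l ; build-last = build-last
  ; build-spine = λ xs e → case split-at (suc (deg b)) width xs e of λ where
      (ys , xs , p , q , refl) → let v , R , e₁ = h ys p ; u , N , e₂ = build-spine xs q in
        app u v , app N R refl , cong₂ bridge e₂ e₁
  ; total = trans (arith₁ lams (deg a) (deg b)) (trans (cong (suc (deg b) +_) total) (arith₂ (suc (deg b)) (suc (deg last)) width)) }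
  where
  open Builder B
  arith₁ : ∀ j a b → j + suc (suc (a + b)) ≡ suc b + (j + suc a)
  arith₁ = solve-∀
  arith₂ : ∀ a b c → a + (b + c) ≡ b + (a + c)
  arith₂ = solve-∀

build   : ∀ c → Build 0 c
builder : ∀ c → c ≢ empty → Builder c

build empty (i ∷ []) refl = var i , var refl , refl
build c@(bridge _ _)  = build-from (builder c λ ())
build c@(chord _ _ _) = build-from (builder c λ ())

builder empty n = contradiction refl n
builder (bridge empty c) _ = record
  { last = c ; l = z≤n ; build-last = build c
  ; build-spine = λ where (i ∷ []) refl → var i , var refl , refl
  ; total = ℕ.+-comm 1 (suc (deg c)) }
builder (bridge a@(bridge _ _) b)  _ = graft (builder a λ ()) (build b)
builder (bridge a@(chord _ _ _) b) _ = graft (builder a λ ()) (build b)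
builder (chord i c i<d) _ = record
  -- The index of the chord in `base` is `deg c ∸ lams`, so `lams` has to be `deg c ∸ i`, here as a
  -- successor to make `base` compute to a chord.
  { lams = suc (deg c ∸ suc i) ; last = c ; l = rest<deg ; build-last = build c
  ; build-spine = λ where (j ∷ []) refl → var j , var refl , chord-cong (complement i i<d)
  ; total = trans (ℕ.+-suc (suc (deg c ∸ suc i)) (suc i)) (cong suc
      (trans (cong suc (ℕ.m∸n+n≡m i<d)) (ℕ.+-comm 1 (deg c)))) }
  where
  rest<deg : suc (deg c ∸ suc i) ≤ deg c
  rest<deg = ℕ.∸-monoʳ-< (s≤s z≤n) i<d
  complement : ∀ i → i < deg c → deg c ∸ suc (deg c ∸ suc i) ≡ i
  complement i i<d = ℕ.suc-injective (trans (sym (ℕ.+-∸-assoc 1 {deg c} {suc (deg c ∸ suc i)} (ℕ.∸-monoʳ-< (s≤s z≤n) i<d))) (ℕ.m∸[m∸n]≡n i<d))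
  chord-cong : ∀ {i′ l} → i′ ≡ i → Code.chord i′ c l ≡ chord i c i<d
  chord-cong refl = cong (chord i c) (ℕ.≤-irrelevant _ _)

size-spine : ∀ {k} {t : Term k} {xs} b (N : Neutral t xs) → suc (edges (spine b N)) ≡ edges b + size t
size-code  : ∀ {k j} {t : Term k} {xs} (R : Regular j t xs) → size t ≡ suc (edges (code R))

size-spine b (var _) = ℕ.+-comm 1 (edges b)
size-spine b (app {u = u} {v} N R _) = trans (cong suc (sym (ℕ.+-suc (edges (spine b N)) (edges (code R)))))
  (trans (cong₂ _+_ (size-spine b N) (sym (size-code R))) (ℕ.+-assoc (edges b) (size u) (size v)))

edges-base : ∀ j c l → edges (base j c l) ≡ suc (edges c)
edges-base zero    c l = refl
edges-base (suc j) c l = refl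

size-code (var _) = refl
size-code (app {j = j} {u} {v} N R l _) = sym (trans (size-spine _ N)
  (trans (cong (_+ size u) (trans (edges-base j (code R) _) (sym (size-code R)))) (ℕ.+-comm (size v) (size u))))
size-code (lam R) = size-code R

code-body : ∀ {k} {t : Term k} {xs} → Body t xs → Code
code-body (app R _) = code R
code-body (lam B)   = code-body B

-- The origin of `n ∸ 2`: a regular term has one leaf more than its code has edges, and the head `x`
-- of the body adds another.
size-body : ∀ {k} {t : Term k} {xs} (B : Body t xs) → size t ≡ suc (suc (edges (code-body B)))
size-body (app R _) = cong suc (size-code R)
size-body (lam B)   = size-body B

code-body-functional : ∀ {k} {t : Term k} {xs ys} (B : Body t xs) (B′ : Body t ys) → code-body B ≡ code-body B′
code-body-functional (app R _) (app R′ _) = code-functional R R′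
code-body-functional (lam B) (lam B′) = code-body-functional B B′

-- Equality holds at the application (`body-length-app`) and each abstraction above it removes a
-- variable. So the list and the code together tell whether an abstraction comes next.
body-length : ∀ {k} {t : Term k} {xs} (B : Body t xs) → length xs ≤ suc (suc (deg (code-body B)))
body-length (app {ys = ys} R refl) = ℕ.≤-reflexive (trans (List.length-++ ys) (trans (ℕ.+-comm (length ys) 1) (cong suc (length-code R))))
body-length (lam {xs = xs} B) = ℕ.≤-trans (ℕ.≤-trans (ℕ.n≤1+n _) (ℕ.≤-reflexive (cong suc (sym (List.length-map suc xs))))) (body-length B)

body-length-app : ∀ {k} {u v : Term k} {xs} (B : Body (app u v) xs) → length xs ≡ suc (suc (deg (code-body B)))
body-length-app (app {ys = ys} R refl) = trans (List.length-++ ys) (trans (ℕ.+-comm (length ys) 1) (cong suc (length-code R)))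

code-body-injective : ∀ {k} {t t′ : Term k} {xs} (B : Body t xs) (B′ : Body t′ xs) → code-body B ≡ code-body B′ → t ≡ t′
code-body-injective (app {ys = ys} R refl) (app {ys = ys′} R′ q) e
  with ++-injective ys ys′ (trans (length-code R) (trans (cong (suc ∘ deg) e) (sym (length-code R′)))) q
... | refl , refl = cong (app _) (code-injective R R′ e)
code-body-injective (lam B) (lam B′) e = cong lam (code-body-injective B B′ e)
code-body-injective B@(app _ _) (lam {xs = xs} B′) e = contradiction
  (ℕ.≤-trans (ℕ.≤-trans (ℕ.≤-reflexive (cong suc (sym (List.length-map suc xs)))) (body-length B′))
    (ℕ.≤-reflexive (trans (cong (λ c → 2 + deg c) (sym e)) (sym (body-length-app B))))) ℕ.1+n≰n
code-body-injective (lam {xs = xs} B) B′@(app _ _) e = contradiction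
  (ℕ.≤-trans (ℕ.≤-trans (ℕ.≤-reflexive (cong suc (sym (List.length-map suc xs)))) (body-length B))
    (ℕ.≤-reflexive (trans (cong (λ c → 2 + deg c) e) (sym (body-length-app B′))))) ℕ.1+n≰n

build-body : ∀ c {k} j (zs : List (Fin k)) → length zs + j ≡ suc (suc (deg c)) → Σ (Term k) λ t → Σ (Body t zs) λ B → code-body B ≡ c
build-body c zero zs e with split-at (suc (deg c)) 1 zs (trans (sym (ℕ.+-identityʳ _)) (trans e (ℕ.+-comm 1 (suc (deg c)))))
... | ys , i ∷ [] , p , refl , refl = let v , R , q = build c ys p in app (var i) v , app R refl , q
build-body c (suc j) zs e =
  let t , B , q = build-body c j (zero ∷ map suc zs) (trans (cong (λ n → suc n + j) (List.length-map suc zs)) (trans (sym (ℕ.+-suc _ j)) e))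
  in lam t , lam B , q

body-normal : ∀ {t : Term 0} → Body t [] → Normal t
body-normal B u v = no-redex-body B
  where
  no-redex-neutral : ∀ {k} {t : Term k} {xs} → Neutral t xs → ∀ {j} {u : Term (suc j)} {v} → ¬ (app (lam u) v ⊑ t)
  no-redex : ∀ {k j} {t : Term k} {xs} → Regular j t xs → ∀ {j} {u : Term (suc j)} {v} → ¬ (app (lam u) v ⊑ t)
  no-redex-neutral (app N R _) (appˡ s) = no-redex-neutral N s
  no-redex-neutral (app N R _) (appʳ s) = no-redex R s
  no-redex (app N R _ _) (appˡ s) = no-redex-neutral N s
  no-redex (app N R _ _) (appʳ s) = no-redex R s
  no-redex (lam R) (lam s) = no-redex R s
  no-redex-body : ∀ {k} {t : Term k} {xs} → Body t xs → ∀ {j} {u : Term (suc j)} {v} → ¬ (app (lam u) v ⊑ t)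
  no-redex-body (app R _) (appʳ s) = no-redex R s
  no-redex-body (lam B) (lam s) = no-redex-body B s

-- Colourings of diagrams

_≟ᵃ_ : DecidableEquality Arity
unary  ≟ᵃ unary  = yes refl
binary ≟ᵃ binary = yes refl
unary  ≟ᵃ binary = no λ ()
binary ≟ᵃ unary  = no λ ()

_≟ᴺ_ : ∀ {a s} → DecidableEquality (Node a s)
unary   ≟ᴺ unary   = yes refl
binary  ≟ᴺ binary  = yes refl
down n  ≟ᴺ down m  = map′ (cong down) (λ where refl → refl) (n ≟ᴺ m)
left n  ≟ᴺ left m  = map′ (cong left) (λ where refl → refl) (n ≟ᴺ m)
right n ≟ᴺ right m = map′ (cong right) (λ where refl → refl) (n ≟ᴺ m)
unary   ≟ᴺ down _  = no λ ()
down _  ≟ᴺ unary   = no λ ()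
binary  ≟ᴺ left _  = no λ ()
binary  ≟ᴺ right _ = no λ ()
left _  ≟ᴺ binary  = no λ ()
left _  ≟ᴺ right _ = no λ ()
right _ ≟ᴺ binary  = no λ ()
right _ ≟ᴺ left _  = no λ ()

_≟ᴵ_ : ∀ {s} → DecidableEquality (Inner s)
_≟ᴵ_ = Prodₚ.≡-dec _≟ᵃ_ _≟ᴺ_

_≟ᴱ_ : ∀ {s} → DecidableEquality (TreeEdge s)
below   ≟ᴱ below   = yes refl
belowˡ  ≟ᴱ belowˡ  = yes refl
belowʳ  ≟ᴱ belowʳ  = yes refl
down e  ≟ᴱ down f  = map′ (cong down) (λ where refl → refl) (e ≟ᴱ f)
left e  ≟ᴱ left f  = map′ (cong left) (λ where refl → refl) (e ≟ᴱ f)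
right e ≟ᴱ right f = map′ (cong right) (λ where refl → refl) (e ≟ᴱ f)
below   ≟ᴱ down _  = no λ ()
down _  ≟ᴱ below   = no λ ()
belowˡ  ≟ᴱ belowʳ  = no λ ()
belowˡ  ≟ᴱ left _  = no λ ()
belowˡ  ≟ᴱ right _ = no λ ()
belowʳ  ≟ᴱ belowˡ  = no λ ()
belowʳ  ≟ᴱ left _  = no λ ()
belowʳ  ≟ᴱ right _ = no λ ()
left _  ≟ᴱ belowˡ  = no λ ()
left _  ≟ᴱ belowʳ  = no λ ()
left _  ≟ᴱ right _ = no λ ()
right _ ≟ᴱ belowˡ  = no λ ()
right _ ≟ᴱ belowʳ  = no λ ()
right _ ≟ᴱ left _  = no λ ()

treeEdges : ∀ s → List (TreeEdge s)
treeEdges leaf         = []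
treeEdges (unary s)    = below ∷ map down (treeEdges s)
treeEdges (binary s r) = belowˡ ∷ belowʳ ∷ map left (treeEdges s) ++ map right (treeEdges r)

∈-treeEdges : ∀ {s} (e : TreeEdge s) → e ∈ treeEdges s
∈-treeEdges below     = here refl
∈-treeEdges belowˡ    = here refl
∈-treeEdges belowʳ    = there (here refl)
∈-treeEdges (down e)  = there (∈-map⁺ down (∈-treeEdges e))
∈-treeEdges (left e)  = there (there (∈-++⁺ˡ (∈-map⁺ left (∈-treeEdges e))))
∈-treeEdges {binary s r} (right e) = there (there (∈-++⁺ʳ (map left (treeEdges s)) (∈-map⁺ right (∈-treeEdges e))))

module _ {V E : Set} (_≟_ : DecidableEquality V) (s t : E → V) where

  Via : List E → V → V → Set
  Via L = EqClosure λ x y → ∃[ e ] e ∈ L × s e ≡ x × t e ≡ y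

  -- Supplies the colouring for 3-connectedness: `comp` does not change along the edges in `L`, and
  -- if it is constant then `L` connects all vertices.
  record Components (L : List E) : Set where
    field
      comp   : V → V
      joined : ∀ x → Via L x (comp x)
      const  : ∀ {e} → e ∈ L → comp (s e) ≡ comp (t e)

  weaken : ∀ {e L x y} → Via L x y → Via (e ∷ L) x y
  weaken = EqC.map λ (f , p , q) → f , there p , q

  components : ∀ L → Components L
  components [] = record { comp = id ; joined = λ _ → ε ; const = λ () }
  components (e ∷ L) = record { comp = comp′ ; joined = joined′ ; const = const′ }
    where
    open Components (components L)
    comp′ : V → V
    comp′ x with comp x ≟ comp (s e)
    ... | yes _ = comp (t e)
    ... | no  _ = comp x
    joined′ : ∀ x → Via (e ∷ L) x (comp′ x)
    joined′ x with comp x ≟ comp (s e)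
    ... | no  _ = weaken (joined x)
    ... | yes q = EqC.transitive _ (weaken (subst (Via L x) q (joined x)))
      (EqC.transitive _ (EqC.symmetric _ (weaken (joined (s e))))
        (fwd (e , here refl , refl , refl) ◅ weaken (joined (t e))))
    same : ∀ {x y} → comp x ≡ comp y → comp′ x ≡ comp′ y
    same {x} {y} q with comp x ≟ comp (s e) | comp y ≟ comp (s e)
    ... | yes _ | yes _ = refl
    ... | no  _ | no  _ = q
    ... | yes p | no  n = contradiction (trans (sym q) p) n
    ... | no  n | yes p = contradiction (trans q p) n
    const′ : ∀ {f} → f ∈ e ∷ L → comp′ (s f) ≡ comp′ (t f)
    const′ (there p) = same (const p)
    const′ (here refl) with comp (s e) ≟ comp (s e) | comp (t e) ≟ comp (s e)
    ... | yes _ | yes _ = refl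
    ... | yes _ | no  _ = refl
    ... | no  n | _     = contradiction refl n

-- Below, an open term is coloured: χ colours its inner nodes, γ its free
-- variables (that is, their binders) and p the parent of its root.  The edge
-- above the root is nothing.

ups : ∀ {s} → Maybe (TreeEdge s) → TreeEdge (unary s)
ups nothing  = below
ups (just e) = down e

upsˡ : ∀ {s r} → Maybe (TreeEdge s) → TreeEdge (binary s r)
upsˡ nothing  = belowˡ
upsˡ (just e) = left e

upsʳ : ∀ {s r} → Maybe (TreeEdge r) → TreeEdge (binary s r)
upsʳ nothing  = belowʳ
upsʳ (just e) = right e

ups-inj : ∀ {s} → Injective (ups {s})
ups-inj {x = nothing} {nothing} e = refl
ups-inj {x = just _} {just _} refl = refl

upsˡ-inj : ∀ {s r} → Injective (upsˡ {s} {r})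
upsˡ-inj {x = nothing} {nothing} e = refl
upsˡ-inj {x = just _} {just _} refl = refl

upsʳ-inj : ∀ {s r} → Injective (upsʳ {s} {r})
upsʳ-inj {x = nothing} {nothing} e = refl
upsʳ-inj {x = just _} {just _} refl = refl

upsˡ≢upsʳ : ∀ {s r} (e : Maybe (TreeEdge s)) (f : Maybe (TreeEdge r)) → upsˡ e ≢ upsʳ f
upsˡ≢upsʳ nothing  nothing  ()
upsˡ≢upsʳ nothing  (just _) ()
upsˡ≢upsʳ (just _) nothing  ()
upsˡ≢upsʳ (just _) (just _) ()

module Coloured {K : Set} where

  out : ∀ {k} (u : Term k) → (Inner (Sk u) → K) → (Fin k → K) → Leaf (Sk u) ⊎ Inner (Sk u) → K
  out u χ γ = [ [ γ , (λ a → χ (unary , a)) ]′ ∘ open-binder u , χ ]′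

  upper : ∀ {k} (u : Term k) → (Inner (Sk u) → K) → K → Maybe (TreeEdge (Sk u)) → K
  upper u χ p nothing  = p
  upper u χ p (just e) = χ (parent e)

  lower : ∀ {k} (u : Term k) → (Inner (Sk u) → K) → (Fin k → K) → Maybe (TreeEdge (Sk u)) → K
  lower u χ γ nothing  = out u χ γ (root (Sk u))
  lower u χ γ (just e) = out u χ γ (child e)

  Mono : ∀ {k} (u : Term k) → (Inner (Sk u) → K) → (Fin k → K) → K → Maybe (TreeEdge (Sk u)) → Set
  Mono u χ γ p e = upper u χ p e ≡ lower u χ γ e

  module _ {k} {u : Term (suc k)} (χ : Inner (Sk (lam u)) → K) (γ : Fin k → K) (p : K) where

    out-down : ∀ x → out (lam u) χ γ (Sum.map down (map₂ down) x) ≡ out u (χ ∘ map₂ down) (extend (χ (unary , unary)) γ) x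
    out-down (inj₂ _) = refl
    out-down (inj₁ ℓ) = go (binder-lam u ℓ)
      where
      go : ∀ {x y} → IsBound x y → [ γ , (λ a → χ (unary , a)) ]′ y ≡ [ extend (χ (unary , unary)) γ , (λ a → χ (unary , down a)) ]′ x
      go zero  = refl
      go suc   = refl
      go inner = refl

    ends-down : ∀ e → upper (lam u) χ p (just (ups e)) ≡ upper u (χ ∘ map₂ down) (χ (unary , unary)) e
                    × lower (lam u) χ γ (just (ups e)) ≡ lower u (χ ∘ map₂ down) (extend (χ (unary , unary)) γ) e
    ends-down nothing  = refl , out-down (root (Sk u))
    ends-down (just e) = refl , out-down (child e)

    mono-down : ∀ e → Mono (lam u) χ γ p (just (ups e)) ≡ Mono u (χ ∘ map₂ down) (extend (χ (unary , unary)) γ) (χ (unary , unary)) e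
    mono-down e = cong₂ _≡_ (proj₁ (ends-down e)) (proj₂ (ends-down e))

  module _ {k} {u v : Term k} (χ : Inner (Sk (app u v)) → K) (γ : Fin k → K) (p : K) where

    out-left : ∀ x → out (app u v) χ γ (Sum.map left (map₂ left) x) ≡ out u (χ ∘ map₂ left) γ x
    out-left (inj₂ _) = refl
    out-left (inj₁ ℓ) with open-binder u ℓ
    ... | inj₁ _ = refl
    ... | inj₂ _ = refl

    out-right : ∀ x → out (app u v) χ γ (Sum.map right (map₂ right) x) ≡ out v (χ ∘ map₂ right) γ x
    out-right (inj₂ _) = refl
    out-right (inj₁ ℓ) with open-binder v ℓ
    ... | inj₁ _ = refl
    ... | inj₂ _ = refl

    mono-left : ∀ e → Mono (app u v) χ γ p (just (upsˡ e)) ≡ Mono u (χ ∘ map₂ left) γ (χ (binary , binary)) e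
    mono-left nothing  = cong (_ ≡_) (out-left (root (Sk u)))
    mono-left (just e) = cong (_ ≡_) (out-left (child e))

    mono-right : ∀ e → Mono (app u v) χ γ p (just (upsʳ e)) ≡ Mono v (χ ∘ map₂ right) γ (χ (binary , binary)) e
    mono-right nothing  = cong (_ ≡_) (out-right (root (Sk v)))
    mono-right (just e) = cong (_ ≡_) (out-right (child e))

module BadEdges {K : Set} (_≟_ : DecidableEquality K) where

  open Coloured {K}

  private variable
    k j : ℕ
    u v : Term k
    xs ys zs : List (Fin k)

  Bad : (u : Term k) → (Inner (Sk u) → K) → (Fin k → K) → K → Maybe (TreeEdge (Sk u)) → Set
  Bad u χ γ p e = ¬ Mono u χ γ p e

  One Two Three Const : (u : Term k) → (Inner (Sk u) → K) → (Fin k → K) → K → Set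
  One   u χ γ p = ∃[ e ] Bad u χ γ p e
  Two   u χ γ p = ∃[ e ] ∃[ f ] e ≢ f × Bad u χ γ p e × Bad u χ γ p f
  Three u χ γ p = ∃[ e ] ∃[ f ] ∃[ g ] e ≢ f × e ≢ g × f ≢ g × Bad u χ γ p e × Bad u χ γ p f × Bad u χ γ p g
  Const u χ γ p = ∀ x → χ x ≡ p

  bad-down : ∀ {u : Term (suc k)} (χ : Inner (Sk (lam u)) → K) (γ : Fin k → K) p {e} →
             Bad u (χ ∘ map₂ down) (extend (χ (unary , unary)) γ) (χ (unary , unary)) e → Bad (lam u) χ γ p (just (ups e))
  bad-down χ γ p {e} b m = b (subst id (mono-down χ γ p e) m)

  bad-left : ∀ {u v : Term k} (χ : Inner (Sk (app u v)) → K) (γ : Fin k → K) p {e} →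
             Bad u (χ ∘ map₂ left) γ (χ (binary , binary)) e → Bad (app u v) χ γ p (just (upsˡ e))
  bad-left χ γ p {e} b m = b (subst id (mono-left χ γ p e) m)

  bad-right : ∀ {u v : Term k} (χ : Inner (Sk (app u v)) → K) (γ : Fin k → K) p {e} →
              Bad v (χ ∘ map₂ right) γ (χ (binary , binary)) e → Bad (app u v) χ γ p (just (upsʳ e))
  bad-right χ γ p {e} b m = b (subst id (mono-right χ γ p e) m)

  just-≢ : ∀ {A B : Set} {f : A → B} → Injective f → ∀ {x y} → x ≢ y → just (f x) ≢ just (f y)
  just-≢ inj ne e = ne (inj (just-injective e))

  -- The path from above the root of `u` to the leaf of `i` starts with colour `p` and ends at the
  -- binder, of colour `γ i`, so it changes colour somewhere.
  one : u ⊢ xs → ∀ χ γ p {i} → i ∈ xs → γ i ≢ p → One u χ γ p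
  one (var refl) χ γ p (here refl) ne = nothing , λ e → ne (sym e)
  one (app {ys = ys} D E refl) χ γ p q ne with p ≟ χ (binary , binary)
  ... | no n = nothing , n
  ... | yes refl with ∈-++⁻ ys q
  ...   | inj₁ r = let e , b = one E _ γ _ r ne in just (upsʳ e) , bad-right χ γ p b
  ...   | inj₂ r = let e , b = one D _ γ _ r ne in just (upsˡ e) , bad-left χ γ p b
  one (lam D) χ γ p q ne with p ≟ χ (unary , unary)
  ... | no n = nothing , n
  ... | yes refl = let e , b = one D _ (extend (χ (unary , unary)) γ) _ (there (∈-map⁺ suc q)) ne in just (ups e) , bad-down χ γ p b

  Coloured : (Fin k → K) → K → List (Fin k) → Set
  Coloured γ c = All (λ i → γ i ≡ c)

  neutral-nonempty : Neutral u xs → ∃[ i ] i ∈ xs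
  neutral-nonempty (var refl) = _ , here refl
  neutral-nonempty (app {ys = ys} N R refl) = let i , q = neutral-nonempty N in i , ∈-++⁺ʳ ys q

  regular-nonempty : Regular 0 u xs → ∃[ i ] i ∈ xs
  regular-nonempty {xs = []} R = case length-code R of λ ()
  regular-nonempty {xs = i ∷ _} R = i , here refl

  coloured-suc : ∀ {γ : Fin k → K} {c a} → Coloured γ c xs → Coloured (extend a γ) c (map suc xs)
  coloured-suc = Allₚ.map⁺

  beyond : ∀ {A : Set} (ys zs : List A) {xs ws} → length zs < length ys → ys ++ xs ≡ zs ++ ws →
           (∀ {x} → x ∈ zs → x ∈ ys) × (∃[ y ] y ∈ ys × y ∈ ws) × (∀ {x} → x ∈ xs → x ∈ ws)
  beyond (y ∷ ys) [] l refl = (λ ()) , (y , here refl , here refl) , λ q → there (∈-++⁺ʳ ys q)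
  beyond (y ∷ ys) (z ∷ zs) (s≤s l) e with List.∷-injective e
  ... | refl , e′ with beyond ys zs l e′
  ...   | f , (w , p , q) , g = (λ where (here r)  → here r
                                         (there r) → there (f r)) , (w , there p , q) , g

  -- Here zs are bound by the abstractions just above u, from the first one not coloured c on.
  two : Regular j u xs → ∀ zs {ws} → xs ≡ zs ++ ws → length zs ≤ j → ∀ χ γ {c} p → Coloured γ c ws →
        ∀ {i} → i ∈ zs → γ i ≢ c → p ≢ c → Two u χ γ p
  two (var _) [] _ _ χ γ p col () _ _
  two (app {ys = ys} N R l refl) zs e m χ γ {c} p col {i} q ne p≢c
    with beyond ys zs (ℕ.≤-<-trans m l) e | χ (binary , binary) ≟ c
  ... | f , _ , _ | yes refl =
    let e₁ , b₁ = one (regular⇒⊢ R) _ γ (χ (binary , binary)) (f q) ne in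
    nothing , just (upsʳ e₁) , (λ ()) , p≢c , bad-right χ γ p b₁
  -- By `j < length ys` the argument reaches beyond `zs`, so it has a variable of colour `c`; all
  -- those of the function part are of colour `c`. Each part thus contains a bad edge.
  ... | _ , (y , y∈ys , y∈ws) , g | no n =
    let x , x∈xs = neutral-nonempty N
        e₁ , b₁ = one (regular⇒⊢ R) _ γ (χ (binary , binary)) y∈ys (λ h → n (trans (sym h) (All.lookup col y∈ws)))
        e₂ , b₂ = one (neutral⇒⊢ N) _ γ (χ (binary , binary)) x∈xs (λ h → n (trans (sym h) (All.lookup col (g x∈xs))))
    in just (upsˡ e₂) , just (upsʳ e₁) , (λ h → upsˡ≢upsʳ e₂ e₁ (just-injective h)) , bad-left χ γ p b₂ , bad-right χ γ p b₁
  two (lam R) zs {ws} refl m χ γ {c} p col {i} q ne p≢c with χ (unary , unary) ≟ c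
  ... | yes refl =
    let e₁ , b₁ = one (regular⇒⊢ R) _ (extend (χ (unary , unary)) γ) (χ (unary , unary)) (there (∈-map⁺ suc (∈-++⁺ˡ q))) ne in
    nothing , just (ups e₁) , (λ ()) , p≢c , bad-down χ γ p b₁
  ... | no n =
    let e₁ , e₂ , d , b₁ , b₂ = two R (zero ∷ map suc zs) (cong (zero ∷_) (List.map-++ suc zs ws))
          (s≤s (ℕ.≤-trans (ℕ.≤-reflexive (List.length-map suc zs)) m)) (χ ∘ map₂ down) (extend (χ (unary , unary)) γ)
          (χ (unary , unary)) (coloured-suc col) (there (∈-map⁺ suc q)) ne n
    in just (ups e₁) , just (ups e₂) , just-≢ ups-inj d , bad-down χ γ p b₁ , bad-down χ γ p b₂

  three-down : ∀ {u : Term (suc k)} (χ : Inner (Sk (lam u)) → K) (γ : Fin k → K) p →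
               Three u (χ ∘ map₂ down) (extend (χ (unary , unary)) γ) (χ (unary , unary)) → Three (lam u) χ γ p
  three-down χ γ p (e , f , g , a , b , c , x , y , z) = just (ups e) , just (ups f) , just (ups g) ,
    just-≢ ups-inj a , just-≢ ups-inj b , just-≢ ups-inj c , bad-down χ γ p x , bad-down χ γ p y , bad-down χ γ p z

  three-left : ∀ {u v : Term k} (χ : Inner (Sk (app u v)) → K) (γ : Fin k → K) p →
               Three u (χ ∘ map₂ left) γ (χ (binary , binary)) → Three (app u v) χ γ p
  three-left χ γ p (e , f , g , a , b , c , x , y , z) = just (upsˡ e) , just (upsˡ f) , just (upsˡ g) ,
    just-≢ upsˡ-inj a , just-≢ upsˡ-inj b , just-≢ upsˡ-inj c , bad-left χ γ p x , bad-left χ γ p y , bad-left χ γ p z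

  three-right : ∀ {u v : Term k} (χ : Inner (Sk (app u v)) → K) (γ : Fin k → K) p →
                Three v (χ ∘ map₂ right) γ (χ (binary , binary)) → Three (app u v) χ γ p
  three-right χ γ p (e , f , g , a , b , c , x , y , z) = just (upsʳ e) , just (upsʳ f) , just (upsʳ g) ,
    just-≢ upsʳ-inj a , just-≢ upsʳ-inj b , just-≢ upsʳ-inj c , bad-right χ γ p x , bad-right χ γ p y , bad-right χ γ p z

  const-app : ∀ {u v : Term k} (χ : Inner (Sk (app u v)) → K) {p} → χ (binary , binary) ≡ p →
              (∀ x → χ (map₂ left x) ≡ p) → (∀ x → χ (map₂ right x) ≡ p) → ∀ x → χ x ≡ p
  const-app χ e f g (_ , binary)  = e
  const-app χ e f g (a , left n)  = f (a , n)
  const-app χ e f g (a , right n) = g (a , n)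

  const-lam : ∀ {u : Term (suc k)} (χ : Inner (Sk (lam u)) → K) {p} → χ (unary , unary) ≡ p →
              (∀ x → χ (map₂ down x) ≡ p) → ∀ x → χ x ≡ p
  const-lam χ e f (_ , unary)  = e
  const-lam χ e f (a , down n) = f (a , n)

  -- At an application coloured unlike its surroundings, the edge above and one edge in each part
  -- are bad. At such an abstraction, the edge above is bad and `two` supplies the others.
  neutral-colours : Neutral u xs → ∀ χ γ p → Coloured γ p xs → Const u χ γ p ⊎ Three u χ γ p
  regular-colours : Regular j u xs → ∀ χ γ p → Coloured γ p xs → Const u χ γ p ⊎ Three u χ γ p
  app-colours     : Neutral u xs → Regular 0 v ys → ∀ χ γ p → Coloured γ p (ys ++ xs) →
                    Const (app u v) χ γ p ⊎ Three (app u v) χ γ p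

  app-colours {ys = ys} N R χ γ p col with p ≟ χ (binary , binary)
  ... | yes refl with neutral-colours N (χ ∘ map₂ left) γ p (Allₚ.++⁻ʳ ys col) | regular-colours R (χ ∘ map₂ right) γ p (Allₚ.++⁻ˡ ys col)
  ...   | inj₂ t | _      = inj₂ (three-left χ γ p t)
  ...   | inj₁ _ | inj₂ t = inj₂ (three-right χ γ p t)
  ...   | inj₁ f | inj₁ g = inj₁ (const-app χ refl f g)
  app-colours {ys = ys} N R χ γ p col | no n =
    let x , x∈xs = neutral-nonempty N
        y , y∈ys = regular-nonempty R
        e₁ , b₁ = one (neutral⇒⊢ N) (χ ∘ map₂ left) γ (χ (binary , binary)) x∈xs (λ h → n (trans (sym (All.lookup col (∈-++⁺ʳ ys x∈xs))) h))
        e₂ , b₂ = one (regular⇒⊢ R) (χ ∘ map₂ right) γ (χ (binary , binary)) y∈ys (λ h → n (trans (sym (All.lookup col (∈-++⁺ˡ y∈ys))) h))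
    in inj₂ (nothing , just (upsˡ e₁) , just (upsʳ e₂) , (λ ()) , (λ ()) ,
             (λ h → upsˡ≢upsʳ e₁ e₂ (just-injective h)) , n , bad-left χ γ p b₁ , bad-right χ γ p b₂)

  neutral-colours (var _) χ γ p col = inj₁ λ ()
  neutral-colours (app N R refl) χ γ p col = app-colours N R χ γ p col
  regular-colours (var _) χ γ p col = inj₁ λ ()
  regular-colours (app N R _ refl) χ γ p col = app-colours N R χ γ p col
  regular-colours (lam {xs = xs} R) χ γ p col with p ≟ χ (unary , unary)
  ... | yes refl = Sum.map (const-lam χ refl) (three-down χ γ p)
    (regular-colours R (χ ∘ map₂ down) (extend p γ) p (refl ∷ coloured-suc col))
  ... | no n = let e , f , d , b , b′ = two R [ zero ] refl (s≤s z≤n) (χ ∘ map₂ down) (extend (χ (unary , unary)) γ) {p}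
                     (χ (unary , unary)) (coloured-suc col) (here refl) (≢-sym n) (≢-sym n)
    in inj₂ (nothing , just (ups e) , just (ups f) , (λ ()) , (λ ()) , just-≢ ups-inj d , n , bad-down χ γ p b , bad-down χ γ p b′)

  LeafEdge : (u : Term k) → Fin k → TreeEdge (Sk u) → Set
  LeafEdge u i e = ∃[ ℓ ] child e ≡ inj₁ ℓ × open-binder u ℓ ≡ inj₁ i

  leaf-down : ∀ {u : Term (suc k)} {i e} → LeafEdge u (suc i) e → LeafEdge (lam u) i (down e)
  leaf-down {u = u} (ℓ , c , b) = down ℓ , cong (Sum.map down (map₂ down)) c , lam-bound u b suc

  BadLeaf : (u : Term k) → Fin k → (Inner (Sk u) → K) → (Fin k → K) → K → Set
  BadLeaf u i χ γ p = ∃[ e ] LeafEdge u i e × Bad u χ γ p (just e)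

  -- The counterpart of `two` for bodies. The argument need not have a variable of colour `c`; the
  -- leaf edge of `x` may then be the only bad edge found, but all of `zs` differ from `c`.
  body-two : Body u xs → ∀ zs {x} → xs ≡ zs ++ [ x ] → ∀ χ γ {c} p → γ x ≡ c → ∀ {i} → i ∈ zs → γ i ≢ c → p ≢ c →
             Two u χ γ p ⊎ All (λ i → γ i ≢ c) zs × BadLeaf u x χ γ p
  body-two (app {ys = ys} R refl) zs e χ γ {c} p col q ne p≢c with List.∷ʳ-injective ys zs e | χ (binary , binary) ≟ c
  ... | refl , refl | yes refl =
    let e₁ , b₁ = one (regular⇒⊢ R) (χ ∘ map₂ right) γ (χ (binary , binary)) q ne in
    inj₁ (nothing , just (upsʳ e₁) , (λ ()) , p≢c , bad-right χ γ p b₁)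
  ... | refl , refl | no n with All.all? (λ i → γ i ≟ χ (binary , binary)) ys
  ...   | yes same = inj₂ (All.map (λ h h′ → n (trans (sym h) h′)) same , belowˡ , (left here , refl , refl) , λ h → n (trans h col))
  ...   | no diff =
    let y , y∈ys , h = find (Allₚ.¬All⇒Any¬ (λ i → γ i ≟ χ (binary , binary)) ys diff)
        e₁ , b₁ = one (regular⇒⊢ R) (χ ∘ map₂ right) γ (χ (binary , binary)) y∈ys h
    in inj₁ (just belowˡ , just (upsʳ e₁) , (λ h′ → upsˡ≢upsʳ nothing e₁ (just-injective h′)) , (λ h′ → n (trans h′ col)) , bad-right χ γ p b₁)
  body-two (lam B) zs {x} refl χ γ {c} p col q ne p≢c with χ (unary , unary) ≟ c
  ... | yes refl =
    let e₁ , b₁ = one (body⇒⊢ B) (χ ∘ map₂ down) (extend (χ (unary , unary)) γ) (χ (unary , unary)) (there (∈-map⁺ suc (∈-++⁺ˡ q))) ne in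
    inj₁ (nothing , just (ups e₁) , (λ ()) , p≢c , bad-down χ γ p b₁)
  ... | no n with body-two B (zero ∷ map suc zs) {suc x} (cong (zero ∷_) (List.map-++ suc zs _)) (χ ∘ map₂ down)
                    (extend (χ (unary , unary)) γ) (χ (unary , unary)) col (there (∈-map⁺ suc q)) ne n
  ...   | inj₁ (e₁ , e₂ , d , b₁ , b₂) = inj₁ (just (ups e₁) , just (ups e₂) , just-≢ ups-inj d , bad-down χ γ p b₁ , bad-down χ γ p b₂)
  ...   | inj₂ (_ ∷ al , e₁ , le , b₁) = inj₂ (Allₚ.map⁻ al , down e₁ , leaf-down {e = e₁} le , bad-down χ γ p {just e₁} b₁)

  -- The last alternative is the exempted cut, formed by the edge below the outermost abstraction
  -- and the edge of the atom that it binds. It requires `x` to be the only free variable.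
  body-colours : Body u xs → ∀ zs {x} → xs ≡ zs ++ [ x ] → ∀ χ γ p → Coloured γ p xs →
                 Const u χ γ p ⊎ Three u χ γ p ⊎ (zs ≡ [] × Bad u χ γ p nothing × BadLeaf u x χ γ p)
  body-colours (app {ys = ys} R refl) zs e χ γ p col with app-colours (var refl) R χ γ p col
  ... | inj₁ c = inj₁ c
  ... | inj₂ t = inj₂ (inj₁ t)
  body-colours (lam B) zs {x} refl χ γ p col with p ≟ χ (unary , unary)
  ... | yes refl with body-colours B (zero ∷ map suc zs) {suc x} (cong (zero ∷_) (List.map-++ suc zs _)) (χ ∘ map₂ down)
                        (extend p γ) p (refl ∷ coloured-suc col)
  ...   | inj₁ c        = inj₁ (const-lam χ refl c)
  ...   | inj₂ (inj₁ t) = inj₂ (inj₁ (three-down χ γ p t))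
  ...   | inj₂ (inj₂ (() , _))
  body-colours (lam B) zs {x} refl χ γ p col | no n
    with body-two B (zero ∷ map suc zs) {suc x} (cong (zero ∷_) (List.map-++ suc zs _)) (χ ∘ map₂ down) (extend (χ (unary , unary)) γ) {p}
           (χ (unary , unary)) (All.lookup col (∈-++⁺ʳ zs (here refl))) (here refl) (≢-sym n) (≢-sym n)
  ... | inj₁ (e₁ , e₂ , d , b₁ , b₂) = inj₂ (inj₁ (nothing , just (ups e₁) , just (ups e₂) , (λ ()) , (λ ()) , just-≢ ups-inj d ,
                                         n , bad-down χ γ p b₁ , bad-down χ γ p b₂))
  ... | inj₂ (_ ∷ al , e₁ , le , b₁) = inj₂ (inj₂ (none zs (Allₚ.map⁻ al) col , n , down e₁ , leaf-down {e = e₁} le , bad-down χ γ p {just e₁} b₁))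
    where
    none : ∀ zs {ws} → All (λ i → γ i ≢ p) zs → Coloured γ p (zs ++ ws) → zs ≡ []
    none [] _ _ = refl
    none (_ ∷ _) (h ∷ _) (h′ ∷ _) = contradiction h′ h

-- 3-connectedness of closed terms of the form `Body`

module _ {K : Set} (t : Term 0) (χ : Inner (Sk t) → K) (γ : Fin 0 → K) where

  open Multigraph (Diag t)
  open Coloured {K}

  colour-end₂ : ∀ e → χ (end₂ e) ≡ out t χ γ (child e)
  colour-end₂ e with child e
  ... | inj₂ _ = refl
  ... | inj₁ ℓ = sym (cong [ γ , (λ a → χ (unary , a)) ]′ (binder-closed t ℓ))

module _ {u : Term 1} (B : Body u [ zero ]) where

  private
    t : Term 0
    t = lam u

  open Multigraph (Diag t)
  open BadEdges (_≟ᴵ_ {Sk t})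

  leaf-at-root : ∀ {e} → LeafEdge u zero e → (unary , unary) ∈ends (down e)
  leaf-at-root {e} (ℓ , c , b) = inj₂ (trans (cong ([ (λ ℓ → unary , binder t ℓ) , id ]′ ∘ Sum.map down (map₂ down)) c)
    (cong (unary ,_) (Sumₚ.inj₂-injective (trans (sym (binder-closed t (down ℓ))) (lam-bound u b zero)))))

  body⇒threeConnected : ThreeConnected t
  body⇒threeConnected e f e≢f free = connect (body-colours B [] refl (comp ∘ map₂ down) γ (comp (unary , unary)) (refl ∷ []))
    where
    Kept : TreeEdge (Sk t) → Set
    Kept g = g ≢ e × g ≢ f
    kept? : Decidable Kept
    kept? g = ¬? (g ≟ᴱ e) ×-dec ¬? (g ≟ᴱ f)
    open Components (components _≟ᴵ_ end₁ end₂ (filter kept? (treeEdges (Sk t))))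
    γ : Fin 1 → Inner (Sk t)
    γ = extend (comp (unary , unary)) λ ()
    bad⇒removed : ∀ g → Bad u (comp ∘ map₂ down) γ (comp (unary , unary)) g → ups g ≡ e ⊎ ups g ≡ f
    bad⇒removed g b with ups g ≟ᴱ e | ups g ≟ᴱ f
    ... | yes p | _     = inj₁ p
    ... | no  _ | yes q = inj₂ q
    ... | no  p | no  q = contradiction
      (trans (const (∈-filter⁺ kept? (∈-treeEdges (ups g)) (p , q))) (colour-end₂ t comp (λ ()) (ups g)))
      (bad-down comp (λ ()) (comp (unary , unary)) {g} b)
    Step : Inner (Sk t) → Inner (Sk t) → Set
    Step x y = ∃[ g ] (g ≢ e × g ≢ f) × end₁ g ≡ x × end₂ g ≡ y
    to-comp : ∀ x → EqClosure Step x (comp x)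
    to-comp x = EqC.map (λ (g , p , q) → g , proj₂ (∈-filter⁻ kept? {xs = treeEdges (Sk t)} p) , q) (joined x)
    three≰two : ∀ {a b c} → a ≢ b → a ≢ c → b ≢ c → a ≡ e ⊎ a ≡ f → b ≡ e ⊎ b ≡ f → c ≡ e ⊎ c ≡ f → ⊥
    three≰two p q r (inj₁ x) (inj₁ y) _ = p (trans x (sym y))
    three≰two p q r (inj₁ x) (inj₂ y) (inj₁ z) = q (trans x (sym z))
    three≰two p q r (inj₁ x) (inj₂ y) (inj₂ z) = r (trans y (sym z))
    three≰two p q r (inj₂ x) (inj₁ y) (inj₁ z) = r (trans y (sym z))
    three≰two p q r (inj₂ x) (inj₁ y) (inj₂ z) = q (trans x (sym z))
    three≰two p q r (inj₂ x) (inj₂ y) _ = p (trans x (sym y))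
    connect : _ → ∀ x y → EqClosure Step x y
    connect (inj₁ same) x y = EqC.transitive _ (to-comp x) (subst (λ z → EqClosure Step z y) (sym (trans (all x) (sym (all y)))) (EqC.symmetric _ (to-comp y)))
      where
      all : ∀ x → comp x ≡ comp (unary , unary)
      all = const-lam comp refl same
    connect (inj₂ (inj₁ (a , b , c , p , q , r , x , y , z))) = ⊥-elim (three≰two (p ∘ ups-inj) (q ∘ ups-inj) (r ∘ ups-inj)
      (bad⇒removed a x) (bad⇒removed b y) (bad⇒removed c z))
    connect (inj₂ (inj₂ (_ , b , g , le , b′))) with bad⇒removed nothing b | bad⇒removed (just g) b′
    ... | inj₁ refl | inj₁ ()
    ... | inj₂ refl | inj₂ ()
    ... | inj₁ refl | inj₂ refl = contradiction (⊢⇒linear (lam (body⇒⊢ B)) unary , inj₁ refl , leaf-at-root {g} le) free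
    ... | inj₂ refl | inj₁ refl = contradiction (⊢⇒linear (lam (body⇒⊢ B)) unary , leaf-at-root {g} le , inj₁ refl) free

open Coloured {Bool}

-- Two-edge cuts

Painted : ∀ {k} → (Fin k → Bool) → Bool → List (Fin k) → Set
Painted γ b = All (λ i → γ i ≡ b)

paint-lam : ∀ {s} → Bool → (Inner s → Bool) → Inner (unary s) → Bool
paint-lam b χ (_ , unary)  = b
paint-lam b χ (a , down n) = χ (a , n)

paint-app : ∀ {s r} → Bool → (Inner s → Bool) → (Inner r → Bool) → Inner (binary s r) → Bool
paint-app b χ χ′ (_ , binary)  = b
paint-app b χ χ′ (a , left n)  = χ (a , n)
paint-app b χ χ′ (a , right n) = χ′ (a , n)

mono-const : ∀ {k} {u : Term k} {xs} → u ⊢ xs → ∀ γ b → Painted γ b xs → ∀ g → Mono u (λ _ → b) γ b g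
mono-const {u = u} D γ b col = λ where
    nothing  → sym (out-const (root (Sk u)))
    (just e) → sym (out-const (child e))
  where
  out-const : ∀ x → out u (λ _ → b) γ x ≡ b
  out-const (inj₂ _) = refl
  out-const (inj₁ ℓ) with open-binder u ℓ in eq
  ... | inj₁ i = All.lookup col (free-occurs D ℓ eq)
  ... | inj₂ _ = refl

end : ∀ {s} → Maybe (TreeEdge s) → Leaf s ⊎ Inner s
end {s} nothing  = root s
end     (just e) = child e

ToInner : ∀ {s} → Maybe (TreeEdge s) → Set
ToInner e = ∃[ y ] end e ≡ inj₂ y

inner-down : ∀ {s} (e : Maybe (TreeEdge s)) → ToInner e → ToInner (just (ups e))
inner-down nothing  (y , q) = _ , cong (Sum.map down (map₂ down)) q
inner-down (just e) (y , q) = _ , cong (Sum.map down (map₂ down)) q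

inner-left : ∀ {s r} (e : Maybe (TreeEdge s)) → ToInner e → ToInner (just (upsˡ {s} {r} e))
inner-left nothing  (y , q) = _ , cong (Sum.map left (map₂ left)) q
inner-left (just e) (y , q) = _ , cong (Sum.map left (map₂ left)) q

inner-right : ∀ {s r} (e : Maybe (TreeEdge r)) → ToInner e → ToInner (just (upsʳ {s} {r} e))
inner-right nothing  (y , q) = _ , cong (Sum.map right (map₂ right)) q
inner-right (just e) (y , q) = _ , cong (Sum.map right (map₂ right)) q

data Ups {s} : Maybe (TreeEdge (unary s)) → Set where
  nothing : Ups nothing
  lift    : ∀ e → Ups (just (ups e))

ups-view : ∀ {s} (g : Maybe (TreeEdge (unary s))) → Ups g
ups-view nothing         = nothing
ups-view (just below)    = lift nothing
ups-view (just (down e)) = lift (just e)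

data Ups₂ {s r} : Maybe (TreeEdge (binary s r)) → Set where
  nothing : Ups₂ nothing
  liftˡ   : ∀ e → Ups₂ (just (upsˡ e))
  liftʳ   : ∀ e → Ups₂ (just (upsʳ e))

ups₂-view : ∀ {s r} (g : Maybe (TreeEdge (binary s r))) → Ups₂ g
ups₂-view nothing          = nothing
ups₂-view (just belowˡ)    = liftˡ nothing
ups₂-view (just belowʳ)    = liftʳ nothing
ups₂-view (just (left e))  = liftˡ (just e)
ups₂-view (just (right e)) = liftʳ (just e)

-- Two edges separating some nodes of u from the rest of any term containing u.
record Cut {k} (u : Term k) (xs : List (Fin k)) : Set where
  field
    χ      : Inner (Sk u) → Bool
    e f    : Maybe (TreeEdge (Sk u))
    e≢f    : e ≢ f
    deep   : ToInner e
    mono   : ∀ γ → Painted γ false xs → ∀ g → g ≢ e → g ≢ f → Mono u χ γ false g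
    marked : ∃[ x ] χ x ≡ true

-- The same for λy₁…yₘ. u, where one of the edges is the one above y₁.
record Partial {k} (m : ℕ) (u : Term k) (xs : List (Fin k)) : Set where
  field
    χ    : Inner (Sk u) → Bool
    f    : TreeEdge (Sk u)
    top  : ∃[ y ] root (Sk u) ≡ inj₂ y × χ y ≡ true
    mono : ∀ γ → Painted γ true (take m xs) → Painted γ false (drop m xs) → ∀ g → g ≢ just f → Mono u χ γ true g

open Cut
open Partial

partial⇒cut : ∀ {k} {u : Term k} {xs} → Partial 0 u xs → Cut u xs
partial⇒cut P = record
  { χ = χ P ; e = nothing ; f = just (f P) ; e≢f = λ () ; deep = _ , proj₁ (proj₂ (top P))
  ; mono = λ where
      γ col nothing  n _ → contradiction refl n
      γ col (just g) _ n → mono P γ [] col (just g) n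
  ; marked = _ , proj₂ (proj₂ (top P)) }

partial-lam : ∀ {k m} {u : Term (suc k)} {xs} → Partial (suc m) u (zero ∷ map suc xs) → Partial m (lam u) xs
partial-lam {m = m} {u} {xs} P = record
  { χ = χ′ ; f = down (f P) ; top = _ , refl , refl ; mono = mono′ }
  where
  χ′ = paint-lam true (χ P)
  mono′ : ∀ γ → Painted γ true (take m xs) → Painted γ false (drop m xs) → ∀ g → g ≢ just (down (f P)) → Mono (lam u) χ′ γ true g
  mono′ γ col col′ g n with ups-view g
  ... | nothing = refl
  ... | lift h = subst id (sym (mono-down χ′ γ true h)) (mono P (extend true γ)
    (refl ∷ subst (Painted (extend true γ) true) (sym (List.take-map m xs)) (Allₚ.map⁺ col))
    (subst (Painted (extend true γ) false) (sym (List.drop-map m xs)) (Allₚ.map⁺ col′)) h λ where refl → n refl)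

cut-lam : ∀ {k} {u : Term (suc k)} {xs} → Cut u (zero ∷ map suc xs) → Cut (lam u) xs
cut-lam {u = u} {xs} C = record
  { χ = χ′ ; e = just (ups (e C)) ; f = just (ups (f C)) ; e≢f = just-≢′ (e≢f C) ; deep = inner-down (e C) (deep C)
  ; mono = mono′ ; marked = let x , q = marked C in map₂ down x , q }
  where
  χ′ = paint-lam false (χ C)
  just-≢′ : ∀ {x y} → x ≢ y → just (ups x) ≢ just (ups y)
  just-≢′ n q = n (ups-inj (just-injective q))
  mono′ : ∀ γ → Painted γ false xs → ∀ g → g ≢ just (ups (e C)) → g ≢ just (ups (f C)) → Mono (lam u) χ′ γ false g
  mono′ γ col g n n′ with ups-view g
  ... | nothing = refl
  ... | lift h = subst id (sym (mono-down χ′ γ false h))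
    (mono C (extend false γ) (refl ∷ Allₚ.map⁺ col) h (λ where refl → n refl) (λ where refl → n′ refl))

cut-left : ∀ {k} {u v : Term k} {xs ys} → v ⊢ ys → Cut u xs → Cut (app u v) (ys ++ xs)
cut-left {u = u} {v} {xs} {ys} D C = record
  { χ = χ′ ; e = just (upsˡ (e C)) ; f = just (upsˡ (f C)) ; e≢f = λ q → e≢f C (upsˡ-inj (just-injective q))
  ; deep = inner-left (e C) (deep C) ; mono = mono′ ; marked = let x , q = marked C in map₂ left x , q }
  where
  χ′ = paint-app false (χ C) (λ _ → false)
  mono′ : ∀ γ → Painted γ false (ys ++ xs) → ∀ g → g ≢ just (upsˡ (e C)) → g ≢ just (upsˡ (f C)) → Mono (app u v) χ′ γ false g
  mono′ γ col g n n′ with ups₂-view g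
  ... | nothing = refl
  ... | liftˡ h = subst id (sym (mono-left χ′ γ false h)) (mono C γ (Allₚ.++⁻ʳ ys col) h (λ where refl → n refl) (λ where refl → n′ refl))
  ... | liftʳ h = subst id (sym (mono-right χ′ γ false h)) (mono-const D γ false (Allₚ.++⁻ˡ ys col) h)

cut-right : ∀ {k} {u v : Term k} {xs ys} → u ⊢ xs → Cut v ys → Cut (app u v) (ys ++ xs)
cut-right {u = u} {v} {xs} {ys} D C = record
  { χ = χ′ ; e = just (upsʳ (e C)) ; f = just (upsʳ (f C)) ; e≢f = λ q → e≢f C (upsʳ-inj (just-injective q))
  ; deep = inner-right (e C) (deep C) ; mono = mono′ ; marked = let x , q = marked C in map₂ right x , q }
  where
  χ′ = paint-app false (λ _ → false) (χ C)
  mono′ : ∀ γ → Painted γ false (ys ++ xs) → ∀ g → g ≢ just (upsʳ (e C)) → g ≢ just (upsʳ (f C)) → Mono (app u v) χ′ γ false g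
  mono′ γ col g n n′ with ups₂-view g
  ... | nothing = refl
  ... | liftʳ h = subst id (sym (mono-right χ′ γ false h)) (mono C γ (Allₚ.++⁻ˡ ys col) h (λ where refl → n refl) (λ where refl → n′ refl))
  ... | liftˡ h = subst id (sym (mono-left χ′ γ false h)) (mono-const D γ false (Allₚ.++⁻ʳ ys col) h)

closed-root : ∀ {k} {v : Term k} → v ⊢ [] → ∃[ y ] root (Sk v) ≡ inj₂ y
closed-root (app _ _ _) = _ , refl
closed-root (lam _)     = _ , refl

-- The edge above a closed argument separates it by itself; `belowˡ` merely fills the second place.
cut-closed : ∀ {k} {u v : Term k} {xs} → u ⊢ xs → v ⊢ [] → Cut (app u v) xs
cut-closed {u = u} {v} {xs} D E = record
  { χ = χ′ ; e = just belowʳ ; f = just belowˡ ; e≢f = λ () ; deep = inner-right nothing (closed-root E)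
  ; mono = mono′ ; marked = let y , _ = closed-root E in map₂ right y , refl }
  where
  χ′ = paint-app false (λ _ → false) (λ _ → true)
  mono′ : ∀ γ → Painted γ false xs → ∀ g → g ≢ just belowʳ → g ≢ just belowˡ → Mono (app u v) χ′ γ false g
  mono′ γ col g n n′ with ups₂-view g
  ... | nothing       = refl
  ... | liftˡ h        = subst id (sym (mono-left χ′ γ false h)) (mono-const D γ false col h)
  ... | liftʳ nothing  = contradiction refl n
  ... | liftʳ (just h) = subst id (sym (mono-right χ′ γ false (just h))) (mono-const E γ true [] (just h))

take-drop : ∀ {A : Set} (ys xs : List A) → take (length ys) (ys ++ xs) ≡ ys × drop (length ys) (ys ++ xs) ≡ xs
take-drop []       xs = refl , refl
take-drop (y ∷ ys) xs with take-drop ys xs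
... | p , q = cong (y ∷_) p , q

-- The edge to the function part of an application and, above the abstractions
-- binding all free variables of the argument, the edge to the whole.
partial-app : ∀ {k} {u v : Term k} {xs ys} → u ⊢ xs → v ⊢ ys → Partial (length ys) (app u v) (ys ++ xs)
partial-app {u = u} {v} {xs} {ys} D E = record
  { χ = χ′ ; f = belowˡ ; top = _ , refl , refl
  ; mono = λ γ col col′ → mono′ γ (subst (Painted γ true) (proj₁ (take-drop ys xs)) col) (subst (Painted γ false) (proj₂ (take-drop ys xs)) col′) }
  where
  χ′ = paint-app true (λ _ → false) (λ _ → true)
  mono′ : ∀ γ → Painted γ true ys → Painted γ false xs → ∀ g → g ≢ just belowˡ → Mono (app u v) χ′ γ true g
  mono′ γ col col′ g n with ups₂-view g
  ... | nothing       = refl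
  ... | liftˡ nothing  = contradiction refl n
  ... | liftˡ (just h) = subst id (sym (mono-left χ′ γ true (just h))) (mono-const D γ false col′ (just h))
  ... | liftʳ h        = subst id (sym (mono-right χ′ γ true h)) (mono-const E γ true col h)

NoRedex : ∀ {k} → Term k → Set
NoRedex t = ∀ {j} (u : Term (suc j)) v → ¬ (app (lam u) v ⊑ t)

head-not-lam : ∀ {k} {u v : Term k} → NoRedex (app u v) → ∀ w → u ≢ lam w
head-not-lam nr w refl = nr w _ here

record Uncut {k} (j : ℕ) (u : Term k) (xs : List (Fin k)) : Set where
  field
    no-cut     : ¬ Cut u xs
    no-partial : ∀ m → m < j → ¬ Partial (suc m) u xs

open Uncut

⊢⇒neutral : ∀ {k} {u : Term k} {xs} → u ⊢ xs → NoRedex u → (∀ w → u ≢ lam w) → ¬ Cut u xs → Neutral u xs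
-- The second case comes from a variable below abstractions. For `j = 0` it says that the term is
-- closed, which `argument` excludes by `cut-closed`.
⊢⇒regular : ∀ {k} j {u : Term k} {xs} → u ⊢ xs → NoRedex u → Uncut j u xs → Regular j u xs ⊎ length xs ≤ j

argument : ∀ {k} {u v : Term k} {xs ys} → u ⊢ xs → v ⊢ ys → NoRedex v → ¬ Cut (app u v) (ys ++ xs) → Regular 0 v ys

⊢⇒neutral (var e) _ _ _ = var e
⊢⇒neutral (lam _) _ n _ = contradiction refl (n _)
⊢⇒neutral (app D E refl) nr _ nc =
  app (⊢⇒neutral D (λ u v → nr u v ∘ appˡ) (head-not-lam nr) (nc ∘ cut-left E)) (argument D E (λ u v → nr u v ∘ appʳ) nc) refl

argument {ys = []} D E _ nc = contradiction (cut-closed D E) nc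
argument {ys = _ ∷ _} D E nr nc with ⊢⇒regular 0 E nr (record { no-cut = nc ∘ cut-right D ; no-partial = λ _ () })
... | inj₁ R = R

⊢⇒regular zero    (var refl) _ _ = inj₁ (var refl)
⊢⇒regular (suc j) (var refl) _ _ = inj₂ (s≤s z≤n)
⊢⇒regular j (lam {xs = xs} D) nr U = Sum.map lam (λ l → ℕ.≤-pred (ℕ.≤-trans (ℕ.≤-reflexive (cong suc (sym (List.length-map suc xs)))) l))
  (⊢⇒regular (suc j) D (λ u v → nr u v ∘ lam) record
    { no-cut = no-cut U ∘ cut-lam
    ; no-partial = λ where
        zero    _       P → no-cut U (partial⇒cut (partial-lam P))
        (suc m) (s≤s l) P → no-partial U m l (partial-lam P) })
⊢⇒regular j (app {u = u} {v} {xs} {ys} D E refl) nr U with j <? length ys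
... | yes l = inj₁ (app (⊢⇒neutral D (λ u v → nr u v ∘ appˡ) (head-not-lam nr) (no-cut U ∘ cut-left E))
                        (argument D E (λ u v → nr u v ∘ appʳ) (no-cut U)) l refl)
... | no ¬l = contradiction (partial-app D E) (excluded (length ys) (ℕ.≮⇒≥ ¬l))
  where
  excluded : ∀ m → m ≤ j → ¬ Partial m (app u v) (ys ++ xs)
  excluded zero    _ = no-cut U ∘ partial⇒cut
  excluded (suc m) l = no-partial U m l

-- Here `u` lies below the outermost abstraction and `j` more. The exemption may apply to cuts
-- through the edge just below the outermost one, so these are left out: `e` lies inside `u`, and
-- `Partial j` is not excluded.
record RootUncut {k} (j : ℕ) (u : Term k) (xs : List (Fin k)) : Set where
  field
    no-inner   : (C : Cut u xs) → ∀ {g} → e C ≡ just g → ⊥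
    no-partial : ∀ m → m < j → ¬ Partial m u xs

open RootUncut

neutral-length : ∀ {k} {u : Term k} {xs} → Neutral u xs → 0 < length xs
neutral-length (var refl) = s≤s z≤n
neutral-length (app {xs = xs} {ys} N R refl) = subst (0 <_) (sym (List.length-++ ys)) (ℕ.<-≤-trans (neutral-length N) (ℕ.m≤n+m (length xs) (length ys)))

-- If the function part were an application, it would have at least two free variables and leave
-- fewer than `j` to the argument; `partial-app` would then give a cut away from the root. The last
-- hypothesis excludes `λx. x`.
⊢⇒body : ∀ {k} j {u : Term k} {xs} → u ⊢ xs → NoRedex u → RootUncut j u xs → length xs ≡ suc j →
         (j ≡ 0 → ∀ i → u ≢ var i) → Body u xs
⊢⇒body j (var refl) _ _ l nv = contradiction refl (nv (ℕ.suc-injective (sym l)) _)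
⊢⇒body j (lam {u = u} {xs} D) nr U l _ = lam (⊢⇒body (suc j) D (λ u v → nr u v ∘ lam) (record
  { no-inner = λ C _ → no-inner U (cut-lam C) refl
  ; no-partial = λ where
      zero    _       P → no-inner U (cut-lam (partial⇒cut P)) refl
      (suc m) (s≤s h) P → no-partial U m h (partial-lam P)
  }) (cong suc (trans (List.length-map suc xs) l)) λ ())
⊢⇒body j (app {u = u} {xs = xs} {ys} D E refl) nr U l _
  with ⊢⇒neutral D (λ u v → nr u v ∘ appˡ) (head-not-lam nr) (λ C → no-inner U (cut-left E C) refl)
... | var refl = app (last-argument ys refl) refl
  where
  last-argument : ∀ zs → zs ≡ ys → Regular 0 _ ys
  last-argument [] refl = ⊥-elim (no-inner U (cut-closed D E) refl)
  last-argument (_ ∷ _) refl with ⊢⇒regular 0 E (λ u v → nr u v ∘ appʳ) (record { no-cut = λ C → no-inner U (cut-right D C) refl ; no-partial = λ _ () })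
  ... | inj₁ R = R
... | app {xs = ws} {ys = vs} N R refl = contradiction (partial-app D E) (no-partial U (length ys) (ℕ.≤-pred (ℕ.≤-trans bound (ℕ.≤-reflexive l))))
  where
  bound : suc (suc (length ys)) ≤ length (ys ++ (vs ++ ws))
  bound = ℕ.≤-trans (ℕ.≤-reflexive (ℕ.+-comm 2 (length ys))) (ℕ.≤-trans
    (ℕ.+-monoʳ-≤ (length ys) (ℕ.≤-trans
      (ℕ.+-mono-≤ (ℕ.≤-trans (s≤s z≤n) (ℕ.≤-reflexive (sym (length-code R)))) (neutral-length N))
      (ℕ.≤-reflexive (sym (List.length-++ vs)))))
    (ℕ.≤-reflexive (sym (List.length-++ ys))))

-- Without redexes and without an abstraction in front, the term has a head variable, which is free.
neutral-open : ∀ {k} {u : Term k} {xs} → u ⊢ xs → NoRedex u → (∀ w → u ≢ lam w) → xs ≢ []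
neutral-open (var refl) _ _ ()
neutral-open (lam _) _ n _ = n _ refl
neutral-open (app {ys = ys} D E refl) nr _ q =
  neutral-open D (λ u v → nr u v ∘ appˡ) (head-not-lam nr) (List.++-conicalʳ ys _ q)

module _ {u : Term 1} where

  private
    t : Term 0
    t = lam u

  open Multigraph (Diag t)

  threeConnected⇒uncut : ThreeConnected t → RootUncut 0 u [ zero ]
  threeConnected⇒uncut tc = record { no-inner = refute ; no-partial = λ _ () }
    where
    -- This is the purpose of `deep`: a skeleton edge between two inner nodes below the root does
    -- not touch the root, so the cut is not the exempted one.
    off-root : ∀ {g} → ToInner (just g) → ¬ ((unary , unary) ∈ends (down g))
    off-root _ (inj₁ ())
    off-root {g} (y , q) (inj₂ h) rewrite q = contradiction h λ ()
    refute : (C : Cut u [ zero ]) → ∀ {g} → e C ≡ just g → ⊥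
    refute C {g} refl with marked C
    ... | x , q = contradiction (trans (separates root-to-x) q) λ ()
      where
      L : Cut t []
      L = cut-lam C
      Step : Inner (Sk t) → Inner (Sk t) → Set
      Step x y = ∃[ g ] (g ≢ ups (e C) × g ≢ ups (f C)) × end₁ g ≡ x × end₂ g ≡ y
      root-to-x : EqClosure Step (unary , unary) (map₂ down x)
      root-to-x = tc (ups (e C)) (ups (f C)) (λ h → e≢f C (ups-inj h)) (λ (_ , h , _) → off-root {g} (deep C) h) _ _
      same : ∀ {x y} → Step x y → χ L x ≡ χ L y
      same (g , (n , n′) , refl , refl) = trans (mono L (λ ()) [] (just g) (n ∘ just-injective) (n′ ∘ just-injective))
        (sym (colour-end₂ t (χ L) (λ ()) g))
      separates : ∀ {x y} → EqClosure Step x y → χ L x ≡ χ L y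
      separates = EqC.gfold isEquivalence (χ L) same

threeConnected⇒body : ∀ (t : Term 0) → t ⊢ [] → Normal t → ThreeConnected t → 2 ≤ size t → Body t []
threeConnected⇒body (app u v) D nr tc l = contradiction refl (neutral-open D nr λ _ ())
threeConnected⇒body (lam u) (lam D) nr tc l = lam (⊢⇒body 0 D (λ u v → nr u v ∘ lam) (threeConnected⇒uncut tc) refl
  λ _ i q → contradiction l (subst (λ w → ¬ 2 ≤ size (lam w)) (sym q) λ where (s≤s ())))

-- The bijection through codes

open 3ConnectedPlanarLinearNormalTerm

term-body : ∀ {n} → n ≥ 2 → (T : 3ConnectedPlanarLinearNormalTerm n) → Body (term T) []
term-body n≥2 T = threeConnected⇒body (term T) (planar⇒⊢ (planar T)) (normal T) (threeConnected T)
  (ℕ.≤-trans n≥2 (ℕ.≤-reflexive (sym (size≡n T))))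

body-term : ∀ {n t} → Body t [] → size t ≡ n → Σ (3ConnectedPlanarLinearNormalTerm n) λ T → term T ≡ t
body-term (app {ys = []} _ ()) _
body-term (app {ys = _ ∷ _} _ ()) _
body-term B@(lam B′) e = record
  { term = _ ; linear = ⊢⇒linear (body⇒⊢ B) ; normal = body-normal B ; planar = ⊢⇒planar (body⇒⊢ B)
  ; threeConnected = body⇒threeConnected B′ ; size≡n = e } , refl

map-of-cong : ∀ {m k k′} (e : edges k ≡ m) (e′ : edges k′ ≡ m) → k ≡ k′ →
              proj₁ (CodeMap.map-of k e) ≅ proj₁ (CodeMap.map-of k′ e′)
map-of-cong refl refl refl = ≅-refl

theorem1 : ∀ (n : ℕ) → n ≥ 2 → Bijection (Terms n) (BipartiteMaps (n ∸ 2))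
theorem1 n n≥2 = record
  { to        = λ T → CodeMap.map-of (code-of-term T) (edges-of-term T)
  ; cong      = λ {T} {T′} e → map-of-cong (edges-of-term T) (edges-of-term T′) (code-cong T T′ e)
  ; bijective = (λ {T} {T′} h → code-inj T T′ (map-injective _ _ (edges-of-term T) (edges-of-term T′) h)) , surjective
  }
  where
  code-of-term : 3ConnectedPlanarLinearNormalTerm n → Code
  code-of-term T = code-body (term-body n≥2 T)
  edges-of-term : ∀ T → edges (code-of-term T) ≡ n ∸ 2
  edges-of-term T = cong (_∸ 2) (trans (sym (size-body (term-body n≥2 T))) (size≡n T))
  code-cong : ∀ T T′ → term T ≡ term T′ → code-of-term T ≡ code-of-term T′
  code-cong T T′ e = same e (term-body n≥2 T) (term-body n≥2 T′)
    where
    same : ∀ {t t′} → t ≡ t′ → (B : Body t []) (B′ : Body t′ []) → code-body B ≡ code-body B′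
    same refl B B′ = code-body-functional B B′
  code-inj : ∀ T T′ → code-of-term T ≡ code-of-term T′ → term T ≡ term T′
  code-inj T T′ = code-body-injective (term-body n≥2 T) (term-body n≥2 T′)
  surjective : ∀ y → Σ _ λ T → ∀ {T′} → term T′ ≡ term T → proj₁ (CodeMap.map-of (code-of-term T′) (edges-of-term T′)) ≅ proj₁ y
  surjective y with map-surjective y
  -- The abstractions bind `x` and the `deg k + 1` free variables of its argument, hence
  -- `deg k + 2`.
  ... | k , e , h with build-body k (suc (suc (deg k))) [] refl
  ...   | t , B , q with body-term B (trans (size-body B) (trans (cong (λ c → 2 + edges c) q) (trans (cong (2 +_) e) (ℕ.m+[n∸m]≡n n≥2))))
  ...     | T , refl = T , λ {T′} e′ → ≅-trans
    (map-of-cong (edges-of-term T′) e (trans (code-cong T′ T e′) (trans (code-body-functional (term-body n≥2 T) B) q))) h
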